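{- Let $\lambda/\mu$ be a skew shape and let $\alpha$ be the weak composition given by $\alpha_i=\lambda'_i-\mu'_i$. Then $$\mathrm{E}_{\lambda/\mu}(\mathbf{x};q,0)=\sum_{\nu\vdash|\lambda/\mu|}\mathrm{s}_{\nu'}(\mathbf{x})\sum_{T\in\mathrm{SSYT}(\nu,\alpha)}q^{\mathrm{charge}_{\mu'}(T)}.$$
   Context: $\lambda'$ denotes the conjugate partition and $\mathrm{s}_\nu$ the Schur function in $\mathbf{x}=(x_1,x_2,\dots)$. $\mathrm{SSYT}(\nu,\alpha)$ is the set of semistandard Young tableaux of shape $\nu$ having exactly $\alpha_i$ entries equal to $i$ for each $i$. Diagrams are in English notation with matrix coordinates: box $(i,j)$ lies in row $i$ (from the top) and column $j$ (from the left). Skew specialized Macdonald fillings. Let $F$ be a filling of the skew shape $\lambda/\mu$ with positive integers. A triple consists of boxes $a,b,c$ with $b,c\in\lambda/\mu$, $c$ somewhere below $b$ in the same column, and $a$ the position immediately to the left of $b$; $a$ may lie outside $\lambda/\mu$ (in $\mu$), in which case it is given value $\infty$. If $a\in\lambda/\mu$, the triple is an inversion-triple if $F(b)\le F(a)<F(c)$, or $F(a)<F(c)<F(b)$, or $F(c)<F(b)\le F(a)$; if $a\notin\lambda/\mu$ it is an inversion-triple if $F(b)>F(c)$. $\mathrm{COF}(\lambda/\mu)$ is the set of fillings $F$ of $\lambda/\mu$ such that each column has distinct entries, the first column is strictly decreasing from top to bottom, and every triple is an inversion-triple. A descent of $F$ is a box $(i,j)$ such that $(i,j-1)$ and $(i,j)$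 are both in $\lambda/\mu$ and $F(i,j-1)<F(i,j)$; $\mathrm{leg}(i,j)=\lambda_i-j$; $\mathrm{maj}(F)=\sum_{b\text{ descent}}(\mathrm{leg}(b)+1)$. The skew specialized non-symmetric Macdonald polynomial is $$\mathrm{E}_{\lambda/\mu}(\mathbf{x};q,0)=\sum_{F\in\mathrm{COF}(\lambda/\mu)}q^{\mathrm{maj}(F)}\,\mathbf{x}^F,\qquad \mathbf{x}^F=\prod_{(i,j)\in\lambda/\mu}x_{F(i,j)}.$$ Charge. For a permutation $\sigma\in S_k$ let $\mathrm{Des}(\sigma)=\{i\in[k-1]:\sigma_{i+1}<\sigma_i\}$ and $\mathrm{charge}(\sigma)=\sum_{i\in[k-1],\,i\notin\mathrm{Des}(\sigma^{ -1})}(k-i)$. For a word $w$ whose content $\kappa$ is a partition ($\kappa_i$ letters equal to $i$), extract standard subwords as follows: scanning from the right end of $w$, mark the first $1$; continue to the left and mark the first $2$ encountered, then the first $3$, and so on, wrapping around cyclically from the left end to the right end when necessary, until $\kappa'_1$ letters are marked; the marked letters, in their order in $w$, form the first standard subword (a permutation). Delete them and repeat to get the second standard subword (of length $\kappa'_2$), etc. Then $\mathrm{charge}(w)$ is the sum of the charges of the standard subwords. For a partition $\kappa$ with $\ell$ parts and a word $w$ of content $\beta$ such that $\kappa+\beta$ is a partition, $\mathrm{charge}_\kappa(w)=\mathrm{charge}(w\cdot\ell^{\kappa_\ell}\cdots2^{\kappa_2}1^{\kappa_1})$ (concatenation, $i^{\kappa_i}$ meaning the letter $i$ repeated $\kappa_i$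 times). For a semistandard tableau $T$, $\mathrm{charge}_\kappa(T)=\mathrm{charge}_\kappa(\mathrm{rw}(T))$, where $\mathrm{rw}(T)$ reads the rows of $T$ from bottom to top, each row from left to right. -}

module Defs where

open import Data.Bool.Base using (if_then_else_)
open import Data.List.Base
  using (List; []; _∷_; _++_; map; concat; concatMap; reverse; replicate; zip; filter;
         length; last; applyUpTo; cartesianProduct; cartesianProductWith)
open import Data.List.Extrema.Nat using (max)
open import Data.List.Membership.DecPropositional using () renaming (_∈?_ to mem?)
open import Data.List.Properties using (≡-dec)
open import Data.List.Relation.Unary.All using (All; all?)
open import Data.List.Relation.Unary.Linked using (Linked; linked?)
open import Data.Maybe.Base using (fromMaybe; _<∣>_)
open import Data.Nat.Base using (ℕ; zero; suc; pred; _+_; _*_; _∸_; _≤_; _<_; _≥_)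
open import Data.Nat.ListAction using (sum)
open import Data.Nat.Properties using (_≟_; _≤?_; _<?_; _≥?_)
open import Data.Product.Base using (_×_; _,_; proj₁; proj₂)
open import Data.Sum.Base using (_⊎_)
open import Relation.Binary.PropositionalEquality.Core using (_≡_; _≢_)
open import Relation.Nullary.Decidable
  using (Dec; does; ¬?; _×-dec_; _⊎-dec_; _→-dec_)
open import Relation.Nullary.Negation using (¬_)

-- All indices below (rows, columns, parts, letters, positions) start at 1.

[1⋯_] : ℕ → List ℕ
[1⋯ n ] = applyUpTo suc n

at : {A : Set} → A → List A → ℕ → A
at d []       _             = d
at d (x ∷ xs) zero          = d
at d (x ∷ xs) (suc zero)    = x
at d (x ∷ xs) (suc (suc i)) = at d xs (suc i)

part : List ℕ → ℕ → ℕ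
part = at 0

IsPartition : List ℕ → Set
IsPartition xs = Linked _≥_ xs × All (0 <_) xs

isPartition? : ∀ xs → Dec (IsPartition xs)
isPartition? xs = linked? _≥?_ xs ×-dec all? (0 <?_) xs

_⊆_ : List ℕ → List ℕ → Set
mu ⊆ lam = ∀ i → part mu i ≤ part lam i

conj : List ℕ → List ℕ
conj lam = map (λ j → length (filter (j ≤?_) lam)) [1⋯ part lam 1 ]

-- A composition of n + 1 arises from a unique composition of n, by prepending
-- the part 1 or by increasing the first part.
extend : List ℕ → List (List ℕ)
extend []       = (1 ∷ []) ∷ []
extend (x ∷ xs) = (1 ∷ x ∷ xs) ∷ (suc x ∷ xs) ∷ []

compositions : ℕ → List (List ℕ)
compositions zero    = [] ∷ []
compositions (suc n) = concatMap extend (compositions n)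

partitions : ℕ → List (List ℕ)
partitions n = filter isPartition? (compositions n)

Box : Set
Box = ℕ × ℕ

InShape : (lam mu : List ℕ) → Box → Set
InShape lam mu (i , j) = part mu i < j × j ≤ part lam i

inShape? : ∀ lam mu b → Dec (InShape lam mu b)
inShape? lam mu (i , j) = (part mu i <? j) ×-dec (j ≤? part lam i)

boxes : (lam mu : List ℕ) → List Box
boxes lam mu =
  filter (inShape? lam mu) (cartesianProduct [1⋯ length lam ] [1⋯ part lam 1 ])

-- λ′ᵢ − μ′ᵢ for each column i of λ
columnLengths : (lam mu : List ℕ) → List ℕ
columnLengths lam mu =
  map (λ i → part (conj lam) i ∸ part (conj mu) i) [1⋯ part lam 1 ]

-- (i , 1) is sent to (i , 0), which lies in no shape.
left right down : Box → Box
left  (i , j) = i , pred j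
right (i , j) = i , suc j
down  (i , j) = suc i , j

-- Polynomials are given by their coefficients: p k is the coefficient of q^k.
ℕ[q] : Set
ℕ[q] = ℕ → ℕ

infix 9 q^_

q^_ : ℕ → ℕ[q]
(q^ m) k = if does (m ≟ k) then 1 else 0

-- The list γ stands for the monomial ∏ xᵢ ^ γᵢ; variables beyond the length
-- of γ have exponent 0.
Monomial : Set
Monomial = List ℕ

Series : Set
Series = Monomial → ℕ[q]

infix 4 _≈_

_≈_ : Series → Series → Set
f ≈ g = ∀ γ k → f γ k ≡ g γ k

Σq : {A : Set} → List A → (A → ℕ[q]) → ℕ[q]
Σq xs f k = sum (map (λ x → f x k) xs)

Σx : {A : Set} → List A → (A → Series) → Series
Σx xs f γ = Σq xs (λ x → f x γ)

infix 6 Σq Σx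

syntax Σq xs (λ x → e) = Σq[ x ∈ xs ] e
syntax Σx xs (λ x → e) = Σx[ x ∈ xs ] e

infixr 7 _·_

-- product of a series in x with coefficients in ℕ and a polynomial in q
_·_ : (Monomial → ℕ) → ℕ[q] → Series
(f · p) γ k = f γ * p k

Word : Set
Word = List ℕ

-- The rows from top to bottom; row i of a filling of λ/μ lists the entries in
-- columns μᵢ + 1, …, λᵢ.
Filling : Set
Filling = List Word

entry : (mu : List ℕ) → Filling → Box → ℕ
entry mu F (i , j) = part (at [] F i) (j ∸ part mu i)

words : (N n : ℕ) → List Word
words N zero    = [] ∷ []
words N (suc n) = cartesianProductWith _∷_ [1⋯ N ] (words N n)

fillingsWithRows : (N : ℕ) → List ℕ → List Filling
fillingsWithRows N []       = [] ∷ []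
fillingsWithRows N (r ∷ rs) =
  cartesianProductWith _∷_ (words N r) (fillingsWithRows N rs)

count : ℕ → Word → ℕ
count a w = length (filter (a ≟_) w)

content : (N : ℕ) → Word → List ℕ
content N w = map (λ a → count a w) [1⋯ N ]

-- The fillings F of λ/μ with positive entries and x^F equal to the monomial γ.
-- Such F use only the letters 1, …, length γ, so there are finitely many.
fillings : (lam mu : List ℕ) → Monomial → List Filling
fillings lam mu γ =
  filter (λ F → ≡-dec _≟_ (content (length γ) (concat F)) γ)
    (fillingsWithRows (length γ)
      (map (λ i → part lam i ∸ part mu i) [1⋯ length lam ]))

IsSemistandard : (nu : List ℕ) → Filling → Set
IsSemistandard nu T =
  All (λ b → (InShape nu [] (right b) → T⟨ b ⟩ ≤ T⟨ right b ⟩)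
           × (InShape nu [] (down b)  → T⟨ b ⟩ < T⟨ down b ⟩))
      (boxes nu [])
  where
  T⟨_⟩ : Box → ℕ
  T⟨_⟩ = entry [] T

isSemistandard? : ∀ nu T → Dec (IsSemistandard nu T)
isSemistandard? nu T =
  all? (λ b → (inShape? nu [] (right b) →-dec (_ ≤? _))
        ×-dec (inShape? nu [] (down b)  →-dec (_ <? _)))
       (boxes nu [])

SSYT : (nu α : List ℕ) → List Filling
SSYT nu α = filter (isSemistandard? nu) (fillings nu [] α)

s : (nu : List ℕ) → Monomial → ℕ
s nu γ = length (SSYT nu γ)

Below : Box → Box → Set
Below (i , j) (i′ , j′) = j ≡ j′ × i < i′

below? : ∀ b c → Dec (Below b c)
below? (i , j) (i′ , j′) = (j ≟ j′) ×-dec (i <? i′)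

-- all (b , c) with c somewhere below b in the same column
columnPairs : (lam mu : List ℕ) → List (Box × Box)
columnPairs lam mu =
  filter (λ (b , c) → below? b c) (cartesianProduct (boxes lam mu) (boxes lam mu))

-- the values F(a), F(b), F(c) of an inversion-triple with a in the shape
Inversion : (a b c : ℕ) → Set
Inversion a b c = (b ≤ a × a < c) ⊎ (a < c × c < b) ⊎ (c < b × b ≤ a)

inversion? : ∀ a b c → Dec (Inversion a b c)
inversion? a b c = ((b ≤? a) ×-dec (a <? c))
             ⊎-dec ((a <? c) ×-dec (c <? b))
             ⊎-dec ((c <? b) ×-dec (b ≤? a))

module _ (lam mu : List ℕ) (F : Filling) where

  private
    F⟨_⟩ : Box → ℕ
    F⟨_⟩ = entry mu F

  InversionTriple : Box → Box → Set
  InversionTriple b c =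
      (InShape lam mu (left b) → Inversion F⟨ left b ⟩ F⟨ b ⟩ F⟨ c ⟩)
    × (¬ InShape lam mu (left b) → F⟨ c ⟩ < F⟨ b ⟩)

  inversionTriple? : ∀ b c → Dec (InversionTriple b c)
  inversionTriple? b c =
          (inShape? lam mu (left b) →-dec inversion? F⟨ left b ⟩ F⟨ b ⟩ F⟨ c ⟩)
    ×-dec (¬? (inShape? lam mu (left b)) →-dec (F⟨ c ⟩ <? F⟨ b ⟩))

  ColumnsDistinct : Set
  ColumnsDistinct = All (λ (b , c) → F⟨ b ⟩ ≢ F⟨ c ⟩) (columnPairs lam mu)

  FirstColumnDecreasing : Set
  FirstColumnDecreasing =
    All (λ (b , c) → proj₂ b ≡ 1 → F⟨ c ⟩ < F⟨ b ⟩) (columnPairs lam mu)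

  AllInversionTriples : Set
  AllInversionTriples = All (λ (b , c) → InversionTriple b c) (columnPairs lam mu)

  IsCOF : Set
  IsCOF = ColumnsDistinct × FirstColumnDecreasing × AllInversionTriples

  isCOF? : Dec IsCOF
  isCOF? =
          all? (λ (b , c) → ¬? (F⟨ b ⟩ ≟ F⟨ c ⟩)) (columnPairs lam mu)
    ×-dec all? (λ (b , c) → (proj₂ b ≟ 1) →-dec (F⟨ c ⟩ <? F⟨ b ⟩)) (columnPairs lam mu)
    ×-dec all? (λ (b , c) → inversionTriple? b c) (columnPairs lam mu)

  Descent : Box → Set
  Descent b = InShape lam mu (left b) × InShape lam mu b × F⟨ left b ⟩ < F⟨ b ⟩

  descent? : ∀ b → Dec (Descent b)
  descent? b =
    inShape? lam mu (left b) ×-dec inShape? lam mu b ×-dec (F⟨ left b ⟩ <? F⟨ b ⟩)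

leg : (lam : List ℕ) → Box → ℕ
leg lam (i , j) = part lam i ∸ j

maj : (lam mu : List ℕ) → Filling → ℕ
maj lam mu F =
  sum (map (λ b → leg lam b + 1) (filter (descent? lam mu F) (boxes lam mu)))

-- the F in COF(λ/μ) with x^F = γ
COF : (lam mu : List ℕ) → Monomial → List Filling
COF lam mu γ = filter (isCOF? lam mu) (fillings lam mu γ)

-- E_{λ/μ}(x; q, 0)
E : (lam mu : List ℕ) → Series
E lam mu γ = Σq[ F ∈ COF lam mu γ ] q^ maj lam mu F

-- Permutations are words in one-line notation.
position : ℕ → Word → ℕ
position a []      = 0
position a (b ∷ w) = if does (a ≟ b) then 1 else suc (position a w)

inverse : Word → Word
inverse σ = map (λ a → position a σ) [1⋯ length σ ]

Des : Word → ℕ → Set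
Des σ i = part σ (suc i) < part σ i

des? : ∀ σ i → Dec (Des σ i)
des? σ i = part σ (suc i) <? part σ i

permCharge : Word → ℕ
permCharge σ =
  sum (map (length σ ∸_) (filter (λ i → ¬? (des? (inverse σ) i)) [1⋯ pred (length σ) ]))

indexed : Word → List (ℕ × ℕ)
indexed w = zip [1⋯ length w ] w

-- The position of the first letter a met when scanning leftwards from just
-- before position p, cyclically: the last a before p if there is one, and
-- otherwise the last a of the whole word.
scan : (w : Word) (p a : ℕ) → ℕ
scan w p a = fromMaybe 0 (last (filter (_<? p) occurrences) <∣> last occurrences)
  where
  occurrences : List ℕ
  occurrences = map proj₁ (filter (λ (_ , b) → b ≟ a) (indexed w))

-- the positions marked for the letters a, a + 1, …, a + m − 1, starting at p
marks : (w : Word) (p a m : ℕ) → List ℕ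
marks w p a zero    = []
marks w p a (suc m) = scan w p a ∷ marks w (scan w p a) (suc a) m

-- The first standard subword (of length m), and the word with it deleted.
-- The scan starts beyond the right end of w.
extract remainder : (m : ℕ) → Word → Word
extract   m w =
  map proj₂ (filter (λ (p , _) → mem? _≟_ p (marks w (suc (length w)) 1 m)) (indexed w))
remainder m w =
  map proj₂ (filter (λ (p , _) → ¬? (mem? _≟_ p (marks w (suc (length w)) 1 m))) (indexed w))

standardSubwords : (lengths : List ℕ) → Word → List Word
standardSubwords []       w = []
standardSubwords (m ∷ ms) w = extract m w ∷ standardSubwords ms (remainder m w)

-- Meaningful when the content κ of w is a partition; the standard subwords
-- then have lengths κ′₁, κ′₂, ….
charge : Word → ℕ
charge w = sum (map permCharge (standardSubwords (conj (content (max 0 w) w)) w))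

-- charge_κ(w) = charge(w · ℓ^{κ_ℓ} ⋯ 2^{κ₂} 1^{κ₁})
wordCharge : (κ : List ℕ) → Word → ℕ
wordCharge κ w =
  charge (w ++ concatMap (λ i → replicate (part κ i) i) (reverse [1⋯ length κ ]))

rw : Filling → Word
rw T = concat (reverse T)

tableauCharge : (κ : List ℕ) → Filling → ℕ
tableauCharge κ T = wordCharge κ (rw T)

{-# OPTIONS --safe #-}

{-
A coinversion-free filling is determined by the sets of entries of its columns:
going down a column, each box contains the first entry not yet used in the cyclic
order a, a − 1, …, a + 1, where a is the entry to its left (a = ∞ outside λ/μ).
These sets form a 0/1 matrix with rows D₁, …, D_N, row v listing in decreasing
order the columns that contain v.  In the word w = D₁ ⋯ D_N · ℓ^{μ′_ℓ} ⋯ 1^{μ′₁} the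
rows of the filling then single out the standard subwords, and descents are the
wraparounds, so maj(F) = charge_{μ′}(D₁ ⋯ D_N).  Dual RSK sends the matrix to a pair
(T, Q) of tableaux of shapes ν and ν′ with D₁ ⋯ D_N Knuth equivalent to rw(T).

It remains to see that charge is invariant under Knuth equivalence.  Read from right
to left, the letter i lets one customer pass from queue i − 1 to queue i of a system
of queues in tandem, and Knuth equivalent words act in the same way on the queues.
A standard subword is the path of a customer who circulates around the word until it
leaves the last queue.  With c customers, those present at the right end form the
least state that the word reproduces, and charge is the sum over m of the sizes of
these states for the letters up to m, where c is the number of letters m.
-}
module Submission where

open import Defs
open import Data.Empty using (⊥-elim)
open import Data.List.Base
  using (List; []; _∷_; _++_; replicate; map; filter; foldr; zip; length; last; applyUpTo; concat;
         cartesianProduct; reverse; concatMap)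
open import Data.List.Extrema.Nat using (max; max≤v⁺; xs≤max)
open import Data.List.Membership.DecPropositional using () renaming (_∈?_ to mem?)
open import Data.List.Membership.Propositional using (_∈_; _∉_)
open import Data.List.Membership.Propositional.Properties
  using (∈-map⁺; ∈-map⁻; ∈-filter⁺; ∈-filter⁻; ∈-applyUpTo⁺; ∈-applyUpTo⁻; ∈-length;
         ∈-cartesianProduct⁺; ∈-cartesianProduct⁻; ∈-cartesianProductWith⁺;
         ∈-cartesianProductWith⁻; ∈-++⁺ˡ; ∈-++⁺ʳ; ∈-++⁻; ∈-concatMap⁺)
open import Data.List.Membership.Propositional.Properties.WithK using (unique∧set⇒bag)
open import Data.List.Properties
  using (++-assoc; ++-identityʳ; filter-accept; filter-reject; length-map; length-applyUpTo;
         applyUpTo-∷ʳ; map-++; map-applyUpTo; filter-++; length-++; ≡-dec; map-cong; map-∘;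
         concat-++; unfold-reverse; map-replicate; reverse-++; map-cong-local)
open import Data.List.Relation.Binary.BagAndSetEquality using (∼bag⇒↭)
open import Data.List.Relation.Binary.Permutation.Propositional
  using (_↭_; ↭-refl; ↭-reflexive; ↭-sym; ↭-trans; ↭-prep; ↭-swap; ↭⇒↭ₛ)
import Data.List.Relation.Binary.Permutation.Propositional.Properties as ↭ₚ
open import Data.List.Relation.Binary.Permutation.Propositional.Properties using (↭-length)
import Data.List.Relation.Binary.Permutation.Setoid.Properties as ↭ₛ
open import Data.List.Relation.Unary.All as All using (All; []; _∷_)
import Data.List.Relation.Unary.All.Properties as Allₚ
open import Data.List.Relation.Unary.AllPairs as AllPairs using (AllPairs; []; _∷_)
import Data.List.Relation.Unary.AllPairs.Properties as AllPairsₚ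
open import Data.List.Relation.Unary.Any as Any using (here; there)
open import Data.List.Relation.Unary.Linked as Linked using (Linked; []; [-]; _∷_)
open import Data.List.Relation.Unary.Unique.Propositional using (Unique)
import Data.List.Relation.Unary.Unique.Propositional.Properties as Uniqueₚ
open import Data.Maybe.Base using (just; nothing)
open import Data.Nat.Base
open import Data.Nat.ListAction using (sum)
open import Data.Nat.ListAction.Properties using (sum-++; sum-↭)
open import Data.Nat.Properties
open import Data.Nat.Solver using (module +-*-Solver)
open import Data.Product.Base using (_×_; _,_; proj₁; proj₂; Σ-syntax; ∃-syntax)
open import Data.Sum.Base using (_⊎_; inj₁; inj₂; [_,_]′)
open import Data.Vec.Base as Vec using (Vec; []; _∷_)
open import Function.Base using (_∘_)
open import Function.Bundles using (mk⇔)
open import Relation.Binary.Definitions using (tri<; tri≈; tri>)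
open import Relation.Binary.PropositionalEquality
open import Relation.Nullary.Decidable using (dec-true; dec-false)
open import Relation.Nullary.Decidable.Core using (yes; no; Dec; ¬?)
open import Relation.Nullary.Negation using (contradiction; ¬_)
open import Relation.Unary using (Decidable)

-- Standard subwords are not preserved by Knuth relations, so `maj` and charge are never compared
-- subword by subword. Both are shown to be values of the relation `Peels`, which removes one
-- customer after another, and `peels-unique` shows that the value depends only on the lengths of
-- the subwords and on the action of the word. A customer can be removed because customers are
-- indistinguishable: he may be given precedence wherever he is present, and then the unmarked
-- letters act on the others as if he were absent. The weight k - j of a wraparound is the number of
-- m with j < m ≤ k, which is why each state is cut off at a queue m.
--
-- The special rules for triples at the border of μ and for the first column disappear once μ is
-- filled with values that exceed every entry and decrease along rows and columns, with a still
-- larger value in a column 0. Each row of the extended filling then is a full subword, and the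
-- boxes of μ supply precisely the suffix of the word; this is how μ′ enters the charge.

-- The local growth rule of dual RSK and its inverse

module RSK where

  between : ∀ {m n} → m ≤ n → n ≤ suc m → n ≡ m ⊎ n ≡ suc m
  between {zero}  {zero}        p q = inj₁ refl
  between {zero}  {suc zero}    p q = inj₂ refl
  between {zero}  {suc (suc n)} p (s≤s ())
  between {suc m} {suc n} (s≤s p) (s≤s q) with between p q
  ... | inj₁ refl = inj₁ refl
  ... | inj₂ refl = inj₂ refl

  -- The local rule of the growth diagram of dual RSK: from r, the vertical strip l / r,
  -- the horizontal strip m / r and the matrix entry d it computes the fourth corner.
  fwd : ∀ {a} → ℕ → Vec ℕ a → Vec ℕ a → Vec ℕ (suc a) → Vec ℕ (suc a)
  fwd d []       []       (m ∷ []) = (m + d) ∷ []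
  fwd d (r ∷ rs) (l ∷ ls) (m ∷ ms) =
    ((m + d) ⊔ l) ∷ fwd (((m + d) ⊓ l) ∸ r) rs ls ms

  -- `fwd` passes its carry from the first row to the last, so here the carries are recovered from
  -- the last row upwards. Once the carry found by the recursive call is subtracted from `l`, the
  -- minimum with `m` is the old row length, and the excess of `n` over the maximum is the incoming
  -- carry.
  bwd : ∀ {a} → Vec ℕ a → Vec ℕ (suc a) → Vec ℕ (suc a) → ℕ × Vec ℕ a
  bwd []       (m ∷ []) (n ∷ []) = n ∸ m , []
  bwd (l ∷ ls) (m ∷ ms) (n ∷ ns) =
    n ∸ (m ⊔ (l ∸ proj₁ (bwd ls ms ns))) ,
    (m ⊓ (l ∸ proj₁ (bwd ls ms ns))) ∷ proj₂ (bwd ls ms ns)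

  data Interlace : ∀ {a} → Vec ℕ (suc a) → Vec ℕ a → Set where
    [_] : ∀ x → Interlace (x ∷ []) []
    _∷_ : ∀ {a x y z} {ys : Vec ℕ a} {zs : Vec ℕ a} → y ≤ x × z ≤ y →
          Interlace (z ∷ zs) ys → Interlace (x ∷ z ∷ zs) (y ∷ ys)

  data Vert : ∀ {a} → Vec ℕ a → Vec ℕ a → Set where
    []  : Vert [] []
    _∷_ : ∀ {a x y} {xs ys : Vec ℕ a} → x ≤ y × y ≤ suc x → Vert xs ys →
          Vert (x ∷ xs) (y ∷ ys)

  data HeadBelow (b : ℕ) : ∀ {a} → Vec ℕ a → Set where
    []  : HeadBelow b []
    [_] : ∀ {a x} {xs : Vec ℕ a} → x ≤ b → HeadBelow b (x ∷ xs)

  data Decr : ∀ {a} → Vec ℕ a → Set where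
    []  : Decr []
    _∷_ : ∀ {a x} {xs : Vec ℕ a} → HeadBelow x xs → Decr xs → Decr (x ∷ xs)

  interlace⇒decr : ∀ {a} {m : Vec ℕ (suc a)} {r} → Interlace m r → Decr m
  interlace⇒decr [ x ] = [] ∷ []
  interlace⇒decr ((y≤x , z≤y) ∷ i) = [ ≤-trans z≤y y≤x ] ∷ interlace⇒decr i

  fwd-head : ∀ {a b d} (r l : Vec ℕ a) {m} {ms : Vec ℕ a} → m + d ≤ b → HeadBelow b l →
             HeadBelow b (fwd d r l (m ∷ ms))
  fwd-head []      []      {ms = []} p h     = [ p ]
  fwd-head (_ ∷ _) (_ ∷ _)           p [ h ] = [ ⊔-lub p h ]

  carry-out : ∀ m d l r → r ≤ l → l ≤ suc r → ((m + d) ⊓ l) ∸ r ≤ 1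
  carry-out m d l r p q = ≤-trans (∸-monoˡ-≤ r (≤-trans (m⊓n≤n (m + d) l) q))
    (≤-reflexive (m+n∸n≡m 1 r))

  carry-below : ∀ m d l r → r ≤ l → r + (((m + d) ⊓ l) ∸ r) ≤ l
  carry-below m d l r p = ≤-trans (+-monoʳ-≤ r (∸-monoˡ-≤ r (m⊓n≤n (m + d) l)))
    (≤-reflexive (m+[n∸m]≡n p))

  fwd-vert : ∀ {a d} {r l : Vec ℕ a} {m} → d ≤ 1 → Interlace m r → Vert r l →
             Vert m (fwd d r l m)
  fwd-vert {d = d} d≤1 [ x ] [] = (m≤m+n x d , ≤-trans (+-monoʳ-≤ x d≤1) (≤-reflexive (+-comm x 1))) ∷ []
  fwd-vert {d = d} {y ∷ _} {l ∷ _} {x ∷ z ∷ _} d≤1 ((y≤x , z≤y) ∷ i) ((p , q) ∷ v) =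
    ( ≤-trans (m≤m+n x d) (m≤m⊔n (x + d) l)
    , ⊔-lub (≤-trans (+-monoʳ-≤ x d≤1) (≤-reflexive (+-comm x 1))) (≤-trans q (s≤s y≤x)))
    ∷ fwd-vert (carry-out x d l y p q) i v

  interlace-∷ : ∀ {a x y} {zs : Vec ℕ (suc a)} {ys : Vec ℕ a} → y ≤ x → HeadBelow y zs →
                Interlace zs ys → Interlace (x ∷ zs) (y ∷ ys)
  interlace-∷ {zs = _ ∷ _} p [ q ] i = (p , q) ∷ i

  fwd-interlace : ∀ {a d} {r l : Vec ℕ a} {m} → Interlace m r → Vert r l → Decr l →
                  Interlace (fwd d r l m) l
  fwd-interlace {d = d} [ x ] [] [] = [ x + d ]
  fwd-interlace {d = d} {y ∷ ys} {l ∷ ls} {x ∷ z ∷ _} ((y≤x , z≤y) ∷ i) ((p , q) ∷ v) (h ∷ dl) =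
    interlace-∷ (m≤n⊔m (x + d) l)
      (fwd-head ys ls (≤-trans (+-monoˡ-≤ _ z≤y) (carry-below x d l y p)) h)
      (fwd-interlace i v dl)

  -- If l = r nothing is carried on. If l = r + 1 and d = 0, the new box of `l` stays in this row
  -- when m = r and is carried on when `m` already contains it. If l = r + 1 and d = 1, the row
  -- grows by one and the box of `l` is carried on.
  bwd∘fwd-step : ∀ {d m r l} → d ≤ 1 → r ≤ m → r ≤ l → l ≤ suc r →
    let d′ = ((m + d) ⊓ l) ∸ r in
    ((m + d) ⊔ l) ∸ (m ⊔ (l ∸ d′)) ≡ d × m ⊓ (l ∸ d′) ≡ r
  bwd∘fwd-step {d} {m} {r} d≤1 r≤m p q with between p q
  ... | inj₁ refl rewrite m≥n⇒m⊓n≡n (≤-trans r≤m (m≤m+n m d)) | n∸n≡0 r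
                        | m≥n⇒m⊔n≡m (≤-trans r≤m (m≤m+n m d)) | m≥n⇒m⊔n≡m r≤m
    = m+n∸m≡n m d , m≥n⇒m⊓n≡n r≤m
  bwd∘fwd-step {zero} {m} {r} d≤1 r≤m p q | inj₂ refl rewrite +-identityʳ m with m ≤? r
  ... | yes m≤r rewrite ≤-antisym m≤r r≤m | m≤n⇒m⊓n≡m (n≤1+n r) | n∸n≡0 r
                      | m≤n⇒m⊔n≡n (n≤1+n r) = n∸n≡0 r , m≤n⇒m⊓n≡m (n≤1+n r)
  ... | no m≰r rewrite m≥n⇒m⊓n≡n (≰⇒> m≰r) | m+n∸n≡m 1 r | m≥n⇒m⊔n≡m (≰⇒> m≰r)
                     | m≥n⇒m⊔n≡m r≤m = n∸n≡0 m , m≥n⇒m⊓n≡n r≤m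
  bwd∘fwd-step {suc zero} {m} {r} d≤1 r≤m p q | inj₂ refl
    rewrite +-comm m 1 | m≥n⇒m⊓n≡n r≤m | m+n∸n≡m 1 r | m≥n⇒m⊔n≡m r≤m | m≥n⇒m⊓n≡n r≤m
    = m+n∸n≡m 1 m , refl
  bwd∘fwd-step {suc (suc d)} (s≤s ()) _ _ _ | inj₂ refl

  bwd∘fwd : ∀ {a d} {r l : Vec ℕ a} {m} → d ≤ 1 → Interlace m r → Vert r l →
            bwd l m (fwd d r l m) ≡ (d , r)
  bwd∘fwd {d = d} d≤1 [ x ] [] = cong (_, []) (m+n∸m≡n x d)
  bwd∘fwd {d = d} {y ∷ ys} {l ∷ ls} {x ∷ zs} d≤1 ((y≤x , z≤y) ∷ i) ((p , q) ∷ v)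
    rewrite bwd∘fwd (carry-out x d l y p q) i v
    with s , t ← bwd∘fwd-step {d} {x} d≤1 y≤x p q = cong₂ _,_ s (cong (_∷ ys) t)

  -- Besides bounding the carry by 1, this keeps it below `l` in the row above, so that the
  -- truncated subtraction of the carry from `l` is an honest difference.
  bwd-carry : ∀ {a} (l : Vec ℕ a) {m n} (ms ns : Vec ℕ a) → m ≤ n → m + proj₁ (bwd l (m ∷ ms) (n ∷ ns)) ≤ n
  bwd-carry [] {m} [] [] p = ≤-reflexive (m+[n∸m]≡n p)
  bwd-carry (l ∷ ls) {m} {n} ms ns p =
    ≤-trans (+-monoʳ-≤ m (∸-monoʳ-≤ n (m≤m⊔n m _))) (≤-reflexive (m+[n∸m]≡n p))

  bwd-≤1 : ∀ {a} (l : Vec ℕ a) m n → Vert m n → proj₁ (bwd l m n) ≤ 1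
  bwd-≤1 l (m ∷ ms) (n ∷ ns) ((p , q) ∷ v) =
    +-cancelˡ-≤ m _ 1 (≤-trans (bwd-carry l ms ns p) (≤-trans q (≤-reflexive (+-comm 1 m))))

  bwd-interlace : ∀ {a} {l : Vec ℕ a} {m n} → Interlace n l → Vert m n → Decr m →
                  Interlace m (proj₂ (bwd l m n))
  bwd-interlace {m = m ∷ []} [ x ] (_ ∷ []) _ = [ m ]
  bwd-interlace {l = l ∷ ls} {m ∷ m₂ ∷ ms} {n ∷ n₂ ∷ ns} ((l≤n , n₂≤l) ∷ i) (_ ∷ v@((p , _) ∷ _)) ([ h ] ∷ dm) =
    (m⊓n≤m m _ , ⊓-glb h (m+n≤o⇒m≤o∸n m₂ (≤-trans (bwd-carry ls ms ns p) n₂≤l)))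
    ∷ bwd-interlace i v dm

  bwd-vert : ∀ {a} {l : Vec ℕ a} {m n} → Interlace n l → Vert m n → Vert (proj₂ (bwd l m n)) l
  bwd-vert {m = m ∷ []} [ x ] _ = []
  bwd-vert {l = l ∷ ls} {m ∷ ms} {n ∷ ns} ((l≤n , _) ∷ i) ((p , q) ∷ v) =
    ( ≤-trans (m⊓n≤n m (l ∸ c)) (m∸n≤m l c)
    , (begin
        l ≤⟨ ⊓-glb (≤-trans l≤n q) (≤-trans (m≤n+m∸n l c) (+-monoˡ-≤ (l ∸ c) (bwd-≤1 ls ms ns v))) ⟩
        suc m ⊓ suc (l ∸ c) ∎))
    ∷ bwd-vert i v
    where
    open ≤-Reasoning
    c : ℕ
    c = proj₁ (bwd ls ms ns)

  fwd∘bwd-step : ∀ {d m l n} → m ≤ n → n ≤ suc m → l ≤ n → d ≤ 1 → d ≤ l →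
    let d₀ = n ∸ (m ⊔ (l ∸ d)) in
    (m + d₀) ⊔ l ≡ n × ((m + d₀) ⊓ l) ∸ (m ⊓ (l ∸ d)) ≡ d
  fwd∘bwd-step {d} {m} {l} p q l≤n d≤1 d≤l with between p q
  ... | inj₁ refl rewrite m≥n⇒m⊔n≡m (≤-trans (m∸n≤m l d) l≤n) | n∸n≡0 m | +-identityʳ m
                        | m≥n⇒m⊓n≡n l≤n | m≥n⇒m⊓n≡n (≤-trans (m∸n≤m l d) l≤n)
    = m≥n⇒m⊔n≡m l≤n , m∸[m∸n]≡n d≤l
  fwd∘bwd-step {zero} {m} {l} p q l≤n d≤1 d≤l | inj₂ refl with l ≤? m
  ... | yes l≤m rewrite m≥n⇒m⊔n≡m l≤m | m+n∸n≡m 1 m | +-comm m 1 | m≥n⇒m⊓n≡n l≤n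
                      | m≥n⇒m⊓n≡n l≤m = m≥n⇒m⊔n≡m l≤n , n∸n≡0 l
  ... | no l≰m with refl ← ≤-antisym l≤n (≰⇒> l≰m)
    rewrite m≤n⇒m⊔n≡n (n≤1+n m) | n∸n≡0 m | +-identityʳ m = m≤n⇒m⊔n≡n (n≤1+n m) , n∸n≡0 (m ⊓ suc m)
  fwd∘bwd-step {suc zero} {m} {suc l} p q (s≤s l≤m) d≤1 d≤l | inj₂ refl
    rewrite m≥n⇒m⊔n≡m l≤m | m+n∸n≡m 1 m | +-comm m 1 | m≥n⇒m⊓n≡n l≤m
    = cong suc (m≥n⇒m⊔n≡m l≤m) , m+n∸n≡m 1 l
  fwd∘bwd-step {suc (suc d)} _ _ _ (s≤s ()) _ | inj₂ refl

  fwd∘bwd : ∀ {a} {l : Vec ℕ a} {m n} → Interlace n l → Vert m n →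
            fwd (proj₁ (bwd l m n)) (proj₂ (bwd l m n)) l m ≡ n
  fwd∘bwd {m = m ∷ []} [ x ] ((p , _) ∷ []) = cong (_∷ []) (m+[n∸m]≡n p)
  fwd∘bwd {l = l ∷ ls} {m ∷ m₂ ∷ ms} {n ∷ n₂ ∷ ns} ((l≤n , n₂≤l) ∷ i) ((p , q) ∷ v@((p₂ , _) ∷ _))
    with s , t ← fwd∘bwd-step {proj₁ (bwd ls (m₂ ∷ ms) (n₂ ∷ ns))} {m} p q l≤n (bwd-≤1 ls _ _ v)
                   (≤-trans (m≤n+m _ m₂) (≤-trans (bwd-carry ls ms ns p₂) n₂≤l))
    rewrite s | t = cong (n ∷_) (fwd∘bwd i v)

  -- Gelfand–Tsetlin patterns: the row of length a is the shape of the letters 1, …, a.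
  data GT : ℕ → Set where
    []  : GT 0
    _∷_ : ∀ {a} → Vec ℕ (suc a) → GT a → GT (suc a)

  top : ∀ {a} → GT a → Vec ℕ a
  top []      = []
  top (m ∷ _) = m

  data Valid : ∀ {a} → GT a → Set where
    []  : Valid []
    _∷_ : ∀ {a m} {t : GT a} → Interlace m (top t) → Valid t → Valid (m ∷ t)

  top-decr : ∀ {a} {t : GT a} → Valid t → Decr (top t)
  top-decr []      = []
  top-decr (i ∷ _) = interlace⇒decr i

  -- D lists the multiplicities of the letters a, …, 1 in the inserted word.
  ins : ∀ {a} → GT a → Vec ℕ a → GT a
  ins []      []      = []
  ins (m ∷ t) (d ∷ D) = fwd d (top t) (top (ins t D)) m ∷ ins t D

  -- `m` is the shape before the insertion. Each use of `bwd` yields the multiplicity of the largest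
  -- letter and the old shape of the smaller letters, with which the recursion continues.
  unins : ∀ {a} → GT a → Vec ℕ a → GT a × Vec ℕ a
  unins []       []  = [] , []
  unins (n ∷ t′) m =
    let d , r = bwd (top t′) m n
        t , D = unins t′ r
    in m ∷ t , d ∷ D

  data All≤1 : ∀ {a} → Vec ℕ a → Set where
    []  : All≤1 []
    _∷_ : ∀ {a d} {D : Vec ℕ a} → d ≤ 1 → All≤1 D → All≤1 (d ∷ D)

  ins-vert : ∀ {a} {t : GT a} {D} → Valid t → All≤1 D → Vert (top t) (top (ins t D))
  ins-vert []      []      = []
  ins-vert (i ∷ v) (p ∷ q) = fwd-vert p i (ins-vert v q)

  ins-valid : ∀ {a} {t : GT a} {D} → Valid t → All≤1 D → Valid (ins t D)
  ins-valid []      []      = []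
  ins-valid (i ∷ v) (p ∷ q) =
    fwd-interlace i (ins-vert v q) (top-decr (ins-valid v q)) ∷ ins-valid v q

  unins∘ins : ∀ {a} {t : GT a} {D} → Valid t → All≤1 D → unins (ins t D) (top t) ≡ (t , D)
  unins∘ins []      []      = refl
  unins∘ins {t = m ∷ t} {d ∷ D} (i ∷ v) (p ∷ q)
    rewrite bwd∘fwd p i (ins-vert v q) | unins∘ins v q = refl

  unins-top : ∀ {a} (t : GT a) m → top (proj₁ (unins t m)) ≡ m
  unins-top []      [] = refl
  unins-top (n ∷ t) m  = refl

  unins-valid : ∀ {a} {t : GT a} {m} → Valid t → Vert m (top t) → Decr m → Valid (proj₁ (unins t m))
  unins-valid []      [] _ = []
  unins-valid {t = n ∷ t} {m} (i ∷ v) h d =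
    subst (Interlace m) (sym (unins-top t _)) (bwd-interlace i h d)
    ∷ unins-valid v (bwd-vert i h) (interlace⇒decr′ (bwd-interlace i h d))
    where
    interlace⇒decr′ : ∀ {a} {m : Vec ℕ (suc a)} {r} → Interlace m r → Decr r
    interlace⇒decr′ [ _ ] = []
    interlace⇒decr′ (_ ∷ [ _ ]) = [] ∷ []
    interlace⇒decr′ ((_ , p) ∷ i@((q , _) ∷ _)) = [ ≤-trans q p ] ∷ interlace⇒decr′ i

  unins-≤1 : ∀ {a} {t : GT a} {m} → Valid t → Vert m (top t) → All≤1 (proj₂ (unins t m))
  unins-≤1 []      []    = []
  unins-≤1 {t = _ ∷ t} (i ∷ v) h = bwd-≤1 (top t) _ _ h ∷ unins-≤1 v (bwd-vert i h)

  ins∘unins : ∀ {a} {t : GT a} {m} → Valid t → Vert m (top t) →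
              ins (proj₁ (unins t m)) (proj₂ (unins t m)) ≡ t
  ins∘unins {m = []} [] h = refl
  ins∘unins {t = n ∷ t} {m} (i ∷ v) h
    rewrite ins∘unins v (bwd-vert i h) | unins-top t (proj₂ (bwd (top t) m n))
          | fwd∘bwd i h = refl

  interlace-zeros : ∀ {a} {l : Vec ℕ a} → Interlace (Vec.replicate (suc a) 0) l → l ≡ Vec.replicate a 0
  interlace-zeros [ _ ]               = refl
  interlace-zeros ((z≤n , z≤n) ∷ i) = cong (0 ∷_) (interlace-zeros i)

  zeroGT : ∀ a → GT a
  zeroGT zero    = []
  zeroGT (suc a) = Vec.replicate (suc a) 0 ∷ zeroGT a

  zeroGT-top : ∀ a → top (zeroGT a) ≡ Vec.replicate a 0
  zeroGT-top zero    = refl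
  zeroGT-top (suc a) = refl

  zeroGT-valid : ∀ a → Valid (zeroGT a)
  zeroGT-valid zero    = []
  zeroGT-valid (suc a) = subst (Interlace _) (sym (zeroGT-top a)) (zeros a) ∷ zeroGT-valid a
    where
    zeros : ∀ a → Interlace (Vec.replicate (suc a) 0) (Vec.replicate a 0)
    zeros zero    = [ 0 ]
    zeros (suc a) = (z≤n , z≤n) ∷ zeros a

  valid-zeros : ∀ {a} {t : GT a} → Valid t → top t ≡ Vec.replicate a 0 → t ≡ zeroGT a
  valid-zeros []      eq   = refl
  valid-zeros (i ∷ v) refl = cong (_ ∷_) (valid-zeros v (interlace-zeros i))

  -- The head of the vector is inserted last. Recorded are the shapes before each insertion; the
  -- final shape is already the top row of the pattern.
  rsk : ∀ {a N} → Vec (Vec ℕ a) N → GT a × Vec (Vec ℕ a) N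
  rsk {a} []  = zeroGT a , []
  rsk (D ∷ M) = ins (proj₁ (rsk M)) D , top (proj₁ (rsk M)) ∷ proj₂ (rsk M)

  unrsk : ∀ {a N} → GT a → Vec (Vec ℕ a) N → Vec (Vec ℕ a) N
  unrsk t []       = []
  unrsk t (q ∷ qs) = proj₂ (unins t q) ∷ unrsk (proj₁ (unins t q)) qs

  -- The recording tableau as the sequence of its shapes, from the largest letter down; `g` is the
  -- number of boxes with that letter. The steps are vertical strips because the inserted words are
  -- strictly decreasing, so the recording tableau is semistandard after transposition.
  data Chain {a} : ∀ {N} → Vec ℕ a → Vec (Vec ℕ a) N → Vec ℕ N → Set where
    []  : Chain (Vec.replicate a 0) [] []
    _∷_ : ∀ {N m q g} {qs : Vec (Vec ℕ a) N} {gs} →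
          Vert q m × Decr q × Vec.sum m ≡ Vec.sum q + g →
          Chain q qs gs → Chain m (q ∷ qs) (g ∷ gs)

  data HasContent : ∀ {a} → GT a → Vec ℕ a → Set where
    []  : HasContent [] []
    _∷_ : ∀ {a m} {t : GT a} {c cs} → Vec.sum m ≡ Vec.sum (top t) + c →
          HasContent t cs → HasContent (m ∷ t) (c ∷ cs)

  hasContent-unique : ∀ {a} {t : GT a} {c d} → HasContent t c → HasContent t d → c ≡ d
  hasContent-unique []      []      = refl
  hasContent-unique {t = _ ∷ t} (p ∷ h) (q ∷ k) =
    cong₂ _∷_ (+-cancelˡ-≡ (Vec.sum (top t)) _ _ (trans (sym p) q)) (hasContent-unique h k)

  min-max : ∀ x y → (x ⊔ y) + (x ⊓ y) ≡ x + y
  min-max x y with ≤-total x y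
  ... | inj₁ p rewrite m≤n⇒m⊔n≡n p | m≤n⇒m⊓n≡m p = +-comm y x
  ... | inj₂ p rewrite m≥n⇒m⊔n≡m p | m≥n⇒m⊓n≡n p = refl

  -- In each row the maximum and the minimum of m + d and l add up to m + d + l, and the carry
  -- cancels against the next row.
  fwd-sum : ∀ {a d} {r l : Vec ℕ a} {m} → Interlace m r → Vert r l →
            Vec.sum (fwd d r l m) + Vec.sum r ≡ Vec.sum m + Vec.sum l + d
  fwd-sum {d = d} [ x ] [] = solve 2 (λ x d → x :+ d :+ con 0 :+ con 0 := x :+ con 0 :+ con 0 :+ d) refl x d
    where open +-*-Solver
  fwd-sum {d = d} {y ∷ ys} {l ∷ ls} {x ∷ zs} ((y≤x , z≤y) ∷ i) ((p , q) ∷ v) = begin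
    (x + d) ⊔ l + S + (y + Vec.sum ys)
      ≡⟨ solve 4 (λ a b c d → a :+ b :+ (c :+ d) := a :+ c :+ (b :+ d)) refl ((x + d) ⊔ l) S y (Vec.sum ys) ⟩
    (x + d) ⊔ l + y + (S + Vec.sum ys)
      ≡⟨ cong ((x + d) ⊔ l + y +_) (fwd-sum {d = d′} i v) ⟩
    (x + d) ⊔ l + y + (Vec.sum zs + Vec.sum ls + d′)
      ≡⟨ solve 5 (λ a b c d e → a :+ b :+ (c :+ d :+ e) := a :+ (b :+ e) :+ (c :+ d)) refl ((x + d) ⊔ l) y (Vec.sum zs) (Vec.sum ls) d′ ⟩
    (x + d) ⊔ l + (y + d′) + (Vec.sum zs + Vec.sum ls)
      ≡⟨ cong (λ k → (x + d) ⊔ l + k + (Vec.sum zs + Vec.sum ls)) (m+[n∸m]≡n (⊓-glb (≤-trans y≤x (m≤m+n x d)) p)) ⟩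
    (x + d) ⊔ l + ((x + d) ⊓ l) + (Vec.sum zs + Vec.sum ls)
      ≡⟨ cong (_+ (Vec.sum zs + Vec.sum ls)) (min-max (x + d) l) ⟩
    x + d + l + (Vec.sum zs + Vec.sum ls)
      ≡⟨ solve 5 (λ a b c d e → a :+ b :+ c :+ (d :+ e) := a :+ d :+ (c :+ e) :+ b) refl x d l (Vec.sum zs) (Vec.sum ls) ⟩
    x + Vec.sum zs + (l + Vec.sum ls) + d ∎
    where
    open ≡-Reasoning
    open +-*-Solver
    d′ S : ℕ
    d′ = ((x + d) ⊓ l) ∸ y
    S  = Vec.sum (fwd d′ ys ls zs)

  ins-sum : ∀ {a} {t : GT a} {D} → Valid t → All≤1 D →
            Vec.sum (top (ins t D)) ≡ Vec.sum (top t) + Vec.sum D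
  ins-sum []      []      = refl
  ins-sum {t = m ∷ t} {d ∷ D} (i ∷ v) (p ∷ q) = +-cancelʳ-≡ (Vec.sum (top t)) _ _ (begin
    Vec.sum (fwd d (top t) (top (ins t D)) m) + Vec.sum (top t)
      ≡⟨ fwd-sum i (ins-vert v q) ⟩
    Vec.sum m + Vec.sum (top (ins t D)) + d
      ≡⟨ cong (λ k → Vec.sum m + k + d) (ins-sum v q) ⟩
    Vec.sum m + (Vec.sum (top t) + Vec.sum D) + d
      ≡⟨ solve 4 (λ a b c d → a :+ (b :+ c) :+ d := a :+ (d :+ c) :+ b) refl (Vec.sum m) (Vec.sum (top t)) (Vec.sum D) d ⟩
    Vec.sum m + (d + Vec.sum D) + Vec.sum (top t) ∎)
    where
    open ≡-Reasoning
    open +-*-Solver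

  ins-content : ∀ {a} {t : GT a} {D c} → Valid t → All≤1 D → HasContent t c →
                HasContent (ins t D) (Vec.zipWith _+_ D c)
  ins-content []      []      []      = []
  ins-content {t = m ∷ t} {d ∷ D} {c ∷ cs} w@(i ∷ v) b@(p ∷ q) (e ∷ h) = (begin
    Vec.sum (top (ins (m ∷ t) (d ∷ D))) ≡⟨ ins-sum w b ⟩
    Vec.sum m + (d + Vec.sum D)            ≡⟨ cong (_+ (d + Vec.sum D)) e ⟩
    Vec.sum (top t) + c + (d + Vec.sum D)
      ≡⟨ solve 4 (λ a b c d → a :+ b :+ (c :+ d) := a :+ d :+ (c :+ b)) refl (Vec.sum (top t)) c d (Vec.sum D) ⟩
    Vec.sum (top t) + Vec.sum D + (d + c)
      ≡⟨ cong (_+ (d + c)) (sym (ins-sum v q)) ⟩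
    Vec.sum (top (ins t D)) + (d + c) ∎) ∷ ins-content v q h
    where
    open ≡-Reasoning
    open +-*-Solver

  data All≤1′ {a} : ∀ {N} → Vec (Vec ℕ a) N → Set where
    []  : All≤1′ []
    _∷_ : ∀ {N D} {M : Vec (Vec ℕ a) N} → All≤1 D → All≤1′ M → All≤1′ (D ∷ M)

  colSums : ∀ {a N} → Vec (Vec ℕ a) N → Vec ℕ a
  colSums {a} []  = Vec.replicate a 0
  colSums (D ∷ M) = Vec.zipWith _+_ D (colSums M)

  rsk-valid : ∀ {a N} {M : Vec (Vec ℕ a) N} → All≤1′ M → Valid (proj₁ (rsk M))
  rsk-valid {a} [] = zeroGT-valid a
  rsk-valid (p ∷ ps) = ins-valid (rsk-valid ps) p

  rsk-chain : ∀ {a N} {M : Vec (Vec ℕ a) N} → All≤1′ M →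
              Chain (top (proj₁ (rsk M))) (proj₂ (rsk M)) (Vec.map Vec.sum M)
  rsk-chain {a} [] = subst (λ z → Chain z [] []) (sym (zeroGT-top a)) []
  rsk-chain (p ∷ ps) =
    (ins-vert (rsk-valid ps) p , top-decr (rsk-valid ps) , ins-sum (rsk-valid ps) p) ∷ rsk-chain ps

  rsk-content : ∀ {a N} {M : Vec (Vec ℕ a) N} → All≤1′ M → HasContent (proj₁ (rsk M)) (colSums M)
  rsk-content {a} [] = zero-content a
    where
    sum-zeros : ∀ a → Vec.sum (Vec.replicate a 0) ≡ 0
    sum-zeros zero    = refl
    sum-zeros (suc a) = sum-zeros a

    zero-content : ∀ a → HasContent (zeroGT a) (Vec.replicate a 0)
    zero-content zero    = []
    zero-content (suc a) =
      trans (sum-zeros a) (sym (trans (+-identityʳ _) (trans (cong Vec.sum (zeroGT-top a)) (sum-zeros a))))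
      ∷ zero-content a
  rsk-content (p ∷ ps) = ins-content (rsk-valid ps) p (rsk-content ps)

  unrsk∘rsk : ∀ {a N} {M : Vec (Vec ℕ a) N} → All≤1′ M → unrsk (proj₁ (rsk M)) (proj₂ (rsk M)) ≡ M
  unrsk∘rsk [] = refl
  unrsk∘rsk (p ∷ ps) rewrite unins∘ins (rsk-valid ps) p = cong (_ ∷_) (unrsk∘rsk ps)

  unins-chain : ∀ {a N} {t : GT a} {q} {qs : Vec (Vec ℕ a) N} {gs} → Chain q qs gs → Chain (top (proj₁ (unins t q))) qs gs
  unins-chain {t = t} {q} c = subst (λ z → Chain z _ _) (sym (unins-top t q)) c

  unrsk-≤1 : ∀ {a N} {t : GT a} {qs : Vec (Vec ℕ a) N} {gs} → Valid t → Chain (top t) qs gs → All≤1′ (unrsk t qs)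
  unrsk-≤1 {qs = []} v c = []
  unrsk-≤1 {t = t} {qs = q ∷ qs} v ((h , d , _) ∷ c) =
    unins-≤1 v h ∷ unrsk-≤1 (unins-valid v h d) (unins-chain {t = t} c)

  rsk∘unrsk : ∀ {a N} {t : GT a} {qs : Vec (Vec ℕ a) N} {gs} → Valid t → Chain (top t) qs gs → rsk (unrsk t qs) ≡ (t , qs)
  rsk∘unrsk {t = t} {[]} v c = cong (_, []) (sym (valid-zeros v (nil c)))
    where
    nil : ∀ {a} {m : Vec ℕ a} {gs} → Chain m [] gs → m ≡ Vec.replicate a 0
    nil [] = refl
  rsk∘unrsk {t = t} {q ∷ qs} v ((h , d , _) ∷ c)
    rewrite rsk∘unrsk (unins-valid v h d) (unins-chain {t = t} c) =
    cong₂ _,_ (ins∘unins v h) (cong (_∷ qs) (unins-top t q))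

-- Knuth equivalence of the inserted word and the reading word

module Plactic where

  open RSK

  infix 4 _~_

  -- Both relations carry an arbitrary tail, so left congruence suffices as a constructor and right
  -- congruence is derived. Words act from their right end, and in this form a relation is applied
  -- to the state produced by its tail.
  data _~_ : Word → Word → Set where
    ~-refl  : ∀ {w} → w ~ w
    ~-sym   : ∀ {v w} → v ~ w → w ~ v
    ~-trans : ∀ {u v w} → u ~ v → v ~ w → u ~ w
    prep    : ∀ a {v w} → v ~ w → a ∷ v ~ a ∷ w
    yxz     : ∀ {x y z} s → x < y → y ≤ z → y ∷ x ∷ z ∷ s ~ y ∷ z ∷ x ∷ s
    xzy     : ∀ {x y z} s → x ≤ y → y < z → x ∷ z ∷ y ∷ s ~ z ∷ x ∷ y ∷ s

  ≡⇒~ : ∀ {v w} → v ≡ w → v ~ w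
  ≡⇒~ refl = ~-refl

  ~-++ʳ : ∀ {v w} s → v ~ w → v ++ s ~ w ++ s
  ~-++ʳ s ~-refl        = ~-refl
  ~-++ʳ s (~-sym p)     = ~-sym (~-++ʳ s p)
  ~-++ʳ s (~-trans p q) = ~-trans (~-++ʳ s p) (~-++ʳ s q)
  ~-++ʳ s (prep a p)    = prep a (~-++ʳ s p)
  ~-++ʳ s (yxz t p q)   = yxz (t ++ s) p q
  ~-++ʳ s (xzy t p q)   = xzy (t ++ s) p q

  ~-++ˡ : ∀ {v w} u → v ~ w → u ++ v ~ u ++ w
  ~-++ˡ []      p = p
  ~-++ˡ (a ∷ u) p = prep a (~-++ˡ u p)

  first : Word → ℕ → ℕ
  first []      a = a
  first (x ∷ w) a = x

  data IncrUpTo (a : ℕ) : Word → Set where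
    []  : IncrUpTo a []
    _∷_ : ∀ {x w} → x ≤ first w a → IncrUpTo a w → IncrUpTo a (x ∷ w)

  data DecrAbove (a : ℕ) : Word → Set where
    []  : DecrAbove a []
    _∷_ : ∀ {x w} → first w a < x → DecrAbove a w → DecrAbove a (x ∷ w)

  data IncrFrom : ℕ → Word → Set where
    []  : ∀ {a} → IncrFrom a []
    _∷_ : ∀ {a x w} → a ≤ x → IncrFrom x w → IncrFrom a (x ∷ w)

  first-incr : ∀ {a w} → IncrUpTo a w → first w a ≤ a
  first-incr []               = ≤-refl
  first-incr (p ∷ i) = ≤-trans p (first-incr i)

  first-decr : ∀ {a w} → DecrAbove a w → a ≤ first w a
  first-decr []      = ≤-refl
  first-decr (p ∷ d) = ≤-trans (first-decr d) (<⇒≤ p)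

  incrUpTo-weaken : ∀ {a b w} → a ≤ b → IncrUpTo a w → IncrUpTo b w
  incrUpTo-weaken p []               = []
  incrUpTo-weaken {w = _ ∷ []}    p (q ∷ i) = ≤-trans q p ∷ []
  incrUpTo-weaken {w = _ ∷ _ ∷ _} p (q ∷ i) = q ∷ incrUpTo-weaken p i

  incrUpTo-replicate : ∀ {a} r → IncrUpTo a (replicate r a)
  incrUpTo-replicate zero          = []
  incrUpTo-replicate (suc zero)    = ≤-refl ∷ []
  incrUpTo-replicate (suc (suc r)) = ≤-refl ∷ incrUpTo-replicate (suc r)

  incrUpTo-++ : ∀ {a w} r → IncrUpTo a w → IncrUpTo a (w ++ replicate r a)
  incrUpTo-++ r []      = incrUpTo-replicate r
  incrUpTo-++ {w = _ ∷ []}    zero    (q ∷ i) = q ∷ []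
  incrUpTo-++ {w = _ ∷ []}    (suc r) (q ∷ i) = q ∷ incrUpTo-replicate (suc r)
  incrUpTo-++ {w = _ ∷ _ ∷ _} r       (q ∷ i) = q ∷ incrUpTo-++ r i

  decrAbove-weaken : ∀ {a b w} → b ≤ a → DecrAbove a w → DecrAbove b w
  decrAbove-weaken p []               = []
  decrAbove-weaken {w = _ ∷ []}    p (q ∷ i) = ≤-<-trans p q ∷ []
  decrAbove-weaken {w = _ ∷ _ ∷ _} p (q ∷ i) = q ∷ decrAbove-weaken p i

  decrAbove-∷ʳ : ∀ {a b w} → b < a → DecrAbove a w → DecrAbove b (w ++ (a ∷ []))
  decrAbove-∷ʳ p []               = p ∷ []
  decrAbove-∷ʳ {w = _ ∷ []}    p (q ∷ i) = q ∷ decrAbove-∷ʳ p i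
  decrAbove-∷ʳ {w = _ ∷ _ ∷ _} p (q ∷ i) = q ∷ decrAbove-∷ʳ p i

  incrFrom-weaken : ∀ {a b w} → b ≤ a → IncrFrom a w → IncrFrom b w
  incrFrom-weaken p []      = []
  incrFrom-weaken p (q ∷ i) = ≤-trans p q ∷ i

  incrFrom-replicate : ∀ {a w} r → IncrFrom a w → IncrFrom a (replicate r a ++ w)
  incrFrom-replicate zero    i = i
  incrFrom-replicate (suc r) i = ≤-refl ∷ incrFrom-replicate r i

  -- `e` moves left one letter at a time by `xzy`. The witness is `y` at first, and then always the
  -- letter just passed.
  shift-large : ∀ {u y e} s → IncrUpTo y u → y < e → u ++ e ∷ y ∷ s ~ e ∷ u ++ y ∷ s
  shift-large s [] _ = ~-refl
  shift-large {x ∷ []}     s (p ∷ i) q = xzy s p q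
  shift-large {x ∷ x′ ∷ u} s (p ∷ i) q =
    ~-trans (prep x (shift-large s i q)) (xzy _ p (≤-<-trans (first-incr i) q))

  shift-decr : ∀ {u w a} s → IncrUpTo a u → DecrAbove a w → u ++ w ++ a ∷ s ~ w ++ u ++ a ∷ s
  shift-decr s i [] = ~-refl
  shift-decr {u} {x ∷ []}    s i (p ∷ d) = shift-large s i p
  shift-decr {u} {x ∷ y ∷ w} s i (p ∷ d) =
    ~-trans (shift-large _ (incrUpTo-weaken (first-decr d) i) p) (prep x (shift-decr s i d))

  -- `x` moves left one letter at a time by `yxz`, the left neighbour of the letter passed being the
  -- witness.
  shift-small : ∀ {x y v} s → x < y → IncrFrom y v → y ∷ v ++ x ∷ s ~ y ∷ x ∷ v ++ s
  shift-small s p [] = ~-refl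
  shift-small {x} {y} s p (q ∷ i) =
    ~-trans (prep y (shift-small s (<-≤-trans p q) i)) (~-sym (yxz _ p q))

  -- One letter of the row insertion of a decreasing word: c and c′ tell whether
  -- the row so far and the row including the letter are extended by the
  -- insertion; the row has r (afterwards r′) copies of the letter, and the
  -- letter occurs d times in the inserted and d′ times in the bumped word.
  data Local : (c r d c′ r′ d′ : ℕ) → Set where
    idle : ∀ {r d} → Local 0 r d d (r + d) 0
    pass : Local 1 0 0 1 0 0
    bump : ∀ {r d r′} → r + d ≡ suc r′ → Local 1 r d d r′ 1

  -- Inserting D into R turns R D into D′ R′; all letters exceed a. If the carry
  -- is 1 then a smaller letter x is still to be inserted, and bumps from R D.
  Inserts : (c a : ℕ) (R D D′ R′ : Word) → Set
  Inserts 0 a R D D′ R′ = ∀ u → IncrUpTo a u → u ++ R ++ D ~ D′ ++ u ++ R′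
  Inserts c a R D D′ R′ = ∀ x → x ≤ a → R ++ D ++ (x ∷ []) ~ D′ ++ x ∷ R′

  private
    rep-∷ : ∀ r (A : ℕ) w → replicate r A ++ A ∷ w ≡ A ∷ replicate r A ++ w
    rep-∷ zero    A w = refl
    rep-∷ (suc r) A w = cong (A ∷_) (rep-∷ r A w)

  -- The hypothesis treats the larger letters. If these are not called upon, the copies of `suc a`
  -- in the row take the part of `u`; an inserted copy of `suc a` takes the part of `x`. In a bump
  -- the new `x` travels left over the row until it stands behind the first copy of `suc a`, which
  -- thereby joins the bumped word.
  inserts-step : ∀ {c r d c′ r′ d′ a R D D′ R′} → Local c r d c′ r′ d′ → d ≤ 1 →
    DecrAbove (suc a) D′ → IncrFrom (suc (suc a)) R′ →
    Inserts c′ (suc a) R D D′ R′ →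
    Inserts c a (replicate r (suc a) ++ R) (D ++ replicate d (suc a))
                (D′ ++ replicate d′ (suc a)) (replicate r′ (suc a) ++ R′)
  inserts-step {r = r} {a = a} {R} {D} {D′} {R′} (idle {d = zero}) d≤1 dec inc h u i
    rewrite +-identityʳ r | ++-identityʳ D | ++-identityʳ D′ =
    ~-trans (≡⇒~ (trans (cong (u ++_) (++-assoc (replicate r (suc a)) R D)) (sym (++-assoc u _ _))))
    (~-trans (h (u ++ replicate r (suc a)) (incrUpTo-++ r (incrUpTo-weaken (n≤1+n a) i)))
             (≡⇒~ (cong (D′ ++_) (++-assoc u _ _))))
  inserts-step {r = r} {a = a} {R} {D} {D′} {R′} (idle {d = suc zero}) d≤1 dec inc h u i
    rewrite +-comm r 1 | ++-identityʳ D′ =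
    ~-trans (≡⇒~ (trans (cong (u ++_) (++-assoc (replicate r (suc a)) R _)) (sym (++-assoc u _ _))))
    (~-trans (~-++ˡ (u ++ replicate r (suc a)) (h (suc a) ≤-refl))
    (~-trans (shift-decr R′ (incrUpTo-++ r (incrUpTo-weaken (n≤1+n a) i)) dec)
    (≡⇒~ (cong (D′ ++_) (trans (++-assoc u _ _) (cong (u ++_) (rep-∷ r (suc a) R′)))))))
  inserts-step (idle {d = suc (suc d)}) (s≤s ())
  inserts-step {a = a} {R} {D} {D′} {R′} pass d≤1 dec inc h x p
    rewrite ++-identityʳ D | ++-identityʳ D′ = h x (≤-trans p (n≤1+n a))
  inserts-step {r = r} {r′ = r′} {a = a} {R} {D} {D′} {R′} (bump {d = zero} eq) d≤1 dec inc h x p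
    rewrite +-identityʳ r | eq | ++-identityʳ D =
    ~-trans (≡⇒~ (sym (++-assoc (replicate (suc r′) (suc a) ++ R) D _)))
    (~-trans (~-++ʳ (x ∷ []) (≡⇒~ (++-assoc (replicate (suc r′) (suc a)) R D)))
    (~-trans (~-++ʳ (x ∷ []) (h (replicate (suc r′) (suc a)) (incrUpTo-replicate (suc r′))))
    (~-trans (≡⇒~ (++-assoc D′ _ _))
    (~-trans (~-++ˡ D′ (shift-small [] (s≤s p) (incrFrom-replicate r′ (incrFrom-weaken (n≤1+n _) inc))))
    (≡⇒~ (trans (cong (λ z → D′ ++ suc a ∷ x ∷ z) (++-identityʳ _)) (sym (++-assoc D′ _ _))))))))
  inserts-step {r = r} {r′ = r′} {a = a} {R} {D} {D′} {R′} (bump {d = suc zero} eq) d≤1 dec inc h x p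
    rewrite +-comm r 1 | suc-injective eq =
    ~-trans (≡⇒~ (trans (++-assoc (replicate r′ (suc a)) R _) (cong (λ z → replicate r′ (suc a) ++ z)
       (trans (cong (R ++_) (++-assoc D _ _)) (trans (sym (++-assoc R _ _)) (trans (sym (++-assoc (R ++ D) _ _)) (cong (_++ (x ∷ [])) (++-assoc R D (suc a ∷ [])))))))))
    (~-trans (~-++ˡ (replicate r′ (suc a)) (~-++ʳ (x ∷ []) (h (suc a) ≤-refl)))
    (~-trans (≡⇒~ (cong (λ z → replicate r′ (suc a) ++ z) (++-assoc D′ _ _)))
    (~-trans (shift-decr (R′ ++ (x ∷ [])) (incrUpTo-replicate r′) dec)
    (~-trans (≡⇒~ (cong (D′ ++_) (trans (rep-∷ r′ (suc a) _) (cong (suc a ∷_) (sym (++-assoc (replicate r′ (suc a)) R′ (x ∷ [])))))))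
    (~-trans (~-++ˡ D′ (shift-small [] (s≤s p) (incrFrom-replicate r′ (incrFrom-weaken (n≤1+n _) inc))))
    (≡⇒~ (trans (cong (λ z → D′ ++ suc a ∷ x ∷ z) (++-identityʳ _)) (sym (++-assoc D′ _ _)))))))))
  inserts-step (bump {d = suc (suc d)} eq) (s≤s ())

  -- If l = r, the smaller letters do not extend the row, hence `idle`. If l = r + 1, either m + d
  -- exceeds r and a copy of the letter is bumped, or the letter occurs neither in the row nor in
  -- the word and the carry passes unchanged.
  local : ∀ {r m l d} → r ≤ m → r ≤ l → l ≤ suc r → d ≤ 1 → 
    Local (l ∸ r) (m ∸ r) d (((m + d) ⊔ l) ∸ m) (((m + d) ⊔ l) ∸ l) (((m + d) ⊓ l) ∸ r)
  local {r} {m} {l} {d} r≤m r≤l l≤ d≤1 with between r≤l l≤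
  ... | inj₁ refl rewrite m≥n⇒m⊔n≡m (≤-trans r≤m (m≤m+n m d)) | m≥n⇒m⊓n≡n (≤-trans r≤m (m≤m+n m d))
    | n∸n≡0 r | m+n∸m≡n m d | +-∸-comm d r≤m = idle
  ... | inj₂ refl with suc r ≤? m + d
  ...   | yes q rewrite m≥n⇒m⊔n≡m q | m≥n⇒m⊓n≡n q | m+n∸n≡m 1 r | m+n∸m≡n m d =
    bump (trans (sym (+-∸-comm d r≤m)) (+-cancelʳ-≡ r _ _ (trans (m∸n+n≡m (≤-trans (n≤1+n r) q)) (sym (trans (sym (+-suc (m + d ∸ suc r) r)) (m∸n+n≡m q))))))
  ...   | no q with refl ← ≤-antisym (≤-trans (m≤m+n m d) (≤-pred (≰⇒> q))) r≤m
               with refl ← +-cancelˡ-≡ r d 0 (trans (≤-antisym (≤-pred (≰⇒> q)) (m≤m+n r d)) (sym (+-identityʳ r)))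
    rewrite +-identityʳ r | m≤n⇒m⊔n≡n (n≤1+n r) | m≤n⇒m⊓n≡m (n≤1+n r) | n∸n≡0 r | m+n∸n≡m 1 r = pass

  row₁ : ∀ {a} → GT a → Vec ℕ a
  row₁ []            = []
  row₁ ((x ∷ _) ∷ t) = x ∷ row₁ t

  -- Deletes the first row of the tableau. The other rows contain no letter 1, so the pattern loses
  -- one row and the letters are renumbered by one; the parameter `k` of the words undoes this.
  lower : ∀ {a} → GT (suc a) → GT a
  lower (m ∷ [])          = []
  lower ((_ ∷ m) ∷ t@(_ ∷ _)) = m ∷ lower t

  -- Schensted insertion of a whole strictly decreasing word into one row, the row being given by
  -- its numbers of entries up to each letter. The carry of the growth rule becomes the multiplicity
  -- of the letter in the bumped word.
  insRow : ∀ {a} → Vec ℕ (suc a) → Vec ℕ (suc a) → Vec ℕ (suc a) × Vec ℕ a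
  insRow (m ∷ [])     (d ∷ [])        = (m + d) ∷ [] , []
  insRow (m ∷ r ∷ xs) (d ∷ D@(_ ∷ _)) =
    let x , D′ = insRow (r ∷ xs) D; l = Vec.head x in
    ((m + d) ⊔ l) ∷ x , (((m + d) ⊓ l) ∸ r) ∷ D′

  ins-∷ : ∀ {a c} {m : Vec ℕ (suc a)} {l} {t t′ : GT a} D → top t′ ≡ l → t′ ≡ ins t D →
    fwd c (top t) l m ∷ t′ ≡ ins (m ∷ t) (c ∷ D)
  ins-∷ _ refl refl = refl

  -- `t′` and `x` stand for `ins t D` and its first row, abstracted so that their patterns can be
  -- matched.
  ins-rows-∷ : ∀ {a m d r} {ms rs} (t : GT a) (t′ : GT (suc a)) x D →
    row₁ t′ ≡ x → lower t′ ≡ ins (lower ((r ∷ rs) ∷ t)) D →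
    row₁ (fwd d (r ∷ rs) (top t′) (m ∷ ms) ∷ t′) ≡ ((m + d) ⊔ Vec.head x) ∷ x ×
    lower (fwd d (r ∷ rs) (top t′) (m ∷ ms) ∷ t′) ≡
      ins (lower ((m ∷ ms) ∷ (r ∷ rs) ∷ t)) ((((m + d) ⊓ Vec.head x) ∸ r) ∷ D)
  ins-rows-∷ {ms = _ ∷ []} {[]} [] ((l ∷ []) ∷ []) _ [] refl eq = refl , refl
  ins-rows-∷ {rs = _ ∷ _} (_ ∷ _) ((l ∷ ls@(_ ∷ _)) ∷ _ ∷ _) _ D refl eq = refl , ins-∷ D refl eq

  -- `ins` runs over the letters and, for each of them, through all rows. Exchanging the two loops
  -- exhibits it as row insertion: the first row is completed, and its bumped word enters the
  -- remaining rows.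
  ins-rows : ∀ {a} (t : GT (suc a)) D →
    row₁ (ins t D) ≡ proj₁ (insRow (row₁ t) D) ×
    lower (ins t D) ≡ ins (lower t) (proj₂ (insRow (row₁ t) D))
  ins-rows ((m ∷ []) ∷ []) (d ∷ []) = refl , refl
  ins-rows ((m ∷ ms) ∷ t@((r ∷ rs) ∷ t′)) (d ∷ D@(_ ∷ _)) =
    ins-rows-∷ t′ (ins t D) _ _ (proj₁ (ins-rows t D)) (proj₂ (ins-rows t D))

  rowWord : ∀ {a} → ℕ → Vec ℕ a → Word
  rowWord {zero}        k _       = []
  rowWord {suc zero}    k (m ∷ _) = replicate m (suc k)
  rowWord {suc (suc a)} k (m ∷ x) = rowWord k x ++ replicate (m ∸ Vec.head x) (suc (suc (a + k)))

  decrWord : ∀ {a} → ℕ → Vec ℕ a → Word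
  decrWord         k []      = []
  decrWord {suc a} k (d ∷ D) = replicate d (suc (a + k)) ++ decrWord k D

  -- The reading word of the tableau whose row i has t^a_i letters at most a + k.
  readingWord : ∀ {a} → ℕ → GT a → Word
  readingWord {zero}  k t = []
  readingWord {suc a} k t = readingWord (suc k) (lower t) ++ rowWord k (row₁ t)

  data Row : ∀ {a} → Vec ℕ a → Set where
    [_] : ∀ m → Row (m ∷ [])
    _∷_ : ∀ {a m r} {x : Vec ℕ a} → r ≤ m → Row (r ∷ x) → Row (m ∷ r ∷ x)

  insRow-vert : ∀ {a d D} {m} {x : Vec ℕ a} → Row (m ∷ x) → All≤1 (d ∷ D) →
    let n = Vec.head (proj₁ (insRow (m ∷ x) (d ∷ D))) in m ≤ n × n ≤ suc m
  insRow-vert {d = d} {[]} [ m ] (p ∷ []) = m≤m+n m d , ≤-trans (+-monoʳ-≤ m p) (≤-reflexive (+-comm m 1))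
  insRow-vert {d = d} {D@(_ ∷ _)} {m} (q ∷ i) (p ∷ ps) with insRow-vert i ps
  ... | _ , l≤ = ≤-trans (m≤m+n m d) (m≤m⊔n _ _) ,
    ⊔-lub (≤-trans (+-monoʳ-≤ m p) (≤-reflexive (+-comm m 1))) (≤-trans l≤ (s≤s q))

  insRow-≤1 : ∀ {a D} {x : Vec ℕ (suc a)} → Row x → All≤1 D → All≤1 (proj₂ (insRow x D))
  insRow-≤1 {D = _ ∷ []} [ m ] (p ∷ []) = []
  insRow-≤1 {D = d ∷ D@(_ ∷ _)} {m ∷ r ∷ x} (q ∷ i) (p ∷ ps) with insRow-vert i ps
  ... | a , b = carry-out m d _ r a b ∷ insRow-≤1 i ps

  -- The row is scanned from its largest letter downwards. `R₀` and `D₀` hold the letters already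
  -- passed, `D₀′` and `R₀′` what they turn into, and `n ∸ m` tells whether the letters still to
  -- come extend the row.
  insRow-accum : ∀ {a} k {m n D} {x : Vec ℕ a} {R₀ D₀ D₀′ R₀′} → Row (m ∷ x) → All≤1 D →
    Vec.head (proj₁ (insRow (m ∷ x) D)) ≡ n →
    DecrAbove (suc (a + k)) D₀′ → IncrFrom (suc (suc (a + k))) R₀′ →
    Inserts (n ∸ m) (suc (a + k)) R₀ D₀ D₀′ R₀′ →
    (rowWord k (m ∷ x) ++ R₀) ++ D₀ ++ decrWord k D ~
    (D₀′ ++ decrWord (suc k) (proj₂ (insRow (m ∷ x) D))) ++ rowWord k (proj₁ (insRow (m ∷ x) D)) ++ R₀′
  insRow-accum {zero} k {D = d ∷ []} {R₀ = R₀} {D₀} {D₀′} {R₀′} [ m ] (p ∷ []) refl dec inc h =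
    ~-trans (≡⇒~ (cong (λ z → (replicate m (suc k) ++ R₀) ++ D₀ ++ z) (++-identityʳ _)))
      (inserts-step {a = k} loc p dec inc h [] [])
    where
    loc : Local 0 m d (m + d ∸ m) (m + d) 0
    loc rewrite m+n∸m≡n m d = idle
  insRow-accum {suc a} k {D = d ∷ D@(_ ∷ _)} {R₀ = R₀} {D₀} {D₀′} {R₀′} (_∷_ {m = m} {r} {x} r≤m i) (p ∷ ps) refl dec inc h =
    ~-trans (≡⇒~ (cong₂ _++_ (++-assoc (rowWord k (r ∷ x)) (replicate (m ∸ r) A) R₀) (sym (++-assoc D₀ (replicate d A) (decrWord k D)))))
    (~-trans (insRow-accum k {D = D} {x = x} i ps refl dec′ inc′ (inserts-step {a = suc (a + k)} loc p dec inc h))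
    (≡⇒~ (cong₂ _++_ (trans (++-assoc D₀′ _ _) (cong (λ z → D₀′ ++ replicate d′ (suc z) ++ decrWord (suc k) D′) (sym (+-suc a k))))
                     (sym (++-assoc (rowWord k y) _ R₀′)))))
    where
    y = proj₁ (insRow (r ∷ x) D)
    D′ = proj₂ (insRow (r ∷ x) D)
    l = Vec.head y
    r≤l = proj₁ (insRow-vert i ps)
    l≤ = proj₂ (insRow-vert i ps)
    A d′ : ℕ
    A = suc (suc (a + k))
    d′ = ((m + d) ⊓ l) ∸ r
    loc = local {r} {m} {l} {d} r≤m r≤l l≤ p
    dec′ : DecrAbove (suc (a + k)) (D₀′ ++ replicate d′ A)
    dec′ with d′ | carry-out m d l r r≤l l≤
    ... | zero  | _ = subst (DecrAbove _) (sym (++-identityʳ D₀′)) (decrAbove-weaken (n≤1+n _) dec)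
    ... | suc zero | _ = decrAbove-∷ʳ ≤-refl dec
    ... | suc (suc _) | s≤s ()
    inc′ = incrFrom-replicate {A} (((m + d) ⊔ l) ∸ l) (incrFrom-weaken (n≤1+n _) inc)

  insRow-~ : ∀ {a} k {D} {x : Vec ℕ (suc a)} → Row x → All≤1 D →
    rowWord k x ++ decrWord k D ~
    decrWord (suc k) (proj₂ (insRow x D)) ++ rowWord k (proj₁ (insRow x D))
  insRow-~ {a} k {D} {m ∷ x} i p =
    ~-trans (≡⇒~ (cong (_++ decrWord k D) (sym (++-identityʳ (rowWord k (m ∷ x))))))
    (~-trans (insRow-accum k i p refl [] [] none)
             (≡⇒~ (cong (decrWord (suc k) (proj₂ (insRow (m ∷ x) D)) ++_) (++-identityʳ _))))
    where
    none : ∀ {c a} → Inserts c a [] [] [] []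
    none {zero}  u _ = ~-refl
    none {suc c} x _ = ~-refl

  valid-row : ∀ {a} {t : GT (suc a)} → Valid t → Row (row₁ t)
  valid-row {t = (m ∷ []) ∷ []} _ = [ m ]
  valid-row {t = _ ∷ (_ ∷ _) ∷ _} (((p , _) ∷ _) ∷ v) = p ∷ valid-row v

  valid-lower : ∀ {a} {t : GT (suc a)} → Valid t → Valid (lower t)
  valid-lower {t = (_ ∷ []) ∷ []} _ = []
  valid-lower {t = (_ ∷ _) ∷ (_ ∷ []) ∷ []} (((_ ∷ i)) ∷ v) = i ∷ valid-lower v
  valid-lower {t = (_ ∷ _) ∷ (_ ∷ _) ∷ _ ∷ _} (((_ ∷ i)) ∷ v) = i ∷ valid-lower v

  ins-~ : ∀ {a} k {t : GT a} {D} → Valid t → All≤1 D →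
    readingWord k (ins t D) ~ readingWord k t ++ decrWord k D
  ins-~ {zero}  k {D = []} v p = ~-refl
  ins-~ {suc a} k {t} {D} v p with x , y ← ins-rows t D rewrite x | y =
    ~-trans (~-++ʳ _ (ins-~ (suc k) (valid-lower v) (insRow-≤1 (valid-row v) p)))
    (~-trans (≡⇒~ (++-assoc (readingWord (suc k) (lower t)) _ _))
    (~-trans (~-++ˡ (readingWord (suc k) (lower t)) (~-sym (insRow-~ k (valid-row v) p)))
             (≡⇒~ (sym (++-assoc (readingWord (suc k) (lower t)) _ _)))))

  matrixWord : ∀ {a N} → Vec (Vec ℕ a) N → Word
  matrixWord []      = []
  matrixWord (D ∷ M) = matrixWord M ++ decrWord 0 D

  row₁-zero : ∀ a k → rowWord k (row₁ (zeroGT (suc a))) ≡ []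
  row₁-zero zero    k = refl
  row₁-zero (suc a) k rewrite row₁-zero a k = refl

  lower-zero : ∀ a → lower (zeroGT (suc a)) ≡ zeroGT a
  lower-zero zero    = refl
  lower-zero (suc a) = cong (Vec.replicate (suc a) 0 ∷_) (lower-zero a)

  readingWord-zero : ∀ a k → readingWord k (zeroGT a) ≡ []
  readingWord-zero zero    k = refl
  readingWord-zero (suc a) k rewrite row₁-zero a k | lower-zero a = trans (++-identityʳ _) (readingWord-zero a (suc k))

  rsk-~ : ∀ {a N} {M : Vec (Vec ℕ a) N} → All≤1′ M → readingWord 0 (proj₁ (rsk M)) ~ matrixWord M
  rsk-~ {a} [] = ≡⇒~ (readingWord-zero a 0)
  rsk-~ (p ∷ ps) = ~-trans (ins-~ 0 (rsk-valid ps) p) (~-++ʳ _ (rsk-~ ps))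

-- Queues in tandem: the least reproduced states as Knuth invariants

module TandemQueues where

  open Plactic using (_~_; ~-refl; ~-sym; ~-trans; prep; yxz; xzy)

  -- A state gives the numbers of customers in the queues 0, 1, 2, … in tandem.
  State : Set
  State = ℕ → ℕ

  infix 4 _≐_
  _≐_ : State → State → Set
  m ≐ n = ∀ j → m j ≡ n j

  infixl 6 _⊕_
  _⊕_ : State → State → State
  (m ⊕ n) j = m j + n j

  -- The letter i + 1 moves a customer, if there is one, from queue i to queue i + 1.
  T : ℕ → State → State
  T zero          n j             = n j
  T (suc zero)    n zero          = pred (n 0)
  T (suc zero)    n (suc zero)    = 1 ⊓ n 0 + n 1
  T (suc zero)    n (suc (suc j)) = n (suc (suc j))
  T (suc (suc i)) n zero          = n 0
  T (suc (suc i)) n (suc j)       = T (suc i) (n ∘ suc) j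

  act : Word → State → State
  act w n = foldr T n w

  -- A letter changes a queue according to that queue and the one before it. The queues below `k`
  -- therefore evolve on their own, and states can be compared on them alone.
  T-mono : ∀ i {k m n} → (∀ j → j < k → m j ≤ n j) → ∀ j → j < k → T i m j ≤ T i n j
  T-mono zero          p j             q = p j q
  T-mono (suc zero)    p zero          q = pred-mono-≤ (p 0 q)
  T-mono (suc zero)    p (suc zero)    q = +-mono-≤ (⊓-monoʳ-≤ 1 (p 0 (<-trans (s≤s z≤n) q))) (p 1 q)
  T-mono (suc zero)    p (suc (suc j)) q = p _ q
  T-mono (suc (suc i)) p zero          q = p 0 q
  T-mono (suc (suc i)) {suc k} p (suc j) (s≤s q) = T-mono (suc i) {k} (λ j r → p (suc j) (s≤s r)) j q

  act-mono : ∀ w {k m n} → (∀ j → j < k → m j ≤ n j) → ∀ j → j < k → act w m j ≤ act w n j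
  act-mono []      p = p
  act-mono (i ∷ w) p = T-mono i (act-mono w p)

  act-cong-below : ∀ w {k m n} → (∀ j → j < k → m j ≡ n j) → ∀ j → j < k → act w m j ≡ act w n j
  act-cong-below w p j q =
    ≤-antisym (act-mono w (λ j r → ≤-reflexive (p j r)) j q)
              (act-mono w (λ j r → ≤-reflexive (sym (p j r))) j q)

  T-cong : ∀ i {m n} → m ≐ n → T i m ≐ T i n
  T-cong i p j = act-cong-below (i ∷ []) (λ j _ → p j) j (n<1+n j)

  act-cong : ∀ w {m n} → m ≐ n → act w m ≐ act w n
  act-cong w p j = act-cong-below w (λ j _ → p j) j (n<1+n j)

  T-comm : ∀ {x z} n → suc (suc x) ≤ z → T x (T z n) ≐ T z (T x n)
  T-comm {zero} n p j = refl
  T-comm {suc zero} {suc (suc (suc z))} n p zero          = refl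
  T-comm {suc zero} {suc (suc (suc z))} n p (suc zero)    = refl
  T-comm {suc zero} {suc (suc (suc z))} n p (suc (suc j)) = refl
  T-comm {suc (suc x)} {suc (suc z)}    n (s≤s p) zero    = refl
  T-comm {suc (suc x)} {suc (suc z)}    n (s≤s p) (suc j) = T-comm {suc x} {suc z} (n ∘ suc) p j
  T-comm {suc zero}    {suc zero}       n (s≤s ()) j
  T-comm {suc zero}    {suc (suc zero)} n (s≤s (s≤s ())) j
  T-comm {suc (suc x)} {suc zero}       n (s≤s ()) j

  -- Consider the queue that `a` fills and `suc a` serves, of length n. If `a` finds a customer,
  -- min(2, n + 1) customers leave this queue on either side, otherwise min(2, n).
  T-bab : ∀ a n → T (suc a) (T a (T (suc a) n)) ≐ T (suc a) (T (suc a) (T a n))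
  T-bab zero          n j = refl
  T-bab (suc zero)    n zero = refl
  T-bab (suc zero)    n (suc zero) with n 0 | n 1
  ... | zero  | _     = refl
  ... | suc _ | zero  = refl
  ... | suc _ | suc _ = refl
  T-bab (suc zero)    n (suc (suc zero)) with n 0 | n 1
  ... | zero  | _     = refl
  ... | suc _ | zero  = refl
  ... | suc _ | suc _ = refl
  T-bab (suc zero)    n (suc (suc (suc j))) = refl
  T-bab (suc (suc a)) n zero    = refl
  T-bab (suc (suc a)) n (suc j) = T-bab (suc a) (n ∘ suc) j

  T-aba : ∀ a n → T a (T (suc a) (T a n)) ≐ T (suc a) (T a (T a n))
  T-aba zero          n j = refl
  T-aba (suc zero)    n zero = refl
  T-aba (suc zero)    n (suc zero) with n 0 | n 1
  ... | zero        | _     = refl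
  ... | suc zero    | _     = refl
  ... | suc (suc _) | _     = refl
  T-aba (suc zero)    n (suc (suc zero)) with n 0 | n 1
  ... | zero        | _     = refl
  ... | suc zero    | _     = refl
  ... | suc (suc _) | _     = refl
  T-aba (suc zero)    n (suc (suc (suc j))) = refl
  T-aba (suc (suc a)) n zero    = refl
  T-aba (suc (suc a)) n (suc j) = T-aba (suc a) (n ∘ suc) j

  -- For x < z the letters x and z act on disjoint pairs of queues unless z = x + 1.
  act-plactic : ∀ {v w} → v ~ w → ∀ n → act v n ≐ act w n
  act-plactic ~-refl        n j = refl
  act-plactic (~-sym p)     n j = sym (act-plactic p n j)
  act-plactic (~-trans p q) n j = trans (act-plactic p n j) (act-plactic q n j)
  act-plactic (prep a p)    n   = T-cong a (act-plactic p n)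
  act-plactic (yxz {x} {y} {z} s p q) n with suc (suc x) ≤? z
  ... | yes r = T-cong y (T-comm (act s n) r)
  ... | no  r with refl ← ≤-antisym (≤-pred (≰⇒> r)) (≤-trans p q)
              with refl ← ≤-antisym q p
    = T-bab x (act s n)
  act-plactic (xzy {x} {y} {z} s p q) n with suc (suc x) ≤? z
  ... | yes r = T-comm (T y (act s n)) r
  ... | no  r with refl ← ≤-antisym (≤-pred (≰⇒> r)) (≤-<-trans p q)
              with refl ← ≤-antisym (≤-pred q) p
    = T-aba x (act s n)

  T-add-idle : ∀ i {f} n → f i ≡ 0 → T (suc i) (n ⊕ f) ≐ T (suc i) n ⊕ f
  T-add-idle zero    {f} n p zero rewrite p | +-identityʳ (n 0) = sym (+-identityʳ _)
  T-add-idle zero    {f} n p (suc zero) rewrite p | +-identityʳ (n 0) = sym (+-assoc (1 ⊓ n 0) (n 1) (f 1))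
  T-add-idle zero        n p (suc (suc j)) = refl
  T-add-idle (suc i)     n p zero    = refl
  T-add-idle (suc i)     n p (suc j) = T-add-idle i (n ∘ suc) p j

  -- Customers are indistinguishable: if `f` has one in the queue, the one who moves can be taken
  -- from `f`, and `n` stays as it is.
  T-add-move : ∀ i {f} n → 0 < f i → T (suc i) (n ⊕ f) ≐ n ⊕ T (suc i) f
  T-add-move zero {f} n p zero with f 0 | p
  ... | suc x | _ rewrite +-suc (n 0) x = refl
  T-add-move zero {f} n p (suc zero) with f 0 | p
  ... | suc x | _ rewrite +-suc (n 0) x = sym (+-suc (n 1) (f 1))
  T-add-move zero        n p (suc (suc j)) = refl
  T-add-move (suc i)     n p zero    = refl
  T-add-move (suc i)     n p (suc j) = T-add-move i (n ∘ suc) p j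

  T-idle : ∀ i {f} → f i ≡ 0 → T (suc i) f ≐ f
  T-idle zero    p zero       rewrite p = refl
  T-idle zero    p (suc zero) rewrite p = refl
  T-idle zero    p (suc (suc j)) = refl
  T-idle (suc i) p zero    = refl
  T-idle (suc i) p (suc j) = T-idle i p j

  T-from : ∀ i n → T (suc i) n i ≡ pred (n i)
  T-from zero    n = refl
  T-from (suc i) n = T-from i (n ∘ suc)

  T-to : ∀ i n → T (suc i) n (suc i) ≡ 1 ⊓ n i + n (suc i)
  T-to zero    n = refl
  T-to (suc i) n = T-to i (n ∘ suc)

  T-other : ∀ i n {j} → j ≢ i → j ≢ suc i → T (suc i) n j ≡ n j
  T-other zero    n {zero}        p q = ⊥-elim (p refl)
  T-other zero    n {suc zero}    p q = ⊥-elim (q refl)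
  T-other zero    n {suc (suc j)} p q = refl
  T-other (suc i) n {zero}        p q = refl
  T-other (suc i) n {suc j}       p q = T-other i (n ∘ suc) (p ∘ cong suc) (q ∘ cong suc)

  -- The word reproduces the queues of x, up to refilling queue 0; the queues from m on
  -- are ignored.
  Fix : ℕ → Word → State → Set
  Fix m w x = ∀ j → 1 ≤ j → j < m → act w x j ≡ x j

  record Least (m c : ℕ) (w : Word) (x : State) : Set where
    field
      start : x 0 ≡ c
      fix   : Fix m w x
      least : ∀ y → y 0 ≡ c → Fix m w y → ∀ j → j < m → x j ≤ y j

  -- `Fix` involves a word only through its action, so each of the two states competes with the
  -- other. Least states are thus invariants of Knuth classes.
  least-unique : ∀ {m c v w x y} → (∀ n → act v n ≐ act w n) →
    Least m c v x → Least m c w y → ∀ j → j < m → x j ≡ y j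
  least-unique eq p q j r = ≤-antisym
    (Least.least p _ (Least.start q) (λ j a b → trans (eq _ j) (Least.fix q j a b)) j r)
    (Least.least q _ (Least.start p) (λ j a b → trans (sym (eq _ j)) (Least.fix p j a b)) j r)

  -- Removing from w the letters at which a single customer moves leaves w′;
  -- e counts its passages from the left to the right end of w.
  record Peel (k : ℕ) (w w′ : Word) (e : State) : Set where
    field
      one   : e 0 ≡ 1
      add   : ∀ n j → 1 ≤ j → j < k → act w (n ⊕ e) j ≡ act w′ n j + e j
      below : ∀ m y → m ≤ k → 0 < y 0 → Fix m w y → ∀ j → j < m → e j ≤ y j

  sumTo : ℕ → State → ℕ
  sumTo zero    e = 0
  sumTo (suc k) e = sumTo k e + e (suc k)

  -- Equal to the sum of (k - j) e j over 1 ≤ j < k. If `e` marks the letters after which the scan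
  -- wraps around, this is the charge of a permutation of length k. The recursion matches that of
  -- `total`.
  turns : ℕ → State → ℕ
  turns zero    e = 0
  turns (suc k) e = turns k e + sumTo k e

  data Peels : List ℕ → Word → ℕ → Set where
    []  : ∀ {w} → Peels [] w 0
    _∷_ : ∀ {k ks w w′ e s} → Peel k w w′ e → Peels ks w′ s → Peels (k ∷ ks) w (turns k e + s)

  when : {P : Set} → Dec P → ℕ → ℕ
  when (yes _) x = x
  when (no  _) x = 0

  -- For weakly decreasing `ks` the number of parts that are at least m, that is, the m-th part of
  -- the conjugate. Stopping at the first smaller part makes one step of `Peels` correspond to one
  -- unfolding.
  atLeast : ℕ → List ℕ → ℕ
  atLeast m []       = 0
  atLeast m (k ∷ ks) = when (m ≤? k) (suc (atLeast m ks))

  atLeast-small : ∀ {m k ks} → Linked _≥_ (k ∷ ks) → k < m → atLeast m ks ≡ 0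
  atLeast-small [-] q = refl
  atLeast-small {m} {ks = k′ ∷ _} (r ∷ _) q with m ≤? k′
  ... | yes m≤k′ = contradiction (≤-trans m≤k′ r) (<⇒≱ q)
  ... | no  _    = refl

  total : ℕ → (ℕ → State) → ℕ
  total zero    X = 0
  total (suc K) X = total K X + sumTo K (X (suc K))

  sumTo-cong : ∀ k {e f} → (∀ j → 1 ≤ j → j ≤ k → e j ≡ f j) → sumTo k e ≡ sumTo k f
  sumTo-cong zero    p = refl
  sumTo-cong (suc k) p = cong₂ _+_ (sumTo-cong k (λ j a b → p j a (m≤n⇒m≤1+n b))) (p (suc k) (s≤s z≤n) ≤-refl)

  sumTo-⊕ : ∀ k e f → sumTo k (e ⊕ f) ≡ sumTo k e + sumTo k f
  sumTo-⊕ zero    e f = refl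
  sumTo-⊕ (suc k) e f rewrite sumTo-⊕ k e f =
    solve 4 (λ a b c d → a :+ b :+ (c :+ d) := a :+ c :+ (b :+ d)) refl (sumTo k e) (sumTo k f) (e (suc k)) (f (suc k))
    where open +-*-Solver

  sumTo-zero : ∀ k {e} → (∀ j → e j ≡ 0) → sumTo k e ≡ 0
  sumTo-zero zero    p = refl
  sumTo-zero (suc k) p rewrite sumTo-zero k p = p (suc k)

  -- By `below` every competitor `y` contains the path `e`. By `add` the difference of the two is
  -- reproduced by `w′` with one customer fewer, so the leastness of `x` applies to it.
  peel-least : ∀ {m k w w′ e x c} → m ≤ k → Peel k w w′ e → Least m c w′ x → Least m (suc c) w (e ⊕ x)
  peel-least {m} {k} {w} {w′} {e} {x} {c} m≤k p l = record
    { start = cong₂ _+_ one start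
    ; fix   = λ j a b → begin
        act w (e ⊕ x) j  ≡⟨ act-cong w (λ j → +-comm (e j) (x j)) j ⟩
        act w (x ⊕ e) j  ≡⟨ add x j a (<-≤-trans b m≤k) ⟩
        act w′ x j + e j ≡⟨ cong (_+ e j) (fix j a b) ⟩
        x j + e j        ≡⟨ +-comm (x j) (e j) ⟩
        e j + x j        ∎
    ; least = λ y y₀ f → λ j j<m →
        let e≤y = below m y m≤k (subst (0 <_) (sym y₀) (s≤s z≤n)) f
            z   = λ j → y j ∸ e j
            z⊕e : ∀ j → j < m → (z ⊕ e) j ≡ y j
            z⊕e j r = m∸n+n≡m (e≤y j r)
            fz : Fix m w′ z
            fz j a b = +-cancelʳ-≡ (e j) _ _ (trans (sym (add z j a (<-≤-trans b m≤k)))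
              (trans (act-cong-below w z⊕e j b) (trans (f j a b) (sym (z⊕e j b)))))
        in ≤-trans (+-monoʳ-≤ (e j) (least z (cong₂ _∸_ y₀ one) fz j j<m))
                   (≤-reflexive (m+[n∸m]≡n (e≤y j j<m)))
    }
    where
    open Peel p
    open Least l
    open ≡-Reasoning

  fix-zero : ∀ w j → act w (λ _ → 0) j ≡ 0
  fix-zero [] j = refl
  fix-zero (i ∷ w) j = trans (T-cong i (fix-zero w) j) (T-zero i j)
    where
    T-zero : ∀ i j → T i (λ _ → 0) j ≡ 0
    T-zero zero    j = refl
    T-zero (suc i) j = T-idle i refl j

  least-zero : ∀ {m w} → Least m 0 w (λ _ → 0)
  least-zero {w = w} = record
    { start = refl ; fix = λ j _ _ → fix-zero w j ; least = λ _ _ _ _ _ → z≤n }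

  -- Exchanging the sums, Σ_r Σ_j e^r_j (k_r − j) is the sum over m of the first m − 1 entries
  -- of X m = Σ_{k_r ≥ m} e^r.
  peels-least : ∀ {ks w s} → Linked _≥_ ks → Peels ks w s → ∀ K → All (_≤ K) ks →
    Σ[ X ∈ (ℕ → State) ]
      (∀ m → Least m (atLeast m ks) w (X m)) ×
      (∀ m j → atLeast m ks ≡ 0 → X m j ≡ 0) × total K X ≡ s
  peels-least _ [] K _ = (λ _ _ → 0) , (λ _ → least-zero) , (λ _ _ _ → refl) , none K
    where
    none : ∀ K → total K (λ _ _ → 0) ≡ 0
    none zero    = refl
    none (suc K) rewrite none K = sumTo-zero K (λ _ → refl)
  peels-least {k ∷ ks} {w} d (_∷_ {e = e} {s} p ps) K (k≤K ∷ b)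
    with X , l , z , t ← peels-least (Linked.tail d) ps K b
    = Y , l′ , z′ , trans (split K k≤K z″) (cong (turns k e +_) t)
    where
    Y : ℕ → State
    -- For m > k neither this subword nor, as the parts decrease, any later one has m letters, and
    -- the state is zero.
    Y m j = when (m ≤? k) (e j + X m j)
    l′ : ∀ m → Least m (atLeast m (k ∷ ks)) w (Y m)
    l′ m with m ≤? k
    ... | yes q = peel-least q p (l m)
    ... | no  _ = least-zero
    z′ : ∀ m j → atLeast m (k ∷ ks) ≡ 0 → Y m j ≡ 0
    z′ m j q with m ≤? k
    ... | no  _ = refl
    ... | yes _ with () ← q
    z″ : ∀ m j → k < m → X m j ≡ 0
    z″ m j q = z m j (atLeast-small d q)
    Y-≤ : ∀ m j → m ≤ k → Y m j ≡ (e ⊕ X m) j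
    Y-≤ m j q with m ≤? k
    ... | yes _ = refl
    ... | no  r = contradiction q r
    Y-> : ∀ m j → k < m → Y m j ≡ 0
    Y-> m j q with m ≤? k
    ... | yes r = contradiction r (<⇒≱ q)
    ... | no  _ = refl
    split-≤ : ∀ K → K ≤ k → total K Y ≡ turns K e + total K X
    split-≤ zero    q = refl
    split-≤ (suc K) q rewrite split-≤ K (≤-trans (n≤1+n K) q)
      | sumTo-cong K {Y (suc K)} (λ j _ _ → Y-≤ (suc K) j q) | sumTo-⊕ K e (X (suc K)) =
      solve 4 (λ a b c d → a :+ b :+ (c :+ d) := a :+ c :+ (b :+ d)) refl (turns K e) (total K X) (sumTo K e) (sumTo K (X (suc K)))
      where open +-*-Solver
    split : ∀ K → k ≤ K → (∀ m j → k < m → X m j ≡ 0) → total K Y ≡ turns k e + total K X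
    split zero    q z with refl ← n≤0⇒n≡0 q = split-≤ 0 z≤n
    split (suc K) q z with k ≟ suc K
    ... | yes refl = split-≤ (suc K) ≤-refl
    ... | no  r rewrite split K (≤-pred (≤∧≢⇒< q r)) z
        | sumTo-zero K (λ j → Y-> (suc K) j (≤∧≢⇒< q r)) | sumTo-zero K (λ j → z (suc K) j (≤∧≢⇒< q r))
        | +-identityʳ (total K X) | +-identityʳ (turns k e + total K X) = refl

  total-cong : ∀ K {X Y} → (∀ m j → j < m → X m j ≡ Y m j) → total K X ≡ total K Y
  total-cong zero    p = refl
  total-cong (suc K) p = cong₂ _+_ (total-cong K p) (sumTo-cong K (λ j _ q → p (suc K) j (s≤s q)))

  ≤-foldr-⊔ : ∀ ks → All (_≤ foldr _⊔_ 0 ks) ks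
  ≤-foldr-⊔ []       = []
  ≤-foldr-⊔ (k ∷ ks) = m≤m⊔n k _ ∷ All.map (λ p → ≤-trans p (m≤n⊔m k _)) (≤-foldr-⊔ ks)

  -- The value is a sum over the least states, which the action determines, however the subwords
  -- were chosen. The maximum of `ks` is a common upper limit for m.
  peels-unique : ∀ {ks v w s t} → Linked _≥_ ks → (∀ n → act v n ≐ act w n) →
    Peels ks v s → Peels ks w t → s ≡ t
  peels-unique {ks} d eq p q
    with X , l , _ , a ← peels-least d p (foldr _⊔_ 0 ks) (≤-foldr-⊔ ks)
       | Y , m , _ , b ← peels-least d q (foldr _⊔_ 0 ks) (≤-foldr-⊔ ks)
    = trans (sym a) (trans (total-cong (foldr _⊔_ 0 ks) (λ i → least-unique eq (l i) (m i))) b)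

-- A marked subword as the path of one customer

module Markings where

  open TandemQueues

  -- Letters with keys in place of positions. Only the order of the keys matters, so they survive
  -- the deletion of letters, and for a filling they can be computed from its entries.
  Keyed : Set
  Keyed = List (ℕ × ℕ)

  letters : Keyed → Word
  letters = map proj₂

  Sorted : Keyed → Set
  Sorted = AllPairs (λ x y → proj₁ x < proj₁ y)

  unmarked : (ℕ → ℕ) → Keyed → Keyed
  unmarked q = filter (λ (p , i) → ¬? (p ≟ q i))

  -- Going leftwards (cyclically) from position a, position b is not met after position p.
  Passed : (a b p : ℕ) → Set
  Passed a b p = (b < a → p ≤ b ⊎ a ≤ p) × (a < b → a < p × p ≤ b)

  -- q j is the position of the letter j of the first standard subword of W, and
  -- q 0 lies to the right of W.
  record Marking (k : ℕ) (W : Keyed) (q : ℕ → ℕ) : Set where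
    field
      sorted : Sorted W
      range  : ∀ {p j} → (p , j) ∈ W → 1 ≤ j × j ≤ k
      marked : ∀ j → 1 ≤ j → j ≤ k → (q j , j) ∈ W
      greedy : ∀ {p} j → j < k → (p , suc j) ∈ W → Passed (q j) (q (suc j)) p
      first  : ∀ {p j} → (p , j) ∈ W → p < q 0

  -- The state of the customer at the right end. He has to pass there in queue j if the letter j + 1
  -- lies to the right of the letter j. The 1 in queue 0 is his first arrival.
  wrap : (ℕ → ℕ) → ℕ → ℕ
  wrap q zero    = 1
  wrap q (suc j) = when (q (suc j) <? q (suc (suc j))) 1

  sorted-unique : ∀ {W p i j} → Sorted W → (p , i) ∈ W → (p , j) ∈ W → i ≡ j
  sorted-unique (s ∷ ss) (here refl) (here refl) = refl
  sorted-unique (s ∷ ss) (here refl) (there y)   = ⊥-elim (<-irrefl refl (All.lookup s y))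
  sorted-unique (s ∷ ss) (there x)   (here refl) = ⊥-elim (<-irrefl refl (All.lookup s x))
  sorted-unique (s ∷ ss) (there x)   (there y)   = sorted-unique ss x y

  when-yes : ∀ {P : Set} (d : Dec P) {x} → P → when d x ≡ x
  when-yes (yes _) p = refl
  when-yes (no ¬p) p = contradiction p ¬p

  when-no : ∀ {P : Set} (d : Dec P) {x} → ¬ P → when d x ≡ 0
  when-no (yes p) ¬p = contradiction p ¬p
  when-no (no _)  _  = refl

  module _ {k W q} (M : Marking k W q) where
    open Marking M

    private
      e : State
      e = wrap q

      -- Once the letters at the positions ≥ t have been met, the customer is in queue j
      -- iff q (j + 1) < t ≤ q j in cyclic order; this is f j = e j + χ t j − χ t (j + 1).
      χ : ℕ → ℕ → ℕ
      -- No letter leads into queue 0.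
      χ t zero    = 0
      χ t (suc j) = when (t ≤? q (suc j)) 1

      At : ℕ → State → Set
      At t f = ∀ j → j < k → f j + χ t (suc j) ≡ e j + χ t j

      χ-yes : ∀ {t} j → t ≤ q (suc j) → χ t (suc j) ≡ 1
      χ-yes {t} j p = when-yes (t ≤? q (suc j)) p

      χ-no : ∀ {t} j → q (suc j) < t → χ t (suc j) ≡ 0
      χ-no {t} j p = when-no (t ≤? q (suc j)) (<⇒≱ p)

      record Suffix (t : ℕ) (V : Keyed) : Set where
        field
          sorted′ : Sorted V
          sub     : ∀ {x} → x ∈ V → x ∈ W
          above   : All (λ x → t ≤ proj₁ x) V
          split   : ∀ j → 1 ≤ j → j ≤ k → q j < t ⊎ (q j , j) ∈ V
      open Suffix

      tail : ∀ {t p i V} → Suffix t ((p , i) ∷ V) → Suffix (suc p) V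
      tail {V = V} s with sorted′ s | above s
      ... | x ∷ xs | y ∷ _ = record
        { sorted′ = xs
        ; sub     = sub s ∘ there
        ; above   = x
        ; split   = λ j a b → [ (λ r → inj₁ (<-≤-trans r (≤-trans y (n≤1+n _))))
                              , (λ { (here refl) → inj₁ ≤-refl ; (there r) → inj₂ r }) ]′ (split s j a b)
        }

      χ-step : ∀ {t p i V} → Suffix t ((p , i) ∷ V) → ∀ j → (p ≡ q j → i ≢ j) → j ≤ k → χ t j ≡ χ (suc p) j
      χ-step s zero    _ _ = refl
      χ-step {t} {p} s (suc j) ne b with sorted′ s | above s | split s (suc j) (s≤s z≤n) b
      ... | _ | y ∷ _ | inj₁ r = trans (χ-no j r) (sym (χ-no j (<-≤-trans r (≤-trans y (n≤1+n p)))))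
      ... | _ | _ | inj₂ (here refl) = ⊥-elim (ne refl refl)
      ... | x ∷ _ | y ∷ _ | inj₂ (there r) =
        trans (χ-yes j (≤-trans y (<⇒≤ (All.lookup x r)))) (sym (χ-yes j (All.lookup x r)))

      q-≢ : ∀ j → j < k → q j ≢ q (suc j)
      q-≢ zero    b eq = <-irrefl (sym eq) (first (marked 1 (s≤s z≤n) b))
      q-≢ (suc j) b eq with () ← sorted-unique sorted (marked (suc j) (s≤s z≤n) (<⇒≤ b))
                              (subst (λ z → (z , suc (suc j)) ∈ W) (sym eq) (marked (suc (suc j)) (s≤s z≤n) b))

      e-yes : ∀ j → q j < q (suc j) → j < k → e j ≡ 1
      e-yes zero    p b = refl
      e-yes (suc j) p b = when-yes (q (suc j) <? q (suc (suc j))) p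

      e-no : ∀ j → q (suc (suc j)) < q (suc j) → e (suc j) ≡ 0
      e-no j p = when-no (q (suc j) <? q (suc (suc j))) (<⇒≯ p)

      q₀ : 1 ≤ k → q 1 < q 0
      q₀ b = first (marked 1 (s≤s z≤n) b)

      -- Either the scan wraps between the letters i and i + 1, and he has been in queue i since the
      -- right end, or `q i` lies further right and has been met. In queue 0 he waits from the
      -- start.
      present : ∀ {f} i → i < k → At (suc (q (suc i))) f → f i ≡ 1
      present {f} i b at with at i b
      ... | eq rewrite χ-no {suc (q (suc i))} i ≤-refl | +-identityʳ (f i) = trans eq (lemma i b)
        where
        lemma : ∀ i → i < k → e i + χ (suc (q (suc i))) i ≡ 1
        lemma zero b = refl
        lemma (suc i) b with <-cmp (q (suc i)) (q (suc (suc i)))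
        ... | tri< p _ _ rewrite e-yes (suc i) p b | χ-no {suc (q (suc (suc i)))} i (<-trans p (n<1+n _)) = refl
        ... | tri≈ _ p _ = ⊥-elim (q-≢ (suc i) b p)
        ... | tri> _ _ p rewrite e-no i p | χ-yes i p = refl

      -- Here greediness enters. The customer is in queue i just between `q i` and `q (suc i)` in
      -- cyclic order, and a greedy choice leaves no other letter `suc i` in that interval.
      absent : ∀ {f p} i → i < k → (p , suc i) ∈ W → p ≢ q (suc i) → At (suc p) f → f i ≡ 0
      absent {f} {p} i b m ne at = +-cancelʳ-≡ (χ (suc p) (suc i)) (f i) 0 (trans (at i b) (lemma i b m ne (greedy i b m)))
        where
        lemma : ∀ i → i < k → (p , suc i) ∈ W → p ≢ q (suc i) → Passed (q i) (q (suc i)) p →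
                e i + χ (suc p) i ≡ 0 + χ (suc p) (suc i)
        lemma zero b m ne (g , _) with g (q₀ b)
        ... | inj₁ x = sym (χ-yes 0 (≤∧≢⇒< x ne))
        ... | inj₂ x = contradiction (first m) (≤⇒≯ x)
        lemma (suc i) b m ne g with <-cmp (q (suc i)) (q (suc (suc i)))
        ... | tri< r _ _ with proj₂ g r
        ...   | x , y rewrite e-yes (suc i) r b | χ-no {suc p} i (<-trans x (n<1+n p)) = sym (χ-yes (suc i) (≤∧≢⇒< y ne))
        lemma (suc i) b m ne g | tri≈ _ r _ = ⊥-elim (q-≢ (suc i) b r)
        lemma (suc i) b m ne g | tri> _ _ r with proj₁ g r
        ... | inj₁ x rewrite e-no i r | χ-yes {suc p} (suc i) (≤∧≢⇒< x ne) = χ-yes i (<-trans (≤∧≢⇒< x ne) r)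
        ... | inj₂ x rewrite e-no i r | χ-no {suc p} (suc i) (s≤s (≤-trans (<⇒≤ r) x)) with m≤n⇒m<n∨m≡n x
        ...   | inj₁ y = χ-no i (<-trans y (n<1+n p))
        ...   | inj₂ refl = χ-no {suc p} i ≤-refl

      step : ∀ {t p i V f} → Suffix t ((p , i) ∷ V) → At (suc p) f → At t (T i f)
      step {i = zero} s at = contradiction (proj₁ (range (sub s (here refl)))) λ ()
      step {t} {p} {suc i} {V} {f} s at j b with range (sub s (here refl)) | p ≟ q (suc i)
      ... | _ , i<k | no ne = begin
        T (suc i) f j + χ t (suc j) ≡⟨ cong₂ _+_ (T-idle i (absent i i<k (sub s (here refl)) ne at) j) (χ-step s (suc j) ne′ b) ⟩
        f j + χ (suc p) (suc j)      ≡⟨ at j b ⟩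
        e j + χ (suc p) j            ≡⟨ cong (e j +_) (sym (χ-step s j ne′ (<⇒≤ b))) ⟩
        e j + χ t j                  ∎
        where
        open ≡-Reasoning
        ne′ : ∀ {j} → p ≡ q j → suc i ≢ j
        ne′ r refl = ne r
      ... | _ , i<k | yes refl with <-cmp j i
      ...   | tri≈ _ refl _
        rewrite T-from i f | present i i<k at | χ-yes {t} i (All.head (above s)) =
        sym (trans (cong (e i +_) (χ-step s i (λ r _ → q-≢ i i<k (sym r)) (<⇒≤ i<k)))
            (trans (sym (at i i<k)) (trans (cong₂ _+_ (present i i<k at) (χ-no {suc (q (suc i))} i ≤-refl)) refl)))
      ...   | tri< j<i _ _ = begin
        T (suc i) f j + χ t (suc j)  ≡⟨ cong₂ _+_ (T-other i f (<⇒≢ j<i) (<⇒≢ (<-trans j<i (n<1+n i)))) (χ-step s (suc j) (λ _ r → <⇒≢ j<i (suc-injective (sym r))) b) ⟩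
        f j + χ (suc p) (suc j)       ≡⟨ at j b ⟩
        e j + χ (suc p) j             ≡⟨ cong (e j +_) (sym (χ-step s j (λ _ r → <⇒≢ (<-trans j<i (n<1+n i)) (sym r)) (<⇒≤ b))) ⟩
        e j + χ t j                   ∎
        where open ≡-Reasoning
      ...   | tri> _ _ i<j with j ≟ suc i
      ...     | yes refl = begin
        T (suc i) f j + χ t (suc j)     ≡⟨ cong₂ _+_ (T-to i f) (χ-step s (suc j) (λ _ → <⇒≢ ≤-refl) b) ⟩
        1 ⊓ f i + f j + χ (suc p) (suc j) ≡⟨ cong (λ z → 1 ⊓ z + f j + χ (suc p) (suc j)) (present i i<k at) ⟩
        suc (f j + χ (suc p) (suc j))   ≡⟨ cong suc (at j b) ⟩
        suc (e j + χ (suc p) j)         ≡⟨ cong (λ z → suc (e j + z)) (χ-no {suc p} i ≤-refl) ⟩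
        suc (e j + 0)                    ≡⟨ sym (+-suc (e j) 0) ⟩
        e j + 1                          ≡⟨ cong (e j +_) (sym (χ-yes {t} i (All.head (above s)))) ⟩
        e j + χ t j                      ∎
        where open ≡-Reasoning
      ...     | no ne = begin
        T (suc i) f j + χ t (suc j)  ≡⟨ cong₂ _+_ (T-other i f (≢-sym (<⇒≢ i<j)) ne) (χ-step s (suc j) (λ _ r → <⇒≢ i<j (suc-injective r)) b) ⟩
        f j + χ (suc p) (suc j)       ≡⟨ at j b ⟩
        e j + χ (suc p) j             ≡⟨ cong (e j +_) (sym (χ-step s j (λ _ r → ne (sym r)) (<⇒≤ b))) ⟩
        e j + χ t j                   ∎
        where open ≡-Reasoning

      end : ∀ {t} → Suffix t [] → At t e
      end s j b with split s (suc j) (s≤s z≤n) b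
      ... | inj₁ r rewrite χ-no j r with j
      ...   | zero  = refl
      ...   | suc j with split s (suc j) (s≤s z≤n) (<⇒≤ b)
      ...     | inj₁ r rewrite χ-no j r = refl

      run : ∀ {t V} → Suffix t V → At t (act (letters V) e)
      run {V = []}         s = end s
      run {V = (p , i) ∷ V} s = step s (run (tail s))

      -- At a marked letter the customer is present and moves, so `n` is unchanged. At an unmarked
      -- letter he is absent, and the letter acts on `n` alone.
      run-add : ∀ {t V} → Suffix t V → ∀ n →
                act (letters V) (n ⊕ e) ≐ act (letters (unmarked q V)) n ⊕ act (letters V) e
      run-add {V = []} s n j = refl
      run-add {V = (p , zero) ∷ V} s n j = contradiction (proj₁ (range (sub s (here refl)))) λ ()
      run-add {V = (p , suc i) ∷ V} s n j with range (sub s (here refl)) | p ≟ q (suc i)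
      ... | _ , i<k | yes refl
        rewrite filter-reject (λ (p , i) → ¬? (p ≟ q i)) {xs = V} (λ (ne : q (suc i) ≢ q (suc i)) → ne refl) =
        trans (T-cong (suc i) (run-add (tail s) n) j)
              (T-add-move i (act (letters (unmarked q V)) n) (subst (0 <_) (sym (present i i<k (run (tail s)))) (s≤s z≤n)) j)
      ... | _ , i<k | no ne
        rewrite filter-accept (λ (p , i) → ¬? (p ≟ q i)) {xs = V} ne =
        trans (T-cong (suc i) (run-add (tail s) n) j)
        (trans (T-add-idle i (act (letters (unmarked q V)) n) f≡0 j)
               (cong (T (suc i) (act (letters (unmarked q V)) n) j +_) (sym (T-idle i f≡0 j))))
        where f≡0 = absent i i<k (sub s (here refl)) ne (run (tail s))

      whole : Suffix 0 W
      whole = record { sorted′ = sorted ; sub = λ x → x ; above = All.universal (λ _ → z≤n) W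
                     ; split = λ j a b → inj₂ (marked j a b) }

      final : ∀ j → 1 ≤ j → j < k → act (letters W) e j ≡ e j
      final (suc j) a b with run whole (suc j) b
      ... | eq rewrite χ-yes {0} (suc j) z≤n | χ-yes {0} j z≤n = +-cancelʳ-≡ 1 _ _ eq

      -- `y` dominates the path up to queue j, so by monotonicity someone is available when the
      -- marked letter `suc j` is met. As the scan wraps afterwards, every letter `suc (suc j)` lies
      -- to the right of that position, and nobody leaves queue `suc j` any more.
      reach : ∀ {m y t V} → Suffix t V → ∀ j → suc j < k → q (suc j) < q (suc (suc j)) →
              (∀ i → i < m → e i ≤ y i) → suc j ≤ m → χ t (suc j) ≤ act (letters V) y (suc j)
      reach {V = []} s j b r low h with split s (suc j) (s≤s z≤n) (<⇒≤ b)
      ... | inj₁ x rewrite χ-no j x = z≤n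
      reach {V = (p , zero) ∷ V} s = contradiction (proj₁ (range (sub s (here refl)))) λ ()
      reach {y = y} {t} {(p , suc i) ∷ V} s j b r low h with range (sub s (here refl)) | i ≟ j
      ... | _ , i<k | yes refl with p ≟ q (suc i)
      ...   | yes refl rewrite T-to i (act (letters V) y) | χ-yes {t} i (All.head (above s)) =
        ≤-trans (⊓-glb ≤-refl (≤-trans (≤-reflexive (sym (present i i<k (run (tail s)))))
                                        (act-mono (letters V) low i h)))
                (m≤m+n _ _)
      ...   | no ne rewrite T-to i (act (letters V) y) | χ-step s (suc i) (λ x _ → ne x) i<k =
        ≤-trans (reach (tail s) i b r low h) (m≤n+m _ _)
      reach {y = y} {t} {(p , suc i) ∷ V} s j b r low h | _ , i<k | no i≢j with i ≟ suc j
      ... | yes refl with proj₂ (greedy (suc j) b (sub s (here refl))) r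
      ...   | x , _ with split s (suc j) (s≤s z≤n) (<⇒≤ b)
      ...     | inj₁ z rewrite χ-no j z = z≤n
      ...     | inj₂ (there z) with sorted′ s
      ...       | w ∷ _ = contradiction (All.lookup w z) (<⇒≯ x)
      reach {y = y} {t} {(p , suc i) ∷ V} s j b r low h | _ , i<k | no i≢j | no ne
        rewrite T-other i (act (letters V) y) (λ x → ne (sym x)) (λ x → i≢j (suc-injective (sym x)))
              | χ-step s (suc j) (λ _ x → i≢j (suc-injective x)) (<⇒≤ b) = reach (tail s) j b r low h

      -- The bound is gained one queue at a time: with the queues below `n` known, `reach` finds a
      -- customer in queue `n` at the left end, and `Fix` makes this a bound for `y`.
      below-step : ∀ m y → m ≤ k → 0 < y 0 → Fix m (letters W) y → ∀ n → n < m → (∀ j → j < n → e j ≤ y j) → e n ≤ y n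
      below-step m y m≤k y₀ fix zero    n<m low = y₀
      below-step m y m≤k y₀ fix (suc n) n<m low with q (suc n) <? q (suc (suc n))
      ... | no  _ = z≤n
      ... | yes r = ≤-trans (≤-reflexive (sym (χ-yes {0} n z≤n)))
        (≤-trans (reach {y = y} whole n (≤-trans n<m m≤k) r low ≤-refl)
                 (≤-reflexive (fix (suc n) (s≤s z≤n) n<m)))

      below′ : ∀ m y → m ≤ k → 0 < y 0 → Fix m (letters W) y → ∀ n → n ≤ m → ∀ j → j < n → e j ≤ y j
      below′ m y m≤k y₀ fix (suc n) n≤m j j<n with m≤n⇒m<n∨m≡n (≤-pred j<n)
      ... | inj₁ r    = below′ m y m≤k y₀ fix n (≤-trans (n≤1+n n) n≤m) j r
      ... | inj₂ refl = below-step m y m≤k y₀ fix n n≤m (below′ m y m≤k y₀ fix n (≤-trans (n≤1+n n) n≤m))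

    marking⇒peel : Peel k (letters W) (letters (unmarked q W)) (wrap q)
    marking⇒peel = record
      { one   = refl
      ; add   = λ n j a b → trans (run-add whole n j) (cong (act (letters (unmarked q W)) n j +_) (final j a b))
      ; below = λ m y m≤k y₀ fix → below′ m y m≤k y₀ fix m ≤-refl
      }

-- The charge of a word as a value of `Peels`

module ChargeWords where

  open TandemQueues
  open Markings

  unique-↭ : ∀ {A : Set} {xs ys : List A} → Unique xs → Unique ys →
             (∀ {x} → x ∈ xs → x ∈ ys) → (∀ {x} → x ∈ ys → x ∈ xs) → xs ↭ ys
  unique-↭ u v f g = ∼bag⇒↭ (unique∧set⇒bag u v (mk⇔ f g))

  filter-cong-∈ : ∀ {A : Set} {P Q : A → Set} (P? : Decidable P) (Q? : Decidable Q) xs →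
    (∀ {x} → x ∈ xs → P x → Q x) → (∀ {x} → x ∈ xs → Q x → P x) → filter P? xs ≡ filter Q? xs
  filter-cong-∈ P? Q? [] f g = refl
  filter-cong-∈ P? Q? (x ∷ xs) f g with P? x
  ... | yes p = trans (cong (x ∷_) ih) (sym (filter-accept Q? (f (here refl) p)))
    where ih = filter-cong-∈ P? Q? xs (f ∘ there) (g ∘ there)
  ... | no ¬p = trans ih (sym (filter-reject Q? (¬p ∘ g (here refl))))
    where ih = filter-cong-∈ P? Q? xs (f ∘ there) (g ∘ there)

  ∈-[1⋯]⁺ : ∀ {n j} → 1 ≤ j → j ≤ n → j ∈ [1⋯ n ]
  ∈-[1⋯]⁺ {j = suc j} _ p = ∈-applyUpTo⁺ suc p

  ∈-[1⋯]⁻ : ∀ {n j} → j ∈ [1⋯ n ] → 1 ≤ j × j ≤ n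
  ∈-[1⋯]⁻ p with _ , q , refl ← ∈-applyUpTo⁻ suc p = s≤s z≤n , q

  [1⋯]-unique : ∀ n → Unique [1⋯ n ]
  [1⋯]-unique n = Uniqueₚ.applyUpTo⁺₁ suc n (λ i<j _ eq → <⇒≢ i<j (suc-injective eq))

  last-∈ : ∀ {A : Set} (xs : List A) {x} → last xs ≡ just x → x ∈ xs
  last-∈ (x ∷ [])     refl = here refl
  last-∈ (x ∷ y ∷ xs) eq   = there (last-∈ (y ∷ xs) eq)

  last-max : ∀ {xs : List ℕ} {x y} → AllPairs _<_ xs → last xs ≡ just x → y ∈ xs → y ≤ x
  last-max {x ∷ []}     s        refl (here refl) = ≤-refl
  last-max {x ∷ y ∷ xs} (s ∷ _)  eq   (here refl) = <⇒≤ (All.lookup s (last-∈ (y ∷ xs) eq))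
  last-max {x ∷ y ∷ xs} (_ ∷ ss) eq   (there p)   = last-max ss eq p

  last-nothing : ∀ {A : Set} (xs : List A) → last xs ≡ nothing → xs ≡ []
  last-nothing []           eq = refl
  last-nothing (x ∷ [])     ()
  last-nothing (x ∷ y ∷ xs) eq with () ← last-nothing (y ∷ xs) eq

  letters-zip : ∀ (f : ℕ → ℕ) w → letters (zip (applyUpTo f (length w)) w) ≡ w
  letters-zip f []      = refl
  letters-zip f (x ∷ w) = cong (x ∷_) (letters-zip (f ∘ suc) w)

  zip-≥ : ∀ (f : ℕ → ℕ) → (∀ i → f i < f (suc i)) → ∀ n (w : Word) →
          All (λ x → f 0 ≤ proj₁ x) (zip (applyUpTo f n) w)
  zip-≥ f m zero    w       = []
  zip-≥ f m (suc n) []      = []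
  zip-≥ f m (suc n) (x ∷ w) = ≤-refl ∷ All.map (≤-trans (<⇒≤ (m 0))) (zip-≥ (f ∘ suc) (m ∘ suc) n w)

  zip-sorted : ∀ (f : ℕ → ℕ) → (∀ i → f i < f (suc i)) → ∀ n w → Sorted (zip (applyUpTo f n) w)
  zip-sorted f m zero    w       = []
  zip-sorted f m (suc n) []      = []
  zip-sorted f m (suc n) (x ∷ w) =
    All.map (<-≤-trans (m 0)) (zip-≥ (f ∘ suc) (m ∘ suc) n w) ∷ zip-sorted (f ∘ suc) (m ∘ suc) n w

  ∈-zip : ∀ {xs : List ℕ} {w : Word} {p i} → (p , i) ∈ zip xs w → p ∈ xs
  ∈-zip {x ∷ xs} {y ∷ w} (here refl) = here refl
  ∈-zip {x ∷ xs} {y ∷ w} (there p)   = there (∈-zip p)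

  module _ (w : Word) where

    indexed-letter : ∀ {p i} → (p , i) ∈ indexed w → i ∈ w
    indexed-letter p = subst (_ ∈_) (letters-zip suc w) (∈-map⁺ proj₂ p)

    indexed-position : ∀ {i} → i ∈ w → ∃[ p ] (p , i) ∈ indexed w
    indexed-position {i} q with ∈-map⁻ proj₂ (subst (i ∈_) (sym (letters-zip suc w)) q)
    ... | (p , _) , r , refl = p , r

    indexed-sorted : Sorted (indexed w)
    indexed-sorted = zip-sorted suc (λ _ → ≤-refl) (length w) w

    module _ (a : ℕ) where
      occurrences : List ℕ
      occurrences = map proj₁ (filter (λ (_ , b) → b ≟ a) (indexed w))

      ∈-occurrences⁺ : ∀ {p} → (p , a) ∈ indexed w → p ∈ occurrences
      ∈-occurrences⁺ q = ∈-map⁺ proj₁ (∈-filter⁺ (λ (_ , b) → b ≟ a) q refl)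

      ∈-occurrences⁻ : ∀ {p} → p ∈ occurrences → (p , a) ∈ indexed w
      ∈-occurrences⁻ q with ∈-map⁻ proj₁ q
      ... | _ , r , refl with ∈-filter⁻ (λ (_ , b) → b ≟ a) {xs = indexed w} r
      ...   | s , refl = s

      occurrences-sorted : AllPairs _<_ occurrences
      occurrences-sorted = AllPairsₚ.map⁺ (AllPairsₚ.filter⁺ (λ (_ , b) → b ≟ a) indexed-sorted)

      scan-spec : ∀ p → a ∈ w → (scan w p a , a) ∈ indexed w ×
        ((scan w p a < p × (∀ {y} → (y , a) ∈ indexed w → y < p → y ≤ scan w p a)) ⊎
         ((∀ {y} → (y , a) ∈ indexed w → p ≤ y × y ≤ scan w p a)))
      scan-spec p a∈w with last (filter (_<? p) occurrences) in eq
      ... | just x with ∈-filter⁻ (_<? p) {xs = occurrences} (last-∈ _ eq)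
      ...   | x∈ , x<p = ∈-occurrences⁻ x∈ , inj₁ (x<p , λ y∈ y<p →
        last-max (AllPairsₚ.filter⁺ (_<? p) occurrences-sorted) eq (∈-filter⁺ (_<? p) (∈-occurrences⁺ y∈) y<p))
      scan-spec p a∈w | nothing with last occurrences in eq′
      ... | just x = ∈-occurrences⁻ (last-∈ _ eq′) , inj₂ λ {y} y∈ →
        ≮⇒≥ (λ y<p → case-[] (subst (y ∈_) (last-nothing _ eq) (∈-filter⁺ (_<? p) (∈-occurrences⁺ y∈) y<p))) ,
        last-max occurrences-sorted eq′ (∈-occurrences⁺ y∈)
        where
        case-[] : ∀ {A B : Set} {x : A} → x ∈ [] → B
        case-[] ()
      ... | nothing with _ , y∈ ← indexed-position a∈w with () ← subst (_ ∈_) (last-nothing _ eq′) (∈-occurrences⁺ y∈)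

    -- The positions listed by `marks` as a function of the letter, in the form required of `q`. The
    -- value at 0 is where the scan starts.
    scanned : ℕ → ℕ
    scanned zero    = suc (length w)
    scanned (suc j) = scan w (scanned j) (suc j)

    ∈-marks⁺ : ∀ a m {j} → a < j → j ≤ a + m → scanned j ∈ marks w (scanned a) (suc a) m
    ∈-marks⁺ a zero    p q = contradiction (≤-trans q (≤-reflexive (+-identityʳ a))) (<⇒≱ p)
    ∈-marks⁺ a (suc m) p q with m≤n⇒m<n∨m≡n p
    ... | inj₂ refl = here refl
    ... | inj₁ r    = there (∈-marks⁺ (suc a) m r (≤-trans q (≤-reflexive (+-suc a m))))

    ∈-marks⁻ : ∀ a m {p} → p ∈ marks w (scanned a) (suc a) m → ∃[ j ] a < j × j ≤ a + m × p ≡ scanned j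
    ∈-marks⁻ a (suc m) (here refl) = suc a , ≤-refl , ≤-trans (m≤m+n (suc a) m) (≤-reflexive (sym (+-suc a m))) , refl
    ∈-marks⁻ a (suc m) (there q) with j , r , s , t ← ∈-marks⁻ (suc a) m q =
      j , <⇒≤ r , ≤-trans s (≤-reflexive (sym (+-suc a m))) , t

    scanned-marking : ∀ {k} → (∀ j → 1 ≤ j → j ≤ k → j ∈ w) → (∀ {j} → j ∈ w → 1 ≤ j × j ≤ k) →
                      Marking k (indexed w) scanned
    scanned-marking {k} occ rng = record
      { sorted = indexed-sorted
      ; range  = rng ∘ indexed-letter
      ; marked = mkd
      ; greedy = grd
      ; first  = frs
      }
      where
      frs : ∀ {p j} → (p , j) ∈ indexed w → p < suc (length w)
      frs p∈ = s≤s (proj₂ (∈-[1⋯]⁻ (∈-zip p∈)))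
      mkd : ∀ j → 1 ≤ j → j ≤ k → (scanned j , j) ∈ indexed w
      mkd (suc j) a b = proj₁ (scan-spec (suc j) (scanned j) (occ (suc j) a b))
      grd : ∀ {p} j → j < k → (p , suc j) ∈ indexed w → Passed (scanned j) (scanned (suc j)) p
      grd {p} j j<k p∈ with scan-spec (suc j) (scanned j) (occ (suc j) (s≤s z≤n) j<k)
      ... | m , inj₁ (x , y) = (λ _ → [ (λ r → inj₁ (y p∈ r)) , inj₂ ]′ (<-≤-connex p (scanned j))) ,
                               (λ r → contradiction r (<⇒≯ x))
      ... | m , inj₂ y = (λ _ → inj₂ (proj₁ (y p∈))) , λ r → strict j r j<k p∈ (proj₁ (y p∈)) , proj₂ (y p∈)
        where
        strict : ∀ j → scanned j < scanned (suc j) → j < k → (p , suc j) ∈ indexed w → scanned j ≤ p → scanned j < p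
        strict zero    r b p∈ q = contradiction (frs (mkd 1 (s≤s z≤n) b)) (<⇒≯ r)
        strict (suc j) r b p∈ q = ≤∧≢⇒< q λ { refl → case (sorted-unique indexed-sorted p∈ (mkd (suc j) (s≤s z≤n) (<⇒≤ b))) }
          where
          case : ∀ {A : Set} {n} → suc n ≡ n → A
          case ()

  position-≢ : ∀ {a b : ℕ} w → a ≢ b → position a (b ∷ w) ≡ suc (position a w)
  position-≢ {a} {b} w ne rewrite dec-false (a ≟ b) ne = refl

  position-≡ : ∀ (a : ℕ) w → position a (a ∷ w) ≡ 1
  position-≡ a w rewrite dec-true (a ≟ a) refl = refl

  position-pos : ∀ {a : ℕ} {w} → a ∈ w → 1 ≤ position a w
  position-pos {a} {b ∷ w} _ with a ≟ b
  ... | yes refl = ≤-reflexive (sym (position-≡ a w))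
  ... | no  ne   = ≤-trans (s≤s z≤n) (≤-reflexive (sym (position-≢ w ne)))

  position-< : ∀ {q : ℕ → ℕ} {V i j} → Sorted V → (∀ {p l} → (p , l) ∈ V → p ≡ q l) →
    (q i , i) ∈ V → (q j , j) ∈ V → q i < q j → position i (letters V) < position j (letters V)
  position-< {q} {_ ∷ V} {i} {j} (s ∷ ss) m (here refl) j∈ lt with j∈
  ... | here refl = contradiction lt (<-irrefl refl)
  ... | there j∈′ rewrite position-≡ i (letters V) | position-≢ {j} {i} (letters V) (λ { refl → <-irrefl refl lt }) =
    s≤s (position-pos (∈-map⁺ proj₂ j∈′))
  position-< (s ∷ ss) m (there i∈) (here refl) lt = contradiction (All.lookup s i∈) (<⇒≯ lt)
  position-< {q} {(p , l) ∷ V} {i} {j} (s ∷ ss) m (there i∈) (there j∈) lt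
    rewrite position-≢ {i} {l} (letters V) (λ { refl → <-irrefl (m (here refl)) (All.lookup s i∈) })
          | position-≢ {j} {l} (letters V) (λ { refl → <-irrefl (m (here refl)) (All.lookup s j∈) })
    = s≤s (position-< ss (m ∘ there) i∈ j∈ lt)

  at-map : ∀ {A : Set} {d} (f : ℕ → A) (g : ℕ → ℕ) {n i} → i < n → at d (map f (applyUpTo g n)) (suc i) ≡ f (g i)
  at-map f g {suc n} {zero}  p = refl
  at-map f g {suc n} {suc i} (s≤s p) = at-map f (g ∘ suc) p

  at-map-[1⋯] : ∀ {A : Set} {d} (f : ℕ → A) {n i} → 1 ≤ i → i ≤ n → at d (map f [1⋯ n ]) i ≡ f i
  at-map-[1⋯] f {i = suc i} _ p = at-map f suc p

  sum-filter : ∀ {A : Set} {P : A → Set} (P? : Decidable P) (f : A → ℕ) xs →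
    sum (map f (filter P? xs)) ≡ sum (map (λ x → when (P? x) (f x)) xs)
  sum-filter P? f [] = refl
  sum-filter P? f (x ∷ xs) with P? x
  ... | yes p = cong (f x +_) (sum-filter P? f xs)
  ... | no ¬p = sum-filter P? f xs

  sum-[1⋯] : ∀ f n → sum (map f [1⋯ n ]) ≡ sumTo n f
  sum-[1⋯] f zero    = refl
  sum-[1⋯] f (suc n) = begin
    sum (map f [1⋯ suc n ])             ≡⟨ cong (sum ∘ map f) (sym (applyUpTo-∷ʳ suc n)) ⟩
    sum (map f ([1⋯ n ] ++ suc n ∷ []))  ≡⟨ cong sum (map-++ f [1⋯ n ] _) ⟩
    sum (map f [1⋯ n ] ++ f (suc n) ∷ []) ≡⟨ sum-++ (map f [1⋯ n ]) _ ⟩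
    sum (map f [1⋯ n ]) + (f (suc n) + 0) ≡⟨ cong₂ _+_ (sum-[1⋯] f n) (+-identityʳ _) ⟩
    sumTo n f + f (suc n)                 ∎
    where open ≡-Reasoning

  -- Raising k by one raises every weight by one, which is what the added partial sum contributes.
  turns-weighted : ∀ k e → turns (suc k) e ≡ sumTo k (λ i → e i * (suc k ∸ i))
  turns-weighted zero    e = refl
  turns-weighted (suc k) e = begin
    turns (suc k) e + (sumTo k e + e (suc k))
      ≡⟨ cong (_+ (sumTo k e + e (suc k))) (turns-weighted k e) ⟩
    sumTo k (λ i → e i * (suc k ∸ i)) + (sumTo k e + e (suc k))
      ≡⟨ sym (+-assoc (sumTo k _) (sumTo k e) (e (suc k))) ⟩
    sumTo k (λ i → e i * (suc k ∸ i)) + sumTo k e + e (suc k)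
      ≡⟨ cong₂ _+_ (trans (+-comm (sumTo k _) (sumTo k e)) (sym (sumTo-⊕ k e _))) (sym (trans (cong (e (suc k) *_) (m+n∸n≡m 1 (suc k))) (*-identityʳ _))) ⟩
    sumTo k (e ⊕ (λ i → e i * (suc k ∸ i))) + e (suc k) * (suc (suc k) ∸ suc k)
      ≡⟨ cong (_+ e (suc k) * (suc (suc k) ∸ suc k)) (sumTo-cong k (λ i _ i≤k → trans (sym (*-suc (e i) _)) (cong (e i *_) (sym (+-∸-assoc 1 (m≤n⇒m≤1+n i≤k)))))) ⟩
    sumTo k (λ i → e i * (suc (suc k) ∸ i)) + e (suc k) * (suc (suc k) ∸ suc k) ∎
    where open ≡-Reasoning

  when-* : ∀ {P : Set} (d : Dec P) x → when d 1 * x ≡ when d x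
  when-* (yes _) x = +-identityʳ x
  when-* (no  _) x = refl

  when-cong : ∀ {P Q : Set} (d : Dec P) (e : Dec Q) {x} → (P → Q) → (Q → P) → when d x ≡ when e x
  when-cong d (yes q) f g = when-yes d (g q)
  when-cong d (no ¬q) f g = when-no d (¬q ∘ f)

  turns-when : ∀ k {P : ℕ → Set} (P? : Decidable P) {e} → (∀ i → 1 ≤ i → i < k → e i ≡ when (P? i) 1) →
    turns k e ≡ sumTo (pred k) (λ i → when (P? i) (k ∸ i))
  turns-when zero    P? p = refl
  turns-when (suc k) P? {e} p = trans (turns-weighted k e)
    (sumTo-cong k (λ i a b → trans (cong (_* (suc k ∸ i)) (p i a (s≤s b))) (when-* (P? i) _)))

  length-filter-∷ : ∀ {A : Set} {P : A → Set} (P? : Decidable P) x xs →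
    length (filter P? (x ∷ xs)) ≡ when (P? x) 1 + length (filter P? xs)
  length-filter-∷ P? x xs with P? x
  ... | yes _ = refl
  ... | no  _ = refl

  count-∷ : ∀ i l w → count i (l ∷ w) ≡ when (i ≟ l) 1 + count i w
  count-∷ i l w = length-filter-∷ (i ≟_) l w

  count-unmarked-∉ : ∀ {q} i V → (q i , i) ∉ V → count i (letters V) ≡ count i (letters (unmarked q V))
  count-unmarked-∉ i [] n = refl
  count-unmarked-∉ {q} i ((p , l) ∷ V) n with p ≟ q l
  ... | yes refl rewrite filter-reject (λ (p , i) → ¬? (p ≟ q i)) {x = q l , l} {xs = V} (λ ne → ne refl)
                       | filter-reject (i ≟_) {x = l} {xs = letters V} (λ { refl → n (here refl) })
    = count-unmarked-∉ i V (n ∘ there)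
  ... | no ne rewrite filter-accept (λ (p , i) → ¬? (p ≟ q i)) {x = p , l} {xs = V} ne =
    trans (count-∷ i l (letters V)) (trans (cong (when (i ≟ l) 1 +_) (count-unmarked-∉ i V (n ∘ there)))
                                            (sym (count-∷ i l (letters (unmarked q V)))))

  count-unmarked-∈ : ∀ {q} i V → Sorted V → (q i , i) ∈ V → count i (letters V) ≡ suc (count i (letters (unmarked q V)))
  count-unmarked-∈ {q} i (_ ∷ V) (s ∷ _) (here refl)
    rewrite filter-reject (λ (p , i) → ¬? (p ≟ q i)) {x = q i , i} {xs = V} (λ ne → ne refl)
          | filter-accept (i ≟_) {x = i} {xs = letters V} refl
    = cong suc (count-unmarked-∉ i V (λ m → <-irrefl refl (All.lookup s m)))
  count-unmarked-∈ {q} i ((p , l) ∷ V) (s ∷ ss) (there m) with p ≟ q l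
  ... | yes refl rewrite filter-reject (λ (p , i) → ¬? (p ≟ q i)) {x = q l , l} {xs = V} (λ ne → ne refl)
                       | filter-reject (i ≟_) {x = l} {xs = letters V} (λ { refl → <-irrefl refl (All.lookup s m) })
    = count-unmarked-∈ i V ss m
  ... | no ne rewrite filter-accept (λ (p , i) → ¬? (p ≟ q i)) {x = p , l} {xs = V} ne =
    trans (count-∷ i l (letters V)) (trans (cong (when (i ≟ l) 1 +_) (count-unmarked-∈ i V ss m))
      (trans (+-suc (when (i ≟ l) 1) _) (cong suc (sym (count-∷ i l (letters (unmarked q V)))))))

  ∈⇒count : ∀ {i w} → i ∈ w → 1 ≤ count i w
  ∈⇒count {i} {w} p = ∈-length (∈-filter⁺ (i ≟_) p refl)

  count⇒∈ : ∀ {i} w → 1 ≤ count i w → i ∈ w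
  count⇒∈ {i} w p with filter (i ≟_) w in eq
  ... | x ∷ xs with ∈-filter⁻ (i ≟_) {xs = w} (subst (x ∈_) (sym eq) (here refl))
  ...   | m , refl = m

  module _ {k : ℕ} (w : Word) (occ : ∀ j → 1 ≤ j → j ≤ k → j ∈ w) (rng : ∀ {j} → j ∈ w → 1 ≤ j × j ≤ k) where
    private
      q = scanned w
      M = scanned-marking w occ rng
      open Marking M
      ms = marks w (suc (length w)) 1 k
      V = filter (λ (p , _) → mem? _≟_ p ms) (indexed w)

      marked⇒≡ : ∀ {p i} → (p , i) ∈ indexed w → p ∈ ms → p ≡ q i
      marked⇒≡ m p∈ with j , a , b , refl ← ∈-marks⁻ w 0 k p∈ = cong q (sorted-unique sorted (marked j a b) m)

      V-≡ : ∀ {p i} → (p , i) ∈ V → p ≡ q i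
      V-≡ m with a , b ← ∈-filter⁻ (λ (p , _) → mem? _≟_ p ms) {xs = indexed w} m = marked⇒≡ a b

      V-∈ : ∀ {i} → 1 ≤ i → i ≤ k → (q i , i) ∈ V
      V-∈ {i} a b = ∈-filter⁺ (λ (p , _) → mem? _≟_ p ms) (marked i a b) (∈-marks⁺ w 0 k a b)

      V-sorted : Sorted V
      V-sorted = AllPairsₚ.filter⁺ (λ (p , _) → mem? _≟_ p ms) sorted

      V-length : length (letters V) ≡ k
      V-length = trans (↭-length (unique-↭ uniq ([1⋯]-unique k) to from)) (length-applyUpTo suc k)
        where
        uniq : Unique (letters V)
        uniq = AllPairsₚ.map⁺ (distinct V-sorted V-≡)
          where
          distinct : ∀ {V} → Sorted V → (∀ {p i} → (p , i) ∈ V → p ≡ q i) → AllPairs (λ x y → proj₂ x ≢ proj₂ y) V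
          distinct []       m = []
          distinct (s ∷ ss) m = All.tabulate (λ {x} x∈ eq → <⇒≢ (All.lookup s x∈)
            (trans (m (here refl)) (trans (cong q eq) (sym (m (there x∈)))))) ∷ distinct ss (m ∘ there)
        to : ∀ {x} → x ∈ letters V → x ∈ [1⋯ k ]
        to x∈ with (p , i) , m , refl ← ∈-map⁻ proj₂ x∈
              with a , b ← range (proj₁ (∈-filter⁻ (λ (p , _) → mem? _≟_ p ms) {xs = indexed w} m)) = ∈-[1⋯]⁺ a b
        from : ∀ {x} → x ∈ [1⋯ k ] → x ∈ letters V
        from x∈ with a , b ← ∈-[1⋯]⁻ x∈ = ∈-map⁺ proj₂ (V-∈ a b)

    remainder≡ : remainder k w ≡ letters (unmarked q (indexed w))
    remainder≡ = cong letters (filter-cong-∈ (λ (p , _) → ¬? (mem? _≟_ p ms)) (λ (p , i) → ¬? (p ≟ q i)) (indexed w)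
      (λ {x} m n eq → n (subst (_∈ ms) (sym eq) (case′ m)))
      (λ m n p∈ → n (marked⇒≡ m p∈)))
      where
      case′ : ∀ {p i} → (p , i) ∈ indexed w → q i ∈ ms
      case′ m with a , b ← range m = ∈-marks⁺ w 0 k a b

    -- i is not a descent of the inverse iff i stands to the left of i + 1, iff the leftward scan
    -- has to wrap between them. The weight k - i is the same on both sides.
    permCharge≡ : permCharge (extract k w) ≡ turns k (wrap q)
    permCharge≡ = begin
      permCharge σ
        ≡⟨ sum-filter (λ i → ¬? (des? (inverse σ) i)) (length σ ∸_) [1⋯ pred (length σ) ] ⟩
      sum (map (λ i → when (¬? (des? (inverse σ) i)) (length σ ∸ i)) [1⋯ pred (length σ) ])
        ≡⟨ cong (λ z → sum (map (λ i → when (¬? (des? (inverse σ) i)) (z ∸ i)) [1⋯ pred z ])) V-length ⟩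
      sum (map (λ i → when (¬? (des? (inverse σ) i)) (k ∸ i)) [1⋯ pred k ])
        ≡⟨ sum-[1⋯] _ (pred k) ⟩
      sumTo (pred k) (λ i → when (¬? (des? (inverse σ) i)) (k ∸ i))
        ≡⟨ sym (turns-when k (λ i → ¬? (des? (inverse σ) i)) wrap≡) ⟩
      turns k (wrap q) ∎
      where
      open ≡-Reasoning
      σ : Word
      σ = letters V
      inv : ∀ {i} → 1 ≤ i → i ≤ k → part (inverse σ) i ≡ position i σ
      inv a b = at-map-[1⋯] (λ a → position a σ) a (≤-trans b (≤-reflexive (sym V-length)))
      pos : ∀ {i j} → 1 ≤ i → i ≤ k → 1 ≤ j → j ≤ k → q i < q j → position i σ < position j σ
      pos a b c d = position-< V-sorted V-≡ (V-∈ a b) (V-∈ c d)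
      wrap≡ : ∀ i → 1 ≤ i → i < k → wrap q i ≡ when (¬? (des? (inverse σ) i)) 1
      wrap≡ (suc i) a b = when-cong (q (suc i) <? q (suc (suc i))) (¬? (des? (inverse σ) (suc i)))
        (λ lt → subst₂ (λ x y → ¬ (x < y)) (sym (inv (s≤s z≤n) b)) (sym (inv a (<⇒≤ b)))
          (<⇒≯ (pos a (<⇒≤ b) (s≤s z≤n) b lt)))
        (λ nd → ≰⇒> (λ le → nd (subst₂ _<_ (sym (inv (s≤s z≤n) b)) (sym (inv a (<⇒≤ b)))
          (pos (s≤s z≤n) b a (<⇒≤ b) (≤∧≢⇒< le (λ eq → m≢1+n+m (suc i) {0} (sym
            (sorted-unique sorted (marked (suc (suc i)) (s≤s z≤n) b) (subst (λ z → (z , suc i) ∈ indexed w) (sym eq) (marked (suc i) a (<⇒≤ b)))))))))))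

  -- The counts say that `ks` is conjugate to the content. Hence the first subword contains each of
  -- 1, ..., k once, and after its deletion the counts fit the remaining parts.
  charge-peels : ∀ ks w → Linked _≥_ ks → (∀ {j} → j ∈ w → 1 ≤ j) →
    (∀ j → 1 ≤ j → count j w ≡ atLeast j ks) → Peels ks w (sum (map permCharge (standardSubwords ks w)))
  charge-peels []       w d pos cnt = []
  charge-peels (k ∷ ks) w d pos cnt =
    subst (λ z → Peels (k ∷ ks) w (z + sum (map permCharge (standardSubwords ks (remainder k w))))) (sym (permCharge≡ w occ rng))
      (subst₂ (λ x y → Peel k x y (wrap q)) (letters-zip suc w) (sym rem) (marking⇒peel M)
       ∷ charge-peels ks (remainder k w) (Linked.tail d) (λ j∈ → pos (sub j∈)) cnt′)
    where
    q = scanned w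
    cnt-k : ∀ j → k < j → count j w ≡ 0
    cnt-k j p = trans (cnt j (≤-<-trans z≤n p)) (when-no (j ≤? k) (<⇒≱ p))
    occ : ∀ j → 1 ≤ j → j ≤ k → j ∈ w
    occ j a b = count⇒∈ w (≤-trans (s≤s z≤n) (≤-reflexive (sym (trans (cnt j a) (when-yes (j ≤? k) b)))))
    rng : ∀ {j} → j ∈ w → 1 ≤ j × j ≤ k
    rng {j} p = pos p , ≮⇒≥ (λ k<j → contradiction (∈⇒count p) (<⇒≱ (s≤s (≤-reflexive (cnt-k j k<j)))))
    M = scanned-marking w occ rng
    rem = remainder≡ w occ rng
    sub : ∀ {j} → j ∈ remainder k w → j ∈ w
    sub j∈ with (p , i) , m , refl ← ∈-map⁻ proj₂ (subst (_ ∈_) rem j∈) =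
      indexed-letter w (proj₁ (∈-filter⁻ (λ (p , i) → ¬? (p ≟ q i)) {xs = indexed w} m))
    cnt′ : ∀ j → 1 ≤ j → count j (remainder k w) ≡ atLeast j ks
    cnt′ j a with j ≤? k
    ... | yes j≤k = suc-injective (begin
      suc (count j (remainder k w)) ≡⟨ cong (suc ∘ count j) rem ⟩
      suc (count j (letters (unmarked q (indexed w))))
        ≡⟨ sym (count-unmarked-∈ j (indexed w) (Marking.sorted M) (Marking.marked M j a j≤k)) ⟩
      count j (letters (indexed w)) ≡⟨ cong (count j) (letters-zip suc w) ⟩
      count j w                     ≡⟨ trans (cnt j a) (when-yes (j ≤? k) j≤k) ⟩
      suc (atLeast j ks)            ∎)
      where open ≡-Reasoning
    ... | no j≰k with count j (remainder k w) in eq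
    ...   | zero  = sym (atLeast-small d (≰⇒> j≰k))
    ...   | suc c = contradiction (proj₂ (rng (sub (count⇒∈ (remainder k w) (subst (1 ≤_) (sym eq) (s≤s z≤n)))))) j≰k

-- Partitions, conjugation, and fillings as functions on boxes

module Shapes where

  open TandemQueues
  open ChargeWords

  part-pos : ∀ {xs i} → 0 < part xs i → 1 ≤ i × i ≤ length xs
  part-pos {x ∷ xs} {suc zero}    p = ≤-refl , s≤s z≤n
  part-pos {x ∷ xs} {suc (suc i)} p = s≤s z≤n , s≤s (proj₂ (part-pos {xs} p))

  part-beyond : ∀ {xs i} → length xs < i → part xs i ≡ 0
  part-beyond {xs} {i} p with part xs i in eq
  ... | zero  = refl
  ... | suc _ = contradiction (proj₂ (part-pos {xs} {i} (subst (0 <_) (sym eq) (s≤s z≤n)))) (<⇒≱ p)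


  part-head : ∀ {x xs} → Linked _≥_ (x ∷ xs) → ∀ i → part xs i ≤ x
  part-head {xs = []}     d       i             = z≤n
  part-head {xs = y ∷ ys} (p ∷ d) zero          = z≤n
  part-head {xs = y ∷ ys} (p ∷ d) (suc zero)    = p
  part-head {xs = y ∷ ys} (p ∷ d) (suc (suc i)) = ≤-trans (part-head d (suc i)) p

  part-anti : ∀ {xs} → Linked _≥_ xs → ∀ {i j} → 1 ≤ i → i ≤ j → part xs j ≤ part xs i
  part-anti {[]} d p q = z≤n
  part-anti {x ∷ xs} d {suc zero}    {suc zero}    p q       = ≤-refl
  part-anti {x ∷ xs} d {suc zero}    {suc (suc j)} p q       = part-head d (suc j)
  part-anti {x ∷ xs} d {suc (suc i)} {suc (suc j)} p (s≤s q) = part-anti (Linked.tail d) (s≤s z≤n) q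
  part-anti {x ∷ xs} d {suc (suc i)} {suc zero}    p (s≤s ())

  partition-pos : ∀ {xs} → IsPartition xs → ∀ {i} → 1 ≤ i → i ≤ length xs → 0 < part xs i
  partition-pos {x ∷ xs} (_ , p ∷ _)  {suc zero}    a b       = p
  partition-pos {x ∷ xs} (d , _ ∷ ps) {suc (suc i)} a (s≤s b) = partition-pos (Linked.tail d , ps) (s≤s z≤n) b

  partition-ext : ∀ {xs ys} → IsPartition xs → IsPartition ys → (∀ i → 1 ≤ i → part xs i ≡ part ys i) → xs ≡ ys
  partition-ext {[]}     {[]}     p q eq = refl
  partition-ext {[]}     {y ∷ ys} p (_ , y>0 ∷ _) eq = contradiction (sym (eq 1 ≤-refl)) (>⇒≢ y>0)
  partition-ext {x ∷ xs} {[]}     (_ , x>0 ∷ _) q eq = contradiction (eq 1 ≤-refl) (>⇒≢ x>0)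
  partition-ext {x ∷ xs} {y ∷ ys} (d , _ ∷ p) (e , _ ∷ q) eq =
    cong₂ _∷_ (eq 1 ≤-refl) (partition-ext (Linked.tail d , p) (Linked.tail e , q) λ { (suc i) _ → eq (suc (suc i)) (s≤s z≤n) })

  -- With its converse this is the adjunction j ≤ xsᵢ iff i ≤ xs′ⱼ, from which the facts about
  -- conjugation follow.
  atLeast⁺ : ∀ {xs} → Linked _≥_ xs → ∀ {i j} → 1 ≤ i → 1 ≤ j → i ≤ atLeast j xs → j ≤ part xs i
  atLeast⁺ {[]} d {suc i} a b ()
  atLeast⁺ {x ∷ xs} d {suc i} {j} a b p with j ≤? x
  atLeast⁺ {x ∷ xs} d {suc zero}    {j} a b p       | yes q = q
  atLeast⁺ {x ∷ xs} d {suc (suc i)} {j} a b (s≤s p) | yes q = atLeast⁺ (Linked.tail d) (s≤s z≤n) b p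

  atLeast⁻ : ∀ {xs} → Linked _≥_ xs → ∀ {i j} → 1 ≤ i → 1 ≤ j → j ≤ part xs i → i ≤ atLeast j xs
  atLeast⁻ {[]} d {suc i} a b p = contradiction (≤-trans b p) λ ()
  atLeast⁻ {x ∷ xs} d {suc i} {j} a b p with j ≤? x
  atLeast⁻ {x ∷ xs} d {suc zero}    a b p | yes q = s≤s z≤n
  atLeast⁻ {x ∷ xs} d {suc (suc i)} a b p | yes q = s≤s (atLeast⁻ (Linked.tail d) (s≤s z≤n) b p)
  atLeast⁻ {x ∷ xs} d {suc zero}    a b p | no ¬q = contradiction p ¬q
  atLeast⁻ {x ∷ xs} d {suc (suc i)} a b p | no ¬q = contradiction (≤-trans p (part-head d (suc i))) ¬q

  length-filter-≤ : ∀ {xs} → Linked _≥_ xs → ∀ j → length (filter (j ≤?_) xs) ≡ atLeast j xs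
  length-filter-≤ {[]} d j = refl
  length-filter-≤ {x ∷ xs} d j with length-filter-∷ (j ≤?_) x xs
  ... | eq with j ≤? x
  ...   | yes q = trans eq (cong suc (length-filter-≤ (Linked.tail d) j))
  ...   | no ¬q = trans eq (trans (length-filter-≤ (Linked.tail d) j) (atLeast-small d (≰⇒> ¬q)))

  part-conj : ∀ {xs} → Linked _≥_ xs → ∀ {j} → 1 ≤ j → part (conj xs) j ≡ atLeast j xs
  part-conj {xs} d {j} a with j ≤? part xs 1
  ... | yes q = trans (at-map-[1⋯] (λ j → length (filter (j ≤?_) xs)) a q) (length-filter-≤ d j)
  ... | no ¬q = trans (part-beyond {conj xs} (≤-trans (s≤s (≤-reflexive (trans (length-map _ [1⋯ part xs 1 ]) (length-applyUpTo suc _)))) (≰⇒> ¬q)))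
                      (sym (n<1⇒n≡0 (≰⇒> (λ p → ¬q (atLeast⁺ d ≤-refl a p)))))

  conj⁺ : ∀ {xs} → Linked _≥_ xs → ∀ {i j} → 1 ≤ i → 1 ≤ j → i ≤ part (conj xs) j → j ≤ part xs i
  conj⁺ d {i} a b p = atLeast⁺ d a b (subst (i ≤_) (part-conj d b) p)

  conj⁻ : ∀ {xs} → Linked _≥_ xs → ∀ {i j} → 1 ≤ i → 1 ≤ j → j ≤ part xs i → i ≤ part (conj xs) j
  conj⁻ d {i} a b p = subst (i ≤_) (sym (part-conj d b)) (atLeast⁻ d a b p)

  ≤-ext : ∀ {a b} → (∀ j → 1 ≤ j → j ≤ a → j ≤ b) → (∀ j → 1 ≤ j → j ≤ b → j ≤ a) → a ≡ b
  ≤-ext f g = ≤-antisym (half f) (half g)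
    where
    half : ∀ {a b} → (∀ j → 1 ≤ j → j ≤ a → j ≤ b) → a ≤ b
    half {zero}  f = z≤n
    half {suc a} f = f (suc a) (s≤s z≤n) ≤-refl

  linked-map-[1⋯] : ∀ (f g : ℕ → ℕ) n → (∀ i → i < n → f (g (suc i)) ≤ f (g i)) → Linked _≥_ (map f (applyUpTo g n))
  linked-map-[1⋯] f g zero          p = []
  linked-map-[1⋯] f g (suc zero)    p = [-]
  linked-map-[1⋯] f g (suc (suc n)) p = p 0 (s≤s z≤n) ∷ linked-map-[1⋯] f (g ∘ suc) (suc n) (λ i q → p (suc i) (s≤s q))

  conj-partition : ∀ {xs} → IsPartition xs → IsPartition (conj xs)
  conj-partition {xs} (d , pos) =
    linked-map-[1⋯] (λ j → length (filter (j ≤?_) xs)) suc (part xs 1) dec ,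
    Allₚ.map⁺ (All.tabulate λ {j} j∈ → let a , b = ∈-[1⋯]⁻ j∈ in
      subst (1 ≤_) (sym (length-filter-≤ d j)) (atLeast⁻ d ≤-refl a b))
    where
    dec : ∀ j → j < part xs 1 → length (filter (suc (suc j) ≤?_) xs) ≤ length (filter (suc j ≤?_) xs)
    dec j p rewrite length-filter-≤ d (suc (suc j)) | length-filter-≤ d (suc j) with atLeast (suc (suc j)) xs in eq
    ... | zero  = z≤n
    ... | suc a = atLeast⁻ d (s≤s z≤n) (s≤s z≤n) (<⇒≤ (atLeast⁺ d (s≤s z≤n) (s≤s z≤n) (≤-reflexive (sym eq))))

  conj-involutive : ∀ {xs} → IsPartition xs → conj (conj xs) ≡ xs
  conj-involutive {xs} p@(d , _) = partition-ext (conj-partition (conj-partition p)) p λ i a →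
    ≤-ext (λ j b q → conj⁺ d a b (conj⁺ (proj₁ (conj-partition p)) b a q))
          (λ j b q → conj⁻ (proj₁ (conj-partition p)) b a (conj⁻ d a b q))

  inShape-row : ∀ lam mu {i j} → InShape lam mu (i , j) → 1 ≤ i × i ≤ length lam
  inShape-row lam mu {i} (p , q) = part-pos {lam} {i} (≤-<-trans z≤n (<-≤-trans p q))

  boxes⁺ : ∀ {lam mu b} → IsPartition lam → InShape lam mu b → b ∈ boxes lam mu
  boxes⁺ {lam} {mu} {i , j} (d , _) s@(p , q) with a , b ← inShape-row lam mu {i} {j} s =
    ∈-filter⁺ (inShape? lam mu) (∈-cartesianProduct⁺ (∈-[1⋯]⁺ a b)
      (∈-[1⋯]⁺ (≤-<-trans z≤n p) (≤-trans q (part-anti d ≤-refl a)))) s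

  boxes⁻ : ∀ {lam mu b} → b ∈ boxes lam mu → InShape lam mu b
  boxes⁻ {lam} {mu} p =
    proj₂ (∈-filter⁻ (inShape? lam mu) {xs = cartesianProduct [1⋯ length lam ] [1⋯ part lam 1 ]} p)

  tabulate-at : ∀ {A : Set} {d : A} xs → map (at d xs) [1⋯ length xs ] ≡ xs
  tabulate-at {A} {d} xs = trans (map-applyUpTo suc (at d xs) (length xs)) (go xs)
    where
    go : ∀ (xs : List A) → applyUpTo (at d xs ∘ suc) (length xs) ≡ xs
    go []       = refl
    go (x ∷ xs) = cong (x ∷_) (go xs)

  map-cong-[1⋯] : ∀ {A : Set} {f g : ℕ → A} n → (∀ i → 1 ≤ i → i ≤ n → f i ≡ g i) → map f [1⋯ n ] ≡ map g [1⋯ n ]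
  map-cong-[1⋯] {f = f} {g} n p = go suc n (λ i q → p (suc i) (s≤s z≤n) q)
    where
    go : ∀ h n → (∀ i → i < n → f (h i) ≡ g (h i)) → map f (applyUpTo h n) ≡ map g (applyUpTo h n)
    go h zero    p = refl
    go h (suc n) p = cong₂ _∷_ (p 0 (s≤s z≤n)) (go (h ∘ suc) n (λ i q → p (suc i) (s≤s q)))

  rowLength : (lam mu : List ℕ) → ℕ → ℕ
  rowLength lam mu i = part lam i ∸ part mu i

  mkRow : (lam mu : List ℕ) → (ℕ → ℕ → ℕ) → ℕ → Word
  mkRow lam mu g i = map (λ k → g i (part mu i + k)) [1⋯ rowLength lam mu i ]

  -- Fillings are handled as functions on all pairs of naturals, of which `mk` keeps the values on
  -- the shape; this frees the constructions from lists of rows.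
  mk : (lam mu : List ℕ) → (ℕ → ℕ → ℕ) → Filling
  mk lam mu g = map (mkRow lam mu g) [1⋯ length lam ]

  entry-mk : ∀ lam mu g {i j} → InShape lam mu (i , j) → entry mu (mk lam mu g) (i , j) ≡ g i j
  entry-mk lam mu g {i} {j} s@(p , q) with a , b ← inShape-row lam mu {i} {j} s = begin
    part (at [] (mk lam mu g) i) (j ∸ part mu i) ≡⟨ cong (λ r → part r (j ∸ part mu i)) (at-map-[1⋯] (mkRow lam mu g) a b) ⟩
    part (mkRow lam mu g i) (j ∸ part mu i)
      ≡⟨ at-map-[1⋯] (λ k → g i (part mu i + k)) (m<n⇒0<n∸m p) (∸-monoˡ-≤ (part mu i) q) ⟩
    g i (part mu i + (j ∸ part mu i))             ≡⟨ cong (g i) (m+[n∸m]≡n (<⇒≤ p)) ⟩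
    g i j ∎
    where open ≡-Reasoning

  row-inShape : ∀ lam mu i {k} → 1 ≤ k → k ≤ rowLength lam mu i → InShape lam mu (i , part mu i + k)
  row-inShape lam mu i {k} a b = m<m+n (part mu i) a ,
    ≤-trans (+-monoʳ-≤ (part mu i) b)
      (≤-reflexive (m+[n∸m]≡n {part mu i} {part lam i} (<⇒≤ (m∸n≢0⇒n<m (>⇒≢ (≤-trans a b))))))

  mk-cong : ∀ lam mu {f g} → (∀ {i j} → InShape lam mu (i , j) → f i j ≡ g i j) → mk lam mu f ≡ mk lam mu g
  mk-cong lam mu p = map-cong-[1⋯] (length lam) λ i a b → map-cong-[1⋯] (rowLength lam mu i) λ k c d →
    p (row-inShape lam mu i c d)

  data Rows (N : ℕ) : List ℕ → Filling → Set where
    []  : Rows N [] []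
    _∷_ : ∀ {r rs w F} → length w ≡ r × All (λ a → 1 ≤ a × a ≤ N) w → Rows N rs F → Rows N (r ∷ rs) (w ∷ F)

  words⁺ : ∀ {N} w → All (λ a → 1 ≤ a × a ≤ N) w → w ∈ words N (length w)
  words⁺ []      []             = here refl
  words⁺ (a ∷ w) ((p , q) ∷ ps) = ∈-cartesianProductWith⁺ _∷_ (∈-[1⋯]⁺ p q) (words⁺ w ps)

  words⁻ : ∀ {N} n {w} → w ∈ words N n → length w ≡ n × All (λ a → 1 ≤ a × a ≤ N) w
  words⁻ zero (here refl) = refl , []
  words⁻ {N} (suc n) p with ∈-cartesianProductWith⁻ _∷_ [1⋯ N ] (words N n) p
  ... | a , w , a∈ , w∈ , refl with words⁻ n w∈
  ...   | r , s = cong suc r , ∈-[1⋯]⁻ a∈ ∷ s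

  fillingsWithRows⁺ : ∀ {N rs F} → Rows N rs F → F ∈ fillingsWithRows N rs
  fillingsWithRows⁺ []                 = here refl
  fillingsWithRows⁺ ((refl , q) ∷ ps) = ∈-cartesianProductWith⁺ _∷_ (words⁺ _ q) (fillingsWithRows⁺ ps)

  fillingsWithRows⁻ : ∀ {N} rs {F} → F ∈ fillingsWithRows N rs → Rows N rs F
  fillingsWithRows⁻ []       (here refl) = []
  fillingsWithRows⁻ {N} (r ∷ rs) p with ∈-cartesianProductWith⁻ _∷_ (words N r) (fillingsWithRows N rs) p
  ... | w , F , w∈ , F∈ , refl = words⁻ r w∈ ∷ fillingsWithRows⁻ rs F∈

  words-unique : ∀ N n → Unique (words N n)
  words-unique N zero    = [] ∷ []
  words-unique N (suc n) = Uniqueₚ.cartesianProductWith⁺ _∷_ (λ { refl → refl , refl }) ([1⋯]-unique N) (words-unique N n)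

  fillings-unique : ∀ lam mu γ → Unique (fillings lam mu γ)
  fillings-unique lam mu γ = Uniqueₚ.filter⁺ (λ F → ≡-dec _≟_ (content (length γ) (concat F)) γ)
    (go (map (rowLength lam mu) [1⋯ length lam ]))
    where
    go : ∀ rs → Unique (fillingsWithRows (length γ) rs)
    go []       = [] ∷ []
    go (r ∷ rs) = Uniqueₚ.cartesianProductWith⁺ _∷_ (λ { refl → refl , refl }) (words-unique (length γ) r) (go rs)

  count-++ : ∀ v xs ys → count v (xs ++ ys) ≡ count v xs + count v ys
  count-++ v xs ys = trans (cong length (filter-++ (v ≟_) xs ys)) (length-++ (filter (v ≟_) xs))

  count-concat : ∀ v F → count v (concat F) ≡ sum (map (count v) F)
  count-concat v []      = refl
  count-concat v (w ∷ F) = trans (count-++ v w (concat F)) (cong (count v w +_) (count-concat v F))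

  count-map : ∀ {A : Set} v (h : A → ℕ) xs → count v (map h xs) ≡ sum (map (λ x → when (v ≟ h x) 1) xs)
  count-map v h []       = refl
  count-map v h (x ∷ xs) = trans (count-∷ v (h x) (map h xs)) (cong (when (v ≟ h x) 1 +_) (count-map v h xs))

  weight : (lam mu : List ℕ) → (ℕ → ℕ → ℕ) → ℕ → ℕ
  weight lam mu g v = sumTo (length lam) (λ i → sumTo (rowLength lam mu i) (λ k → when (v ≟ g i (part mu i + k)) 1))

  count-mk : ∀ lam mu g v → count v (concat (mk lam mu g)) ≡ weight lam mu g v
  count-mk lam mu g v = begin
    count v (concat (mk lam mu g))                         ≡⟨ count-concat v (mk lam mu g) ⟩
    sum (map (count v) (map (mkRow lam mu g) [1⋯ length lam ])) ≡⟨ cong sum (sym (map-∘ [1⋯ length lam ])) ⟩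
    sum (map (count v ∘ mkRow lam mu g) [1⋯ length lam ])  ≡⟨ sum-[1⋯] _ (length lam) ⟩
    sumTo (length lam) (count v ∘ mkRow lam mu g)
      ≡⟨ sumTo-cong (length lam) (λ i _ _ → trans (count-map v (λ k → g i (part mu i + k)) [1⋯ rowLength lam mu i ]) (sum-[1⋯] _ (rowLength lam mu i))) ⟩
    weight lam mu g v ∎
    where open ≡-Reasoning

  record Fills (lam mu γ : List ℕ) (g : ℕ → ℕ → ℕ) : Set where
    field
      bounded : ∀ {i j} → InShape lam mu (i , j) → 1 ≤ g i j × g i j ≤ length γ
      weights : ∀ v → 1 ≤ v → v ≤ length γ → weight lam mu g v ≡ part γ v

  content⁺ : ∀ γ w → (∀ v → 1 ≤ v → v ≤ length γ → count v w ≡ part γ v) → content (length γ) w ≡ γ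
  content⁺ γ w p = trans (map-cong-[1⋯] (length γ) p) (tabulate-at γ)

  content⁻ : ∀ γ w → content (length γ) w ≡ γ → ∀ v → 1 ≤ v → v ≤ length γ → count v w ≡ part γ v
  content⁻ γ w eq v a b = trans (sym (at-map-[1⋯] (λ a → count a w) a b)) (cong (λ z → part z v) eq)

  fillings⁺ : ∀ {lam mu γ g} → Fills lam mu γ g → mk lam mu g ∈ fillings lam mu γ
  fillings⁺ {lam} {mu} {γ} {g} f = ∈-filter⁺ (λ F → ≡-dec _≟_ (content (length γ) (concat F)) γ)
    (fillingsWithRows⁺ (rows suc (length lam)))
    (content⁺ γ (concat (mk lam mu g)) (λ v a b → trans (count-mk lam mu g v) (weights v a b)))
    where
    open Fills f
    rows : ∀ h n → Rows (length γ) (map (rowLength lam mu) (applyUpTo h n)) (map (mkRow lam mu g) (applyUpTo h n))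
    rows h zero    = []
    rows h (suc n) =
      ( trans (length-map _ [1⋯ rowLength lam mu (h 0) ]) (length-applyUpTo suc _)
      , Allₚ.map⁺ (All.tabulate λ {k} k∈ → let c , d = ∈-[1⋯]⁻ k∈ in
          bounded (row-inShape lam mu (h 0) c d)))
      ∷ rows (h ∘ suc) n

  Rows-at : ∀ {N rs F} → Rows N rs F → ∀ i → length (at [] F i) ≡ part rs i × All (λ a → 1 ≤ a × a ≤ N) (at [] F i)
  Rows-at []       i             = refl , []
  Rows-at (p ∷ ps) zero          = refl , []
  Rows-at (p ∷ ps) (suc zero)    = p
  Rows-at (p ∷ ps) (suc (suc i)) = Rows-at ps (suc i)

  Rows-length : ∀ {N rs F} → Rows N rs F → length F ≡ length rs
  Rows-length []       = refl
  Rows-length (p ∷ ps) = cong suc (Rows-length ps)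

  all-at : ∀ {P : ℕ → Set} {w} → All P w → ∀ i → 1 ≤ i → i ≤ length w → P (part w i)
  all-at (p ∷ ps) (suc zero)    a b       = p
  all-at (p ∷ ps) (suc (suc i)) a (s≤s b) = all-at ps (suc i) (s≤s z≤n) b

  fillings⁻ : ∀ {lam mu γ F} → F ∈ fillings lam mu γ →
    mk lam mu (λ i j → entry mu F (i , j)) ≡ F × Fills lam mu γ (λ i j → entry mu F (i , j))
  fillings⁻ {lam} {mu} {γ} {F} F∈ = mk≡ , record
    { bounded = bnd
    ; weights = λ v a b → trans (sym (count-mk lam mu (λ i j → entry mu F (i , j)) v)) (trans (cong (count v ∘ concat) mk≡) (content⁻ γ (concat F) (proj₂ split) v a b))
    }
    where
    rs = map (rowLength lam mu) [1⋯ length lam ]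
    split = ∈-filter⁻ (λ F → ≡-dec _≟_ (content (length γ) (concat F)) γ) {xs = fillingsWithRows (length γ) rs} F∈
    R = fillingsWithRows⁻ rs (proj₁ split)
    row-length : ∀ i → 1 ≤ i → i ≤ length lam → length (at [] F i) ≡ rowLength lam mu i
    row-length i a b = trans (proj₁ (Rows-at R i)) (at-map-[1⋯] (rowLength lam mu) a b)
    mk≡ : mk lam mu (λ i j → entry mu F (i , j)) ≡ F
    mk≡ = begin
      mk lam mu (λ i j → entry mu F (i , j))
        ≡⟨ map-cong-[1⋯] {f = mkRow lam mu (λ i j → entry mu F (i , j))} {at [] F} (length lam) (λ i a b → begin
             mkRow lam mu (λ i j → entry mu F (i , j)) i
               ≡⟨ map-cong-[1⋯] (rowLength lam mu i) (λ k _ _ → cong (part (at [] F i)) (m+n∸m≡n (part mu i) k)) ⟩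
             map (part (at [] F i)) [1⋯ rowLength lam mu i ]
               ≡⟨ cong (λ n → map (part (at [] F i)) [1⋯ n ]) (sym (row-length i a b)) ⟩
             map (part (at [] F i)) [1⋯ length (at [] F i) ]
               ≡⟨ tabulate-at (at [] F i) ⟩
             at [] F i ∎) ⟩
      map (at [] F) [1⋯ length lam ]
        ≡⟨ cong (λ n → map (at [] F) [1⋯ n ]) (sym (trans (Rows-length R) (trans (length-map _ [1⋯ length lam ]) (length-applyUpTo suc _)))) ⟩
      map (at [] F) [1⋯ length F ]
        ≡⟨ tabulate-at F ⟩
      F ∎
      where open ≡-Reasoning
    bnd : ∀ {i j} → InShape lam mu (i , j) → 1 ≤ entry mu F (i , j) × entry mu F (i , j) ≤ length γ
    bnd {i} {j} s@(p , q) with a , b ← inShape-row lam mu {i} {j} s =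
      all-at (proj₂ (Rows-at R i)) (j ∸ part mu i) (m<n⇒0<n∸m p)
        (≤-trans (∸-monoˡ-≤ (part mu i) q) (≤-reflexive (sym (row-length i a b))))

-- Finite sums and indexed vectors

module Sums where

  open TandemQueues using (sumTo; sumTo-cong; sumTo-⊕; sumTo-zero; when)
  open Markings using (when-yes; when-no)
  open ChargeWords using (when-cong)

  sumTo-zero′ : ∀ n {f} → (∀ i → 1 ≤ i → i ≤ n → f i ≡ 0) → sumTo n f ≡ 0
  sumTo-zero′ n p = trans (sumTo-cong n p) (sumTo-zero n (λ _ → refl))

  sumTo-suc : ∀ n f → sumTo (suc n) f ≡ f 1 + sumTo n (f ∘ suc)
  sumTo-suc zero    f = +-comm 0 (f 1)
  sumTo-suc (suc n) f = trans (cong (_+ f (suc (suc n))) (sumTo-suc n f)) (+-assoc (f 1) _ _)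

  sumTo-extend : ∀ {m n} f → m ≤ n → (∀ i → m < i → i ≤ n → f i ≡ 0) → sumTo n f ≡ sumTo m f
  sumTo-extend {m} {zero}  f m≤n z with refl ← n≤0⇒n≡0 m≤n = refl
  sumTo-extend {m} {suc n} f m≤n z with m ≟ suc n
  ... | yes refl = refl
  ... | no  ne   = trans (cong₂ _+_ (sumTo-extend f m≤n′ (λ i a b → z i a (m≤n⇒m≤1+n b))) (z (suc n) (s≤s m≤n′) ≤-refl)) (+-identityʳ _)
    where
    m≤n′ : m ≤ n
    m≤n′ = ≤-pred (≤∧≢⇒< m≤n ne)

  sumTo-swap : ∀ m n (h : ℕ → ℕ → ℕ) → sumTo m (λ i → sumTo n (h i)) ≡ sumTo n (λ j → sumTo m (λ i → h i j))
  sumTo-swap zero    n h = sym (sumTo-zero n (λ _ → refl))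
  sumTo-swap (suc m) n h = trans (cong (_+ sumTo n (h (suc m))) (sumTo-swap m n h)) (sym (sumTo-⊕ n (λ j → sumTo m (λ i → h i j)) (h (suc m))))

  sumTo-when : ∀ {m n} f → m ≤ n → sumTo m f ≡ sumTo n (λ i → when (i ≤? m) (f i))
  sumTo-when {m} {n} f p = trans (sumTo-cong m (λ i _ q → sym (when-yes (i ≤? m) q)))
    (sym (sumTo-extend (λ i → when (i ≤? m) (f i)) p (λ i q _ → when-no (i ≤? m) (<⇒≱ q))))

  -- `l` and `c` describe one set of pairs, by its rows and by its columns.
  sumTo-conj : ∀ {m n} (l c : ℕ → ℕ) (h : ℕ → ℕ → ℕ) → (∀ i → 1 ≤ i → i ≤ m → l i ≤ n) → (∀ j → 1 ≤ j → j ≤ n → c j ≤ m) →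
    (∀ {i j} → 1 ≤ i → i ≤ m → 1 ≤ j → j ≤ n → j ≤ l i → i ≤ c j) →
    (∀ {i j} → 1 ≤ i → i ≤ m → 1 ≤ j → j ≤ n → i ≤ c j → j ≤ l i) →
    sumTo m (λ i → sumTo (l i) (h i)) ≡ sumTo n (λ j → sumTo (c j) (λ i → h i j))
  sumTo-conj {m} {n} l c h lb cb to from = begin
    sumTo m (λ i → sumTo (l i) (h i))
      ≡⟨ sumTo-cong m (λ i a b → sumTo-when (h i) (lb i a b)) ⟩
    sumTo m (λ i → sumTo n (λ j → when (j ≤? l i) (h i j)))
      ≡⟨ sumTo-swap m n _ ⟩
    sumTo n (λ j → sumTo m (λ i → when (j ≤? l i) (h i j)))
      ≡⟨ sumTo-cong n (λ j a b → trans (sumTo-cong m (λ i c′ d → when-cong (j ≤? l i) (i ≤? c j) (to c′ d a b) (from c′ d a b))) (sym (sumTo-when (λ i → h i j) (cb j a b)))) ⟩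
    sumTo n (λ j → sumTo (c j) (λ i → h i j)) ∎
    where open ≡-Reasoning

  sumTo-count : ∀ L {P : ℕ → Set} (P? : Decidable P) → sumTo L (λ j → when (P? j) 1) ≤ L
  sumTo-count zero    P? = z≤n
  sumTo-count (suc L) P? = ≤-trans (+-mono-≤ (sumTo-count L P?) (w (P? (suc L)))) (≤-reflexive (+-comm L 1))
    where
    w : ∀ {P : Set} (d : Dec P) → when d 1 ≤ 1
    w (yes _) = ≤-refl
    w (no _)  = z≤n

  -- A downward closed subset of 1, ..., L is an initial segment, so its cardinality decides
  -- membership.
  count-initial⁺ : ∀ L {P : ℕ → Set} (P? : Decidable P) → (∀ {i j} → 1 ≤ i → i ≤ j → j ≤ L → P j → P i) →
    ∀ j → 1 ≤ j → j ≤ L → P j → j ≤ sumTo L (λ j → when (P? j) 1)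
  count-initial⁺ zero    P? d j a b p = b
  count-initial⁺ (suc L) P? d j a b p with m≤n⇒m<n∨m≡n b
  ... | inj₁ (s≤s j≤L) = ≤-trans (count-initial⁺ L P? (λ x y z → d x y (m≤n⇒m≤1+n z)) j a j≤L p) (m≤m+n _ _)
  ... | inj₂ refl rewrite when-yes (P? (suc L)) {1} p | +-comm (sumTo L (λ j → when (P? j) 1)) 1 = s≤s (all L ≤-refl)
    where
    all : ∀ n → n ≤ L → n ≤ sumTo n (λ j → when (P? j) 1)
    all zero    q = z≤n
    all (suc n) q rewrite when-yes (P? (suc n)) {1} (d (s≤s z≤n) (m≤n⇒m≤1+n q) ≤-refl p) =
      ≤-trans (s≤s (all n (<⇒≤ q))) (≤-reflexive (+-comm 1 _))

  count-initial⁻ : ∀ L {P : ℕ → Set} (P? : Decidable P) → (∀ {i j} → 1 ≤ i → i ≤ j → j ≤ L → P j → P i) →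
    ∀ j → 1 ≤ j → j ≤ sumTo L (λ j → when (P? j) 1) → P j
  count-initial⁻ zero    P? d j a b = contradiction b (<⇒≱ a)
  count-initial⁻ (suc L) P? d j a b with P? (suc L)
  ... | yes p = d a (≤-trans b (≤-trans (+-monoˡ-≤ 1 (sumTo-count L P?)) (≤-reflexive (+-comm L 1)))) ≤-refl p
  ... | no _  = count-initial⁻ L P? (λ x y z → d x y (m≤n⇒m≤1+n z)) j a (≤-trans b (≤-reflexive (+-identityʳ _)))

  -- mkA lists f 1, …, f n and mkV lists f n, …, f 1.
  mkA : ∀ n → (ℕ → ℕ) → Vec ℕ n
  mkA zero    f = []
  mkA (suc n) f = f 1 ∷ mkA n (f ∘ suc)

  mkV : ∀ {A : Set} n → (ℕ → A) → Vec A n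
  mkV zero    f = []
  mkV (suc n) f = f (suc n) ∷ mkV n f

  getA : ∀ {n} → Vec ℕ n → ℕ → ℕ
  getA []       i             = 0
  getA (x ∷ xs) zero          = 0
  getA (x ∷ xs) (suc zero)    = x
  getA (x ∷ xs) (suc (suc i)) = getA xs (suc i)

  getV : ∀ {A : Set} {n} → A → Vec A n → ℕ → A
  getV d []       i = d
  getV {n = suc n} d (x ∷ xs) i with i ≟ suc n
  ... | yes _ = x
  ... | no  _ = getV d xs i

  mkA-cong : ∀ n {f g} → (∀ i → 1 ≤ i → i ≤ n → f i ≡ g i) → mkA n f ≡ mkA n g
  mkA-cong zero    p = refl
  mkA-cong (suc n) p = cong₂ _∷_ (p 1 ≤-refl (s≤s z≤n)) (mkA-cong n λ i a b → p (suc i) (s≤s z≤n) (s≤s b))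

  mkV-cong : ∀ {A : Set} n {f g : ℕ → A} → (∀ i → 1 ≤ i → i ≤ n → f i ≡ g i) → mkV n f ≡ mkV n g
  mkV-cong zero    p = refl
  mkV-cong (suc n) p = cong₂ _∷_ (p (suc n) (s≤s z≤n) ≤-refl) (mkV-cong n λ i a b → p i a (m≤n⇒m≤1+n b))

  mkA∘getA : ∀ {n} (xs : Vec ℕ n) → mkA n (getA xs) ≡ xs
  mkA∘getA []           = refl
  mkA∘getA {suc n} (x ∷ xs) = cong (x ∷_) (trans (mkA-cong n (λ { (suc i) a b → refl })) (mkA∘getA xs))

  getA∘mkA : ∀ n f i → 1 ≤ i → i ≤ n → getA (mkA n f) i ≡ f i
  getA∘mkA (suc n) f (suc zero)    a b       = refl
  getA∘mkA (suc n) f (suc (suc i)) a (s≤s b) = getA∘mkA n (f ∘ suc) (suc i) (s≤s z≤n) b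

  getA-beyond : ∀ {n} (xs : Vec ℕ n) {i} → n < i → getA xs i ≡ 0
  getA-beyond []       p = refl
  getA-beyond (x ∷ xs) {suc (suc i)} (s≤s p) = getA-beyond xs p
  getA-beyond (x ∷ xs) {suc zero} (s≤s ())

  getV-last : ∀ {A : Set} {n} (d : A) x (xs : Vec A n) → getV d (x ∷ xs) (suc n) ≡ x
  getV-last {n = n} d x xs with suc n ≟ suc n
  ... | yes _ = refl
  ... | no ne = contradiction refl ne

  getV-init : ∀ {A : Set} {n} (d : A) x (xs : Vec A n) {i} → i ≤ n → getV d (x ∷ xs) i ≡ getV d xs i
  getV-init {n = n} d x xs {i} p with i ≟ suc n
  ... | yes refl = contradiction p (<⇒≱ ≤-refl)
  ... | no _     = refl

  mkV∘getV : ∀ {A : Set} {n} (d : A) (xs : Vec A n) → mkV n (getV d xs) ≡ xs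
  mkV∘getV d []       = refl
  mkV∘getV {n = suc n} d (x ∷ xs) =
    cong₂ _∷_ (getV-last d x xs) (trans (mkV-cong n (λ i _ b → getV-init d x xs b)) (mkV∘getV d xs))

  getV∘mkV : ∀ {A : Set} n (d : A) f i → 1 ≤ i → i ≤ n → getV d (mkV n f) i ≡ f i
  getV∘mkV zero d f i a b = contradiction b (<⇒≱ a)
  getV∘mkV (suc n) d f i a b with m≤n⇒m<n∨m≡n b
  ... | inj₂ refl      = getV-last d _ (mkV n f)
  ... | inj₁ (s≤s i≤n) = trans (getV-init d _ (mkV n f) i≤n) (getV∘mkV n d f i a i≤n)

  sum-mkA : ∀ n f → Vec.sum (mkA n f) ≡ sumTo n f
  sum-mkA zero    f = refl
  sum-mkA (suc n) f = trans (cong (f 1 +_) (sum-mkA n (f ∘ suc))) (sym (sumTo-suc n f))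

  sum-mkV : ∀ n f → Vec.sum (mkV n f) ≡ sumTo n f
  sum-mkV zero    f = refl
  sum-mkV (suc n) f = trans (cong (f (suc n) +_) (sum-mkV n f)) (+-comm (f (suc n)) _)

-- Tableaux as chains of partitions

module Tableaux where

  open RSK
  open TandemQueues using (sumTo; sumTo-cong; sumTo-⊕; when)
  open Markings using (when-yes; when-no)
  open ChargeWords using (when-cong)
  open Shapes
  open Sums

  record SemiStd (nu : List ℕ) (g : ℕ → ℕ → ℕ) : Set where
    field
      row : ∀ {i j} → InShape nu [] (i , j) → InShape nu [] (i , suc j) → g i j ≤ g i (suc j)
      col : ∀ {i j} → InShape nu [] (i , j) → InShape nu [] (suc i , j) → g i j < g (suc i) j

  SSYT⁺ : ∀ {nu α g} → IsPartition nu → Fills nu [] α g → SemiStd nu g → mk nu [] g ∈ SSYT nu α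
  SSYT⁺ {nu} {α} {g} p f s = ∈-filter⁺ (isSemistandard? nu) (fillings⁺ f) (All.tabulate λ {b} b∈ → box b (boxes⁻ {nu} {[]} b∈))
    where
    T⟨_⟩ : Box → ℕ
    T⟨_⟩ = entry [] (mk nu [] g)
    box : ∀ b → InShape nu [] b → (InShape nu [] (right b) → T⟨ b ⟩ ≤ T⟨ right b ⟩) × (InShape nu [] (down b) → T⟨ b ⟩ < T⟨ down b ⟩)
    box (i , j) b = (λ r → subst₂ _≤_ (sym (entry-mk nu [] g b)) (sym (entry-mk nu [] g r)) (SemiStd.row s b r))
                  , (λ r → subst₂ _<_ (sym (entry-mk nu [] g b)) (sym (entry-mk nu [] g r)) (SemiStd.col s b r))

  SSYT⁻ : ∀ {nu α T} → IsPartition nu → T ∈ SSYT nu α →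
    mk nu [] (λ i j → entry [] T (i , j)) ≡ T × Fills nu [] α (λ i j → entry [] T (i , j)) × SemiStd nu (λ i j → entry [] T (i , j))
  SSYT⁻ {nu} {α} {T} p T∈ with ∈-filter⁻ (isSemistandard? nu) {xs = fillings nu [] α} T∈
  ... | T∈′ , s with fillings⁻ {nu} {[]} {α} T∈′
  ...   | eq , f = eq , f , record
    { row = λ {i} {j} b r → proj₁ (All.lookup s (boxes⁺ {nu} {[]} p b)) r
    ; col = λ {i} {j} b r → proj₂ (All.lookup s (boxes⁺ {nu} {[]} p b)) r }

  -- f a is the number of the entries g 1, …, g L not exceeding a.
  record Galois (n L : ℕ) (g f : ℕ → ℕ) : Set where
    field
      to   : ∀ a j → a ≤ n → 1 ≤ j → j ≤ L → g j ≤ a → j ≤ f a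
      from : ∀ a j → a ≤ n → 1 ≤ j → j ≤ L → j ≤ f a → g j ≤ a
      bound : ∀ a → a ≤ n → f a ≤ L
      start : f 0 ≡ 0
      end   : f n ≡ L

  cumulative : ℕ → (ℕ → ℕ) → ℕ → ℕ
  cumulative L g a = sumTo L (λ j → when (g j ≤? a) 1)

  -- The j-th entry of the row with counts `f` is the least a with j ≤ f a, found by counting the a
  -- with f a < j. The successor accounts for a = 0.
  inverseOf : ℕ → (ℕ → ℕ) → ℕ → ℕ
  inverseOf n f j = suc (sumTo n (λ a → when (f a <? j) 1))

  ≤-mono : ∀ {n} {f : ℕ → ℕ} → (∀ a → a < n → f a ≤ f (suc a)) → ∀ {a b} → a ≤ b → b ≤ n → f a ≤ f b
  ≤-mono {f = f} m {a} {b} p q with m≤n⇒m<n∨m≡n p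
  ... | inj₂ refl = ≤-refl
  ≤-mono {f = f} m {a} {suc b} p q | inj₁ (s≤s r) = ≤-trans (≤-mono m r (<⇒≤ q)) (m b q)

  galois-cumulative : ∀ {n L g} → (∀ j → 1 ≤ j → j ≤ L → 1 ≤ g j × g j ≤ n) →
    (∀ j → 1 ≤ j → j < L → g j ≤ g (suc j)) → Galois n L g (cumulative L g)
  galois-cumulative {n} {L} {g} b m = record
    { to    = λ a j _ p q r → count-initial⁺ L (λ j → g j ≤? a) init j p q r
    ; from  = λ a j _ p q r → count-initial⁻ L (λ j → g j ≤? a) init j p r
    ; bound = λ a _ → sumTo-count L (λ j → g j ≤? a)
    ; start = sumTo-zero′ L (λ j p q → when-no (g j ≤? 0) (<⇒≱ (proj₁ (b j p q))))
    ; end   = trans (sumTo-cong L (λ j p q → when-yes (g j ≤? n) (proj₂ (b j p q)))) (ones L)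
    }
    where
    mono : ∀ {i j} → 1 ≤ i → i ≤ j → j ≤ L → g i ≤ g j
    mono {i} {j} p q r with m≤n⇒m<n∨m≡n q
    ... | inj₂ refl = ≤-refl
    mono {i} {suc j} p q r | inj₁ (s≤s i≤j) = ≤-trans (mono p i≤j (<⇒≤ r)) (m j (≤-trans p i≤j) r)
    init : ∀ {a i j} → 1 ≤ i → i ≤ j → j ≤ L → g j ≤ a → g i ≤ a
    init p q r = ≤-trans (mono p q r)
    ones : ∀ L → sumTo L (λ _ → 1) ≡ L
    ones zero    = refl
    ones (suc L) = trans (cong (_+ 1) (ones L)) (+-comm L 1)

  galois-inverse : ∀ {n L f} → (∀ a → a < n → f a ≤ f (suc a)) → f 0 ≡ 0 → f n ≡ L → Galois n L (inverseOf n f) f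
  galois-inverse {n} {L} {f} m f0 fn = record
    { to    = λ a j p q r s → ≮⇒≥ (λ f<j → contradiction (reach a j p q f<j) (<⇒≱ s))
    ; from  = λ a j p q r s → ≮⇒≥ (λ a<g → above a j p q s (≤-pred a<g))
    ; bound = λ a p → ≤-trans (≤-mono m p ≤-refl) (≤-reflexive fn)
    ; start = f0
    ; end   = fn
    }
    where
    init : ∀ {j a b} → 1 ≤ a → a ≤ b → b ≤ n → f b < j → f a < j
    init p q r s = ≤-<-trans (≤-mono m q r) s
    reach : ∀ a j → a ≤ n → 1 ≤ j → f a < j → a ≤ sumTo n (λ a → when (f a <? j) 1)
    reach zero    j p q r = z≤n
    reach (suc a) j p q r = count-initial⁺ n (λ a → f a <? j) init (suc a) (s≤s z≤n) p r
    above : ∀ a j → a ≤ n → 1 ≤ j → j ≤ f a → ¬ a ≤ sumTo n (λ a → when (f a <? j) 1)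
    above zero    j p q r s = contradiction (≤-trans r (≤-reflexive f0)) (<⇒≱ q)
    above (suc a) j p q r s = <⇒≱ (count-initial⁻ n (λ a → f a <? j) init (suc a) (s≤s z≤n) s) r

  module _ {n L : ℕ} {g f : ℕ → ℕ} (G : Galois n L g f) where
    open Galois G

    galois-range : ∀ j → 1 ≤ j → j ≤ L → 1 ≤ g j × g j ≤ n
    galois-range j p q = n≢0⇒n>0 (λ eq → contradiction (≤-trans (to 0 j z≤n p q (≤-reflexive eq)) (≤-reflexive start)) (<⇒≱ p))
                       , from n j ≤-refl p q (≤-trans q (≤-reflexive (sym end)))

    galois-unique-f : ∀ {f′} → Galois n L g f′ → ∀ a → a ≤ n → f a ≡ f′ a
    galois-unique-f G′ a p = ≤-ext
      (λ j q r → let s = ≤-trans r (bound a p) in Galois.to G′ a j p q s (from a j p q s r))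
      (λ j q r → let s = ≤-trans r (Galois.bound G′ a p) in to a j p q s (Galois.from G′ a j p q s r))

    galois-mono : ∀ a → a < n → f a ≤ f (suc a)
    galois-mono a p with f a in eq
    ... | zero  = z≤n
    ... | suc b = to (suc a) (suc b) p (s≤s z≤n) h (m≤n⇒m≤1+n (from a (suc b) (<⇒≤ p) (s≤s z≤n) h (≤-reflexive (sym eq))))
      where h = ≤-trans (≤-reflexive (sym eq)) (bound a (<⇒≤ p))

    galois-sorted : ∀ j → 1 ≤ j → j < L → g j ≤ g (suc j)
    galois-sorted j p q = from _ j gn p (<⇒≤ q) (<⇒≤ (to _ (suc j) gn (s≤s z≤n) q ≤-refl))
      where gn = proj₂ (galois-range (suc j) (s≤s z≤n) q)

    galois-weight : ∀ a → a < n → sumTo L (λ j → when (suc a ≟ g j) 1) + f a ≡ f (suc a)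
    galois-weight a p = begin
      sumTo L (λ j → when (suc a ≟ g j) 1) + f a
        ≡⟨ cong (sumTo L (λ j → when (suc a ≟ g j) 1) +_) (cum a (<⇒≤ p)) ⟩
      sumTo L (λ j → when (suc a ≟ g j) 1) + cumulative L g a
        ≡⟨ sym (sumTo-⊕ L _ _) ⟩
      sumTo L (λ j → when (suc a ≟ g j) 1 + when (g j ≤? a) 1)
        ≡⟨ sumTo-cong L (λ j _ _ → split (g j)) ⟩
      cumulative L g (suc a)
        ≡⟨ sym (cum (suc a) p) ⟩
      f (suc a) ∎
      where
      open ≡-Reasoning
      cum : ∀ a → a ≤ n → f a ≡ cumulative L g a
      cum = galois-unique-f (galois-cumulative galois-range galois-sorted)
      split : ∀ x → when (suc a ≟ x) 1 + when (x ≤? a) 1 ≡ when (x ≤? suc a) 1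
      split x with suc a ≟ x
      ... | yes refl rewrite when-no (suc a ≤? a) {1} (<⇒≱ ≤-refl) | when-yes (suc a ≤? suc a) {1} ≤-refl = refl
      ... | no  ne   = when-cong (x ≤? a) (x ≤? suc a) m≤n⇒m≤1+n (λ q → ≤-pred (≤∧≢⇒< q (λ eq → ne (sym eq))))

  galois-unique-g : ∀ {n L g g′ f} → Galois n L g f → Galois n L g′ f → ∀ j → 1 ≤ j → j ≤ L → g j ≡ g′ j
  galois-unique-g {g = g} {g′} G G′ j p q = ≤-antisym
    (Galois.from G _ j (proj₂ (galois-range G′ j p q)) p q (Galois.to G′ _ j (proj₂ (galois-range G′ j p q)) p q ≤-refl))
    (Galois.from G′ _ j (proj₂ (galois-range G j p q)) p q (Galois.to G _ j (proj₂ (galois-range G j p q)) p q ≤-refl))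

  -- The functional form of a pair of chains of partitions f 0, …, f n and
  -- q 0, …, q N, the first increasing by horizontal strips of the sizes α and
  -- the second increasing by vertical strips of the sizes γ.
  record Chains (n N : ℕ) (α γ : ℕ → ℕ) (f q : ℕ → ℕ → ℕ) : Set where
    field
      f-beyond : ∀ a i → a ≤ n → a < i → f a i ≡ 0
      f-mono   : ∀ a i → a < n → 1 ≤ i → f a i ≤ f (suc a) i
      f-strip  : ∀ a i → a < n → 1 ≤ i → f (suc a) (suc i) ≤ f a i
      f-size   : ∀ a → a < n → sumTo (suc a) (f (suc a)) ≡ sumTo a (f a) + α (suc a)
      q-start  : ∀ i → 1 ≤ i → q 0 i ≡ 0
      q-mono   : ∀ v i → v < N → 1 ≤ i → q v i ≤ q (suc v) i
      q-strip  : ∀ v i → v < N → 1 ≤ i → q (suc v) i ≤ suc (q v i)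
      q-decr   : ∀ v i → v ≤ N → 1 ≤ i → q v (suc i) ≤ q v i
      q-size   : ∀ v → v < N → sumTo n (q (suc v)) ≡ sumTo n (q v) + γ (suc v)
      same     : ∀ i → 1 ≤ i → f n i ≡ q N i

  record Pair (nu α γ : List ℕ) (gT gQ : ℕ → ℕ → ℕ) : Set where
    field
      fillsT : Fills nu [] α gT
      stdT   : SemiStd nu gT
      fillsQ : Fills (conj nu) [] γ gQ
      stdQ   : SemiStd (conj nu) gQ

  module _ {nu α γ : List ℕ} (P : IsPartition nu) {gT gQ f q : ℕ → ℕ → ℕ} where
    private
      n N : ℕ
      n = length α
      N = length γ

    -- Row i of T and column i of Q have the same length, so `part nu i` bounds both. The arguments
    -- of `gQ` are swapped because Q has the conjugate shape.
    Match : Set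
    Match = ∀ i → 1 ≤ i → Galois n (part nu i) (gT i) (λ a → f a i) × Galois N (part nu i) (λ j → gQ j i) (λ v → q v i)

    private
      in-conj : ∀ {i j} → InShape (conj nu) [] (j , i) → 1 ≤ i × 1 ≤ j × j ≤ part nu i
      in-conj {i} {j} s@(p , r) with a , _ ← inShape-row (conj nu) [] {j} {i} s = p , a , conj⁺ (proj₁ P) p a r

      conj-in : ∀ {i j} → 1 ≤ i → 1 ≤ j → j ≤ part nu i → InShape (conj nu) [] (j , i)
      conj-in p a b = p , conj⁻ (proj₁ P) p a b

      in-row : ∀ {i j} → InShape nu [] (i , j) → 1 ≤ i
      in-row {i} {j} s = proj₁ (inShape-row nu [] {i} {j} s)

      weight-conj : length nu ≤ n → ∀ v → weight (conj nu) [] gQ v ≡ sumTo n (λ i → sumTo (part nu i) (λ j → when (v ≟ gQ j i) 1))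
      weight-conj len v = sym (sumTo-conj {n} {length (conj nu)} (part nu) (part (conj nu)) (λ i j → when (v ≟ gQ j i) 1)
        (λ i a _ → bnd i a) (λ j a _ → bnd′ j a)
        (λ a _ b _ → conj⁻ (proj₁ P) a b) (λ a _ b _ → conj⁺ (proj₁ P) a b))
        where
        bnd : ∀ i → 1 ≤ i → part nu i ≤ length (conj nu)
        bnd i a with part nu i in eq
        ... | zero  = z≤n
        ... | suc l = proj₂ (part-pos {conj nu} (≤-trans a (conj⁻ (proj₁ P) a (s≤s z≤n) (≤-reflexive (sym eq)))))
        bnd′ : ∀ j → 1 ≤ j → part (conj nu) j ≤ n
        bnd′ j a with part (conj nu) j in eq
        ... | zero  = z≤n
        ... | suc l = ≤-trans (proj₂ (part-pos {nu} (≤-trans a (conj⁺ (proj₁ P) (s≤s z≤n) a (≤-reflexive (sym eq)))))) len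

      weight-rows : length nu ≤ n → ∀ v → weight nu [] gT v ≡ sumTo n (λ i → sumTo (part nu i) (λ j → when (v ≟ gT i j) 1))
      weight-rows len v = sym (sumTo-extend (λ i → sumTo (part nu i) (λ j → when (v ≟ gT i j) 1)) len
        (λ i p _ → cong (λ l → sumTo l (λ j → when (v ≟ gT i j) 1)) (part-beyond {nu} p)))

    -- In terms of counts, horizontal strips make the columns of T strict and vertical strips those
    -- of Q. The rows of Q increase weakly because each shape of its chain is a partition. Weights
    -- are differences of consecutive sizes.
    chains⇒pair : Match → Chains n N (part α) (part γ) f q → Pair nu α γ gT gQ
    chains⇒pair M C = record
      { fillsT = record
        { bounded = λ {i} {j} b → galois-range (proj₁ (M i (in-row b))) j (proj₁ b) (proj₂ b)
        ; weights = λ { (suc a) p r → +-cancelʳ-≡ (sumTo n (f a)) _ _ (begin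
            weight nu [] gT (suc a) + sumTo n (f a)   ≡⟨ cong (_+ sumTo n (f a)) (weight-rows len (suc a)) ⟩
            sumTo n (λ i → sumTo (part nu i) (λ j → when (suc a ≟ gT i j) 1)) + sumTo n (f a) ≡⟨ sym (sumTo-⊕ n _ _) ⟩
            sumTo n (λ i → sumTo (part nu i) (λ j → when (suc a ≟ gT i j) 1) + f a i)
              ≡⟨ sumTo-cong n (λ i b _ → galois-weight (proj₁ (M i b)) a r) ⟩
            sumTo n (f (suc a))                       ≡⟨ sumTo-extend (f (suc a)) r (λ i b _ → f-beyond (suc a) i r b) ⟩
            sumTo (suc a) (f (suc a))                 ≡⟨ f-size a r ⟩
            sumTo a (f a) + part α (suc a)            ≡⟨ cong (_+ part α (suc a)) (sym (sumTo-extend (f a) (<⇒≤ r) (λ i b _ → f-beyond a i (<⇒≤ r) b))) ⟩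
            sumTo n (f a) + part α (suc a)            ≡⟨ +-comm (sumTo n (f a)) _ ⟩
            part α (suc a) + sumTo n (f a)            ∎) } }
      ; stdT = record
        { row = λ {i} {j} b r → galois-sorted (proj₁ (M i (in-row b))) j (proj₁ b) (proj₂ r)
        ; col = λ {i} {j} b r → colT i j (in-row b) (proj₁ b) (proj₂ b) (proj₂ r) }
      ; fillsQ = record
        { bounded = λ {j} {i} b → let x , y , z = in-conj b in galois-range (proj₂ (M i x)) j y z
        ; weights = λ { (suc a) p r → +-cancelʳ-≡ (sumTo n (q a)) _ _ (begin
            weight (conj nu) [] gQ (suc a) + sumTo n (q a)   ≡⟨ cong (_+ sumTo n (q a)) (weight-conj len (suc a)) ⟩
            sumTo n (λ i → sumTo (part nu i) (λ j → when (suc a ≟ gQ j i) 1)) + sumTo n (q a) ≡⟨ sym (sumTo-⊕ n _ _) ⟩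
            sumTo n (λ i → sumTo (part nu i) (λ j → when (suc a ≟ gQ j i) 1) + q a i)
              ≡⟨ sumTo-cong n (λ i b _ → galois-weight (proj₂ (M i b)) a r) ⟩
            sumTo n (q (suc a))                       ≡⟨ q-size a r ⟩
            sumTo n (q a) + part γ (suc a)            ≡⟨ +-comm (sumTo n (q a)) _ ⟩
            part γ (suc a) + sumTo n (q a)            ∎) } }
      ; stdQ = record
        { row = λ {j} {i} b r → let x , y , z = in-conj b ; _ , _ , z′ = in-conj r in rowQ i j x y z z′
        ; col = λ {j} {i} b r → let x , y , z = in-conj b ; _ , _ , z′ = in-conj r in colQ i j x y z z′ }
      }
      where
      open Chains C
      open ≡-Reasoning
      len : length nu ≤ n
      len with length nu ≤? n
      ... | yes p = p
      ... | no  p = contradiction (trans (sym (Galois.end (proj₁ (M (length nu) (≤-trans (s≤s z≤n) (≰⇒> p)))))) (f-beyond n (length nu) ≤-refl (≰⇒> p)))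
                      (>⇒≢ (partition-pos P (≤-trans (s≤s z≤n) (≰⇒> p)) ≤-refl))
      colT : ∀ i j → 1 ≤ i → 1 ≤ j → j ≤ part nu i → j ≤ part nu (suc i) → gT i j < gT (suc i) j
      colT i j a b c d with gT (suc i) j in eq | galois-range (proj₁ (M (suc i) (s≤s z≤n))) j b d
      ... | suc x | _ , r = s≤s (Galois.from (proj₁ (M i a)) x j (<⇒≤ r) b c
        (≤-trans (Galois.to (proj₁ (M (suc i) (s≤s z≤n))) (suc x) j r b d (≤-reflexive eq)) (f-strip x i r a)))
      colQ : ∀ i j → 1 ≤ i → 1 ≤ j → j ≤ part nu i → suc j ≤ part nu i → gQ j i < gQ (suc j) i
      colQ i j a b c d with gQ (suc j) i in eq | galois-range (proj₂ (M i a)) (suc j) (s≤s z≤n) d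
      ... | suc x | _ , r = s≤s (Galois.from (proj₂ (M i a)) x j (<⇒≤ r) b c
        (≤-pred (≤-trans (Galois.to (proj₂ (M i a)) (suc x) (suc j) r (s≤s z≤n) d (≤-reflexive eq)) (q-strip x i r a))))
      rowQ : ∀ i j → 1 ≤ i → 1 ≤ j → j ≤ part nu i → j ≤ part nu (suc i) → gQ j i ≤ gQ j (suc i)
      rowQ i j a b c d with galois-range (proj₂ (M (suc i) (s≤s z≤n))) j b d
      ... | _ , r = Galois.from (proj₂ (M i a)) _ j r b c
        (≤-trans (Galois.to (proj₂ (M (suc i) (s≤s z≤n))) _ j r b d ≤-refl) (q-decr _ i r a))

    pair⇒chains : Match → Pair nu α γ gT gQ → Chains n N (part α) (part γ) f q
    pair⇒chains M Y = record
      { f-beyond = zeros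
      ; f-mono   = λ a i p b → galois-mono (proj₁ (M i b)) a p
      ; f-strip  = strip
      ; f-size   = λ a r → begin
          sumTo (suc a) (f (suc a)) ≡⟨ sym (sumTo-extend (f (suc a)) r (λ i b c → zeros (suc a) i r b)) ⟩
          sumTo n (f (suc a))       ≡⟨ sym (sumTo-cong n (λ i b _ → galois-weight (proj₁ (M i b)) a r)) ⟩
          sumTo n (λ i → sumTo (part nu i) (λ j → when (suc a ≟ gT i j) 1) + f a i) ≡⟨ sumTo-⊕ n _ _ ⟩
          sumTo n (λ i → sumTo (part nu i) (λ j → when (suc a ≟ gT i j) 1)) + sumTo n (f a)
            ≡⟨ cong (_+ sumTo n (f a)) (trans (sym (weight-rows len (suc a))) (Fills.weights fillsT (suc a) (s≤s z≤n) r)) ⟩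
          part α (suc a) + sumTo n (f a) ≡⟨ cong (part α (suc a) +_) (sumTo-extend (f a) (<⇒≤ r) (λ i b c → zeros a i (<⇒≤ r) b)) ⟩
          part α (suc a) + sumTo a (f a) ≡⟨ +-comm (part α (suc a)) _ ⟩
          sumTo a (f a) + part α (suc a) ∎
      ; q-start  = λ i b → Galois.start (proj₂ (M i b))
      ; q-mono   = λ v i p b → galois-mono (proj₂ (M i b)) v p
      ; q-strip  = stripQ
      ; q-decr   = decrQ
      ; q-size   = λ a r → begin
          sumTo n (q (suc a))       ≡⟨ sym (sumTo-cong n (λ i b _ → galois-weight (proj₂ (M i b)) a r)) ⟩
          sumTo n (λ i → sumTo (part nu i) (λ j → when (suc a ≟ gQ j i) 1) + q a i) ≡⟨ sumTo-⊕ n _ _ ⟩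
          sumTo n (λ i → sumTo (part nu i) (λ j → when (suc a ≟ gQ j i) 1)) + sumTo n (q a)
            ≡⟨ cong (_+ sumTo n (q a)) (trans (sym (weight-conj len (suc a))) (Fills.weights fillsQ (suc a) (s≤s z≤n) r)) ⟩
          part γ (suc a) + sumTo n (q a) ≡⟨ +-comm (part γ (suc a)) _ ⟩
          sumTo n (q a) + part γ (suc a) ∎
      ; same     = λ i b → trans (Galois.end (proj₁ (M i b))) (sym (Galois.end (proj₂ (M i b))))
      }
      where
      open Pair Y
      open ≡-Reasoning
      strip : ∀ a i → a < n → 1 ≤ i → f (suc a) (suc i) ≤ f a i
      strip a i p b with f (suc a) (suc i) in eq
      ... | zero  = z≤n
      ... | suc j = Galois.to (proj₁ (M i b)) a (suc j) (<⇒≤ p) (s≤s z≤n) j≤i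
        (≤-pred (<-≤-trans (SemiStd.col stdT {i} {suc j} (s≤s z≤n , j≤i) (s≤s z≤n , j≤si))
                           (Galois.from (proj₁ (M (suc i) (s≤s z≤n))) (suc a) (suc j) p (s≤s z≤n) j≤si (≤-reflexive (sym eq)))))
        where
        j≤si : suc j ≤ part nu (suc i)
        j≤si = ≤-trans (≤-reflexive (sym eq)) (Galois.bound (proj₁ (M (suc i) (s≤s z≤n))) (suc a) p)
        j≤i : suc j ≤ part nu i
        j≤i = ≤-trans j≤si (part-anti (proj₁ P) b (n≤1+n i))
      -- Strict columns force the entries of row i to be at least i.
      zeros : ∀ a i → a ≤ n → a < i → f a i ≡ 0
      zeros zero    i       p q = Galois.start (proj₁ (M i q))
      zeros (suc a) (suc i) p (s≤s q) = n≤0⇒n≡0 (≤-trans (strip a i p (≤-trans (s≤s z≤n) q)) (≤-reflexive (zeros a i (<⇒≤ p) q)))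
      len : length nu ≤ n
      len with length nu ≤? n
      ... | yes p = p
      ... | no  p = contradiction (trans (sym (Galois.end (proj₁ (M (length nu) (≤-trans (s≤s z≤n) (≰⇒> p)))))) (zeros n (length nu) ≤-refl (≰⇒> p)))
                      (>⇒≢ (partition-pos P (≤-trans (s≤s z≤n) (≰⇒> p)) ≤-refl))
      stripQ : ∀ v i → v < N → 1 ≤ i → q (suc v) i ≤ suc (q v i)
      stripQ v i p b with q (suc v) i in eq
      ... | zero        = z≤n
      ... | suc zero    = s≤s z≤n
      ... | suc (suc j) = s≤s (Galois.to (proj₂ (M i b)) v (suc j) (<⇒≤ p) (s≤s z≤n) (<⇒≤ j≤)
        (≤-pred (<-≤-trans (SemiStd.col stdQ {suc j} {i} (conj-in b (s≤s z≤n) (<⇒≤ j≤)) (conj-in b (s≤s z≤n) j≤))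
                           (Galois.from (proj₂ (M i b)) (suc v) (suc (suc j)) p (s≤s z≤n) j≤ (≤-reflexive (sym eq))))))
        where
        j≤ : suc (suc j) ≤ part nu i
        j≤ = ≤-trans (≤-reflexive (sym eq)) (Galois.bound (proj₂ (M i b)) (suc v) p)
      decrQ : ∀ v i → v ≤ N → 1 ≤ i → q v (suc i) ≤ q v i
      decrQ v i p b with q v (suc i) in eq
      ... | zero  = z≤n
      ... | suc j = Galois.to (proj₂ (M i b)) v (suc j) p (s≤s z≤n) j≤i
        (≤-trans (SemiStd.row stdQ {suc j} {i} (conj-in b (s≤s z≤n) j≤i) (conj-in (s≤s z≤n) (s≤s z≤n) j≤si))
                 (Galois.from (proj₂ (M (suc i) (s≤s z≤n))) v (suc j) p (s≤s z≤n) j≤si (≤-reflexive (sym eq))))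
        where
        j≤si : suc j ≤ part nu (suc i)
        j≤si = ≤-trans (≤-reflexive (sym eq)) (Galois.bound (proj₂ (M (suc i) (s≤s z≤n))) v p)
        j≤i : suc j ≤ part nu i
        j≤i = ≤-trans j≤si (part-anti (proj₁ P) b (n≤1+n i))

-- Patterns with chains versus pairs of tableaux

module Correspondence where

  open RSK
  open TandemQueues using (sumTo; sumTo-cong)
  open Shapes
  open Sums
  open Tableaux

  mkGT : ∀ n → (ℕ → ℕ → ℕ) → GT n
  mkGT zero    f = []
  mkGT (suc n) f = mkA (suc n) (f (suc n)) ∷ mkGT n f

  getGT : ∀ {n} → GT n → ℕ → ℕ → ℕ
  getGT []      a i = 0
  getGT {suc n} (m ∷ t) a i with a ≟ suc n
  ... | yes _ = getA m i
  ... | no  _ = getGT t a i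

  getGT-top : ∀ {n} (t : GT n) i → getGT t n i ≡ getA (top t) i
  getGT-top []      i = refl
  getGT-top {suc n} (m ∷ t) i with suc n ≟ suc n
  ... | yes _ = refl
  ... | no ne = contradiction refl ne

  getGT-below : ∀ {n} m (t : GT n) {a} i → a ≤ n → getGT (m ∷ t) a i ≡ getGT t a i
  getGT-below {n} m t {a} i p with a ≟ suc n
  ... | yes refl = contradiction p (<⇒≱ ≤-refl)
  ... | no _     = refl

  top-mkGT : ∀ n f → top (mkGT n f) ≡ mkA n (f n)
  top-mkGT zero    f = refl
  top-mkGT (suc n) f = refl

  mkGT-cong : ∀ n {f g} → (∀ a i → 1 ≤ a → a ≤ n → 1 ≤ i → f a i ≡ g a i) → mkGT n f ≡ mkGT n g
  mkGT-cong zero    p = refl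
  mkGT-cong (suc n) p = cong₂ _∷_ (mkA-cong (suc n) (λ i b _ → p (suc n) i (s≤s z≤n) ≤-refl b))
                                  (mkGT-cong n (λ a i b c → p a i b (m≤n⇒m≤1+n c)))

  mkGT∘getGT : ∀ {n} (t : GT n) → mkGT n (getGT t) ≡ t
  mkGT∘getGT []      = refl
  mkGT∘getGT {suc n} (m ∷ t) = cong₂ _∷_
    (trans (mkA-cong (suc n) (λ i _ _ → getGT-top (m ∷ t) i)) (mkA∘getA m))
    (trans (mkGT-cong n (λ a i _ c _ → getGT-below m t i c)) (mkGT∘getGT t))

  getGT∘mkGT : ∀ n f a i → 1 ≤ a → a ≤ n → 1 ≤ i → i ≤ a → getGT (mkGT n f) a i ≡ f a i
  getGT∘mkGT zero f a i p q = contradiction q (<⇒≱ p)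
  getGT∘mkGT (suc n) f a i p q c d with m≤n⇒m<n∨m≡n q
  ... | inj₂ refl      = trans (getGT-top (mkGT (suc n) f) i) (getA∘mkA (suc n) (f (suc n)) i c d)
  ... | inj₁ (s≤s a≤n) = trans (getGT-below _ (mkGT n f) i a≤n) (getGT∘mkGT n f a i p a≤n c d)

  getGT-beyond : ∀ {n} (t : GT n) a i → a < i → getGT t a i ≡ 0
  getGT-beyond []      a i p = refl
  getGT-beyond {suc n} (m ∷ t) a i p with a ≟ suc n
  ... | yes refl = getA-beyond m p
  ... | no _     = getGT-beyond t a i p

  getGT-zero : ∀ {n} (t : GT n) i → getGT t 0 i ≡ 0
  getGT-zero []      i = refl
  getGT-zero {suc n} (m ∷ t) i with 0 ≟ suc n
  ... | no _ = getGT-zero t i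

  interlace-at : ∀ {a} {m : Vec ℕ (suc a)} {r} → Interlace m r → ∀ i → 1 ≤ i →
    getA r i ≤ getA m i × getA m (suc i) ≤ getA r i
  interlace-at [ x ] (suc zero)    b = z≤n , z≤n
  interlace-at [ x ] (suc (suc i)) b = z≤n , z≤n
  interlace-at (p ∷ h) (suc zero)    b = p
  interlace-at (_∷_ {ys = ys} {zs} p h) (suc (suc i)) b = interlace-at h (suc i) (s≤s z≤n)

  interlace-mk : ∀ a x y → (∀ i → 1 ≤ i → y i ≤ x i × x (suc i) ≤ y i) → Interlace (mkA (suc a) x) (mkA a y)
  interlace-mk zero    x y p = [ x 1 ]
  interlace-mk (suc a) x y p = p 1 ≤-refl ∷ interlace-mk a (x ∘ suc) (y ∘ suc) (λ i _ → p (suc i) (s≤s z≤n))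

  vert-at : ∀ {a} {x y : Vec ℕ a} → Vert x y → ∀ i → getA x i ≤ getA y i × getA y i ≤ suc (getA x i)
  vert-at []      i             = z≤n , z≤n
  vert-at (p ∷ v) zero          = z≤n , z≤n
  vert-at (p ∷ v) (suc zero)    = p
  vert-at (p ∷ v) (suc (suc i)) = vert-at v (suc i)

  vert-mk : ∀ a x y → (∀ i → 1 ≤ i → x i ≤ y i × y i ≤ suc (x i)) → Vert (mkA a x) (mkA a y)
  vert-mk zero    x y p = []
  vert-mk (suc a) x y p = p 1 ≤-refl ∷ vert-mk a (x ∘ suc) (y ∘ suc) (λ i _ → p (suc i) (s≤s z≤n))

  decr-at : ∀ {a} {x : Vec ℕ a} → Decr x → ∀ i → 1 ≤ i → getA x (suc i) ≤ getA x i
  decr-at []            i             b = z≤n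
  decr-at ([] ∷ _)      (suc i)       b = z≤n
  decr-at ([ p ] ∷ d)   (suc zero)    b = p
  decr-at ([ p ] ∷ d)   (suc (suc i)) b = decr-at d (suc i) (s≤s z≤n)

  decr-mk : ∀ a x → (∀ i → 1 ≤ i → x (suc i) ≤ x i) → Decr (mkA a x)
  decr-mk zero          x p = []
  decr-mk (suc zero)    x p = [] ∷ []
  decr-mk (suc (suc a)) x p = [ p 1 ≤-refl ] ∷ decr-mk (suc a) (x ∘ suc) (λ i _ → p (suc i) (s≤s z≤n))

  GTPair : ℕ → ℕ → Set
  GTPair n N = GT n × Vec (Vec ℕ n) N

  Good : (αs γ : List ℕ) → GTPair (length αs) (length γ) → Set
  Good αs γ (t , qs) = Valid t × Chain (top t) qs (mkV (length γ) (part γ)) × HasContent t (mkV (length αs) (part αs))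

  -- The shapes are numbered from 0 and `getV` counts from 1, hence the successor. The last shape is
  -- not stored in `qs`; it is the top row of `t`.
  getQ : ∀ {n N} → GTPair n N → ℕ → ℕ → ℕ
  getQ {n} (t , qs) v i = getA (getV (Vec.replicate n 0) (top t ∷ qs) (suc v)) i

  mkQ : ∀ n N → (ℕ → ℕ → ℕ) → Vec (Vec ℕ n) N
  mkQ n N q = mkV N (λ v → mkA n (q (pred v)))


  chains⇒good : ∀ n N {α γ f q} → Chains n N α γ f q →
    Valid (mkGT n f) × Chain (top (mkGT n f)) (mkQ n N q) (mkV N γ) × HasContent (mkGT n f) (mkV n α)
  chains⇒good n N {α} {γ} {f} {q} C =
    valid n ≤-refl , subst (λ m → Chain m (mkQ n N q) (mkV N γ)) (sym top≡) (chain N ≤-refl) , cont n ≤-refl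
    where
    open Chains C
    top≡ : top (mkGT n f) ≡ mkA n (q N)
    top≡ = trans (top-mkGT n f) (mkA-cong n (λ i a _ → same i a))
    valid : ∀ a → a ≤ n → Valid (mkGT a f)
    valid zero    p = []
    valid (suc a) p = subst (Interlace (mkA (suc a) (f (suc a)))) (sym (top-mkGT a f))
      (interlace-mk a (f (suc a)) (f a) (λ i b → f-mono a i p b , f-strip a i p b)) ∷ valid a (<⇒≤ p)
    cont : ∀ a → a ≤ n → HasContent (mkGT a f) (mkV a α)
    cont zero    p = []
    cont (suc a) p = trans (sum-mkA (suc a) (f (suc a))) (trans (f-size a p) (cong (_+ α (suc a))
      (sym (trans (cong Vec.sum (top-mkGT a f)) (sum-mkA a (f a)))))) ∷ cont a (<⇒≤ p)
    zeros : ∀ n (h : ℕ → ℕ) → (∀ i → 1 ≤ i → h i ≡ 0) → mkA n h ≡ Vec.replicate n 0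
    zeros zero    h p = refl
    zeros (suc n) h p = cong₂ _∷_ (p 1 ≤-refl) (zeros n (h ∘ suc) (λ i _ → p (suc i) (s≤s z≤n)))
    chain : ∀ v → v ≤ N → Chain (mkA n (q v)) (mkQ n v q) (mkV v γ)
    chain zero    p = subst (λ z → Chain z [] []) (sym (zeros n (q 0) q-start)) []
    chain (suc v) p =
      ( vert-mk n (q v) (q (suc v)) (λ i b → q-mono v i p b , q-strip v i p b)
      , decr-mk n (q v) (λ i b → q-decr v i (<⇒≤ p) b)
      , trans (sum-mkA n (q (suc v))) (trans (q-size v p) (cong (_+ γ (suc v)) (sym (sum-mkA n (q v))))))
      ∷ chain v (<⇒≤ p)

  sum-getA : ∀ {n} (x : Vec ℕ n) → Vec.sum x ≡ sumTo n (getA x)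
  sum-getA {n} x = trans (cong Vec.sum (sym (mkA∘getA x))) (sum-mkA n (getA x))

  valid-at : ∀ {n} {t : GT n} → Valid t → ∀ a i → a < n → 1 ≤ i →
    getGT t a i ≤ getGT t (suc a) i × getGT t (suc a) (suc i) ≤ getGT t a i
  valid-at {suc n} {m ∷ t} (h ∷ v) a i p b with m≤n⇒m<n∨m≡n p
  ... | inj₂ refl rewrite getGT-top (m ∷ t) i | getGT-top (m ∷ t) (suc i) | getGT-below m t i (≤-refl {n}) | getGT-top t i =
    interlace-at h i b
  ... | inj₁ (s≤s r) rewrite getGT-below m t i r | getGT-below m t (suc i) r | getGT-below m t i (<⇒≤ r) = valid-at v a i r b

  content-at : ∀ {n} {t : GT n} (α : ℕ → ℕ) → HasContent t (mkV n α) → ∀ a → a < n →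
    sumTo (suc a) (getGT t (suc a)) ≡ sumTo a (getGT t a) + α (suc a)
  content-at {suc n} {m ∷ t} α (e ∷ h) a p with m≤n⇒m<n∨m≡n p
  ... | inj₂ refl = begin
    sumTo (suc n) (getGT (m ∷ t) (suc n))    ≡⟨ sumTo-cong (suc n) (λ i _ _ → getGT-top (m ∷ t) i) ⟩
    sumTo (suc n) (getA m)                    ≡⟨ sym (sum-getA m) ⟩
    Vec.sum m                                 ≡⟨ e ⟩
    Vec.sum (top t) + α (suc n)               ≡⟨ cong (_+ α (suc n)) (sum-getA (top t)) ⟩
    sumTo n (getA (top t)) + α (suc n)        ≡⟨ cong (_+ α (suc n)) (sumTo-cong n (λ i _ _ → sym (trans (getGT-below m t i ≤-refl) (getGT-top t i)))) ⟩
    sumTo n (getGT (m ∷ t) n) + α (suc n)     ∎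
    where open ≡-Reasoning
  ... | inj₁ (s≤s r) = trans (sumTo-cong (suc a) (λ i _ _ → getGT-below m t i r))
    (trans (content-at α h a r) (cong (_+ α (suc a)) (sumTo-cong a (λ i _ _ → sym (getGT-below m t i (<⇒≤ r))))))

  Step : ∀ {n} → Vec ℕ n → Vec ℕ n → ℕ → Set
  Step q m g = Vert q m × Decr q × Vec.sum m ≡ Vec.sum q + g

  chain-at : ∀ {n N m} {qs : Vec (Vec ℕ n) N} {γ : ℕ → ℕ} d → Chain m qs (mkV N γ) →
    ∀ v → v < N → Step (getV d (m ∷ qs) (suc v)) (getV d (m ∷ qs) (suc (suc v))) (γ (suc v))
  chain-at {N = suc N} {m} {q ∷ qs} {γ} d (s ∷ c) v p with m≤n⇒m<n∨m≡n p
  ... | inj₂ refl rewrite getV-last d m (q ∷ qs) | getV-init d m (q ∷ qs) (≤-refl {suc N}) | getV-last d q qs = s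
  ... | inj₁ (s≤s r) rewrite getV-init d m (q ∷ qs) {suc v} (m≤n⇒m≤1+n r) | getV-init d m (q ∷ qs) {suc (suc v)} (s≤s r) =
    chain-at d c v r

  chain-start : ∀ {n N m} {qs : Vec (Vec ℕ n) N} {gs} d → Chain m qs gs → getV d (m ∷ qs) 1 ≡ Vec.replicate n 0
  chain-start d [] = refl
  chain-start {m = m} {q ∷ qs} d (_ ∷ c) = trans (getV-init d m (q ∷ qs) (s≤s z≤n)) (chain-start d c)

  good⇒chains : ∀ {n N} (α γ : ℕ → ℕ) {t : GT n} {qs : Vec (Vec ℕ n) N} →
    Valid t → Chain (top t) qs (mkV N γ) → HasContent t (mkV n α) → Chains n N α γ (getGT t) (getQ (t , qs))
  good⇒chains {n} {N} α γ {t} {qs} v c h = record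
    { f-beyond = λ a i _ → getGT-beyond t a i
    ; f-mono   = λ a i p b → proj₁ (valid-at v a i p b)
    ; f-strip  = λ a i p b → proj₂ (valid-at v a i p b)
    ; f-size   = content-at α h
    ; q-start  = λ i _ → trans (cong (λ z → getA z i) (chain-start d c)) (zeros n i)
    ; q-mono   = λ u i p _ → proj₁ (vert-at (proj₁ (chain-at d c u p)) i)
    ; q-strip  = λ u i p _ → proj₂ (vert-at (proj₁ (chain-at d c u p)) i)
    ; q-decr   = decr
    ; q-size   = λ u p → trans (sym (sum-getA (getV d (top t ∷ qs) (suc (suc u))))) (trans (proj₂ (proj₂ (chain-at d c u p))) (cong (_+ γ (suc u)) (sum-getA (getV d (top t ∷ qs) (suc u)))))
    ; same     = λ i _ → trans (getGT-top t i) (cong (λ z → getA z i) (sym (getV-last d (top t) qs)))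
    }
    where
    d = Vec.replicate n 0
    zeros : ∀ n i → getA (Vec.replicate n 0) i ≡ 0
    zeros zero    i = refl
    zeros (suc n) zero = refl
    zeros (suc n) (suc zero) = refl
    zeros (suc n) (suc (suc i)) = zeros n (suc i)
    decr : ∀ u i → u ≤ N → 1 ≤ i → getQ (t , qs) u (suc i) ≤ getQ (t , qs) u i
    decr u i p b with m≤n⇒m<n∨m≡n p
    ... | inj₁ r    = decr-at (proj₁ (proj₂ (chain-at d c u r))) i b
    ... | inj₂ refl rewrite getV-last d (top t) qs = decr-at (top-decr v) i b

  -- Shapes in patterns are padded with zeros to a fixed length, whereas a partition as a list has
  -- positive parts.
  trim : ℕ → (ℕ → ℕ) → List ℕ
  trim zero    u = []
  trim (suc n) u with u 1
  ... | zero  = []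
  ... | suc x = suc x ∷ trim n (u ∘ suc)

  module _ where
    private
      Descending : (ℕ → ℕ) → Set
      Descending u = ∀ i → 1 ≤ i → u (suc i) ≤ u i

    trim-part : ∀ n u → Descending u → (∀ i → n < i → u i ≡ 0) → ∀ i → 1 ≤ i → part (trim n u) i ≡ u i
    trim-part zero    u d z i a = sym (z i a)
    trim-part (suc n) u d z i a with u 1 in eq
    ... | zero  = sym (n≤0⇒n≡0 (≤-trans (low i a) (≤-reflexive eq)))
      where
      low : ∀ i → 1 ≤ i → u i ≤ u 1
      low (suc zero)    a = ≤-refl
      low (suc (suc i)) a = ≤-trans (d (suc i) (s≤s z≤n)) (low (suc i) (s≤s z≤n))
    trim-part (suc n) u d z (suc zero)    a | suc x = sym eq
    trim-part (suc n) u d z (suc (suc i)) a | suc x =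
      trim-part n (u ∘ suc) (λ i _ → d (suc i) (s≤s z≤n)) (λ i p → z (suc i) (s≤s p)) (suc i) (s≤s z≤n)

    trim-partition : ∀ n u → Descending u → IsPartition (trim n u)
    trim-partition zero    u d = [] , []
    trim-partition (suc n) u d with u 1 in eq
    ... | zero  = [] , []
    ... | suc x with trim-partition n (u ∘ suc) (λ i _ → d (suc i) (s≤s z≤n))
    ...   | l , a = link n l , s≤s z≤n ∷ a
      where
      link : ∀ n → Linked _≥_ (trim n (u ∘ suc)) → Linked _≥_ (suc x ∷ trim n (u ∘ suc))
      link zero    l = [-]
      link (suc n) l with u 2 in eq₂
      ... | zero  = [-]
      ... | suc y = ≤-trans (≤-reflexive (sym eq₂)) (≤-trans (d 1 ≤-refl) (≤-reflexive eq)) ∷ l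

  -- The maps are defined on the whole ambient types and are inverse to each other on the two
  -- subsets. No proofs enter the elements, so lists of them can be compared.
  record _≃_ {A B : Set} (P : A → Set) (Q : B → Set) : Set where
    field
      to      : A → B
      from    : B → A
      to-⊢    : ∀ {a} → P a → Q (to a)
      from-⊢  : ∀ {b} → Q b → P (from b)
      from∘to : ∀ {a} → P a → from (to a) ≡ a
      to∘from : ∀ {b} → Q b → to (from b) ≡ b

  ≃-trans : ∀ {A B C : Set} {P : A → Set} {Q : B → Set} {R : C → Set} → P ≃ Q → Q ≃ R → P ≃ R
  ≃-trans I J = record
    { to      = J.to ∘ I.to
    ; from    = I.from ∘ J.from
    ; to-⊢    = J.to-⊢ ∘ I.to-⊢
    ; from-⊢  = I.from-⊢ ∘ J.from-⊢
    ; from∘to = λ p → trans (cong I.from (J.from∘to (I.to-⊢ p))) (I.from∘to p)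
    ; to∘from = λ q → trans (cong J.to (I.to∘from (J.from-⊢ q))) (J.to∘from q)
    }
    where
    module I = _≃_ I
    module J = _≃_ J

  galois-cong : ∀ {n L g g′ f f′} → Galois n L g f → (∀ j → 1 ≤ j → j ≤ L → g j ≡ g′ j) → (∀ a → a ≤ n → f a ≡ f′ a) → Galois n L g′ f′
  galois-cong {n} {L} {g} {g′} {f} {f′} G p q = record
    { to    = λ a j r x y z → subst (j ≤_) (q a r) (to a j r x y (subst (_≤ a) (sym (p j x y)) z))
    ; from  = λ a j r x y z → subst (_≤ a) (p j x y) (from a j r x y (subst (j ≤_) (sym (q a r)) z))
    ; bound = λ a r → subst (_≤ L) (q a r) (bound a r)
    ; start = trans (sym (q 0 z≤n)) start
    ; end   = trans (sym (q n ≤-refl)) end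
    }
    where open Galois G

  module Triples (αs γ : List ℕ) where
    private
      n N : ℕ
      n = length αs
      N = length γ

    Triple : Set
    Triple = List ℕ × Filling × Filling

    IsTriple : Triple → Set
    IsTriple (nu , Q , T) = IsPartition nu × Q ∈ SSYT (conj nu) γ × T ∈ SSYT nu αs

    shape : GTPair n N → List ℕ
    shape (t , qs) = trim n (getGT t n)

    gridT gridQ : GTPair n N → ℕ → ℕ → ℕ
    gridT (t , qs) i j = inverseOf n (λ a → getGT t a i) j
    gridQ x        j i = inverseOf N (λ v → getQ x v i) j

    toTriple : GTPair n N → Triple
    toTriple x = shape x , mk (conj (shape x)) [] (gridQ x) , mk (shape x) [] (gridT x)

    chainT chainQ : Triple → ℕ → ℕ → ℕ
    chainT (nu , Q , T) a i = cumulative (part nu i) (λ j → entry [] T (i , j)) a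
    chainQ (nu , Q , T) v i = cumulative (part nu i) (λ j → entry [] Q (j , i)) v

    fromTriple : Triple → GTPair n N
    fromTriple y = mkGT n (chainT y) , mkQ n N (chainQ y)

    module _ {x : GTPair n N} (g : Good αs γ x) where
      private
        t  = proj₁ x
        nu = shape x

      chains : Chains n N (part αs) (part γ) (getGT t) (getQ x)
      chains = good⇒chains (part αs) (part γ) (proj₁ g) (proj₁ (proj₂ g)) (proj₂ (proj₂ g))
      open Chains chains

      private
        decr : ∀ i → 1 ≤ i → getGT t n (suc i) ≤ getGT t n i
        decr i a = subst₂ _≤_ (sym (same (suc i) (s≤s z≤n))) (sym (same i a)) (q-decr N i ≤-refl a)

      shape-partition : IsPartition nu
      shape-partition = trim-partition n (getGT t n) decr

      shape-part : ∀ i → 1 ≤ i → part nu i ≡ getGT t n i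
      shape-part = trim-part n (getGT t n) decr (λ i → f-beyond n i ≤-refl)

      good-match : Match {α = αs} {γ} shape-partition {gridT x} {gridQ x} {getGT t} {getQ x}
      good-match i a =
        galois-inverse (λ b p → f-mono b i p a) (getGT-zero t i) (sym (shape-part i a)) ,
        galois-inverse (λ b p → q-mono b i p a) (q-start i a) (trans (sym (same i a)) (sym (shape-part i a)))

      private
        pair = chains⇒pair {α = αs} {γ} shape-partition good-match chains
      open Pair pair

      toTriple-⊢ : IsTriple (toTriple x)
      toTriple-⊢ = shape-partition , SSYT⁺ (conj-partition shape-partition) fillsQ stdQ , SSYT⁺ shape-partition fillsT stdT

      private
        in-conj : ∀ {i j} → 1 ≤ i → 1 ≤ j → j ≤ part nu i → InShape (conj nu) [] (j , i)
        in-conj a b c = a , conj⁻ (proj₁ shape-partition) a b c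
        entT : ∀ i j → 1 ≤ j → j ≤ part nu i → gridT x i j ≡ entry [] (mk nu [] (gridT x)) (i , j)
        entT i j a b = sym (entry-mk nu [] (gridT x) (a , b))
        entQ : ∀ i j → 1 ≤ i → 1 ≤ j → j ≤ part nu i → gridQ x j i ≡ entry [] (mk (conj nu) [] (gridQ x)) (j , i)
        entQ i j a b c = sym (entry-mk (conj nu) [] (gridQ x) (in-conj a b c))
        cumul : ∀ {n L g f} → Galois n L g f → ∀ h → (∀ j → 1 ≤ j → j ≤ L → g j ≡ h j) → ∀ a → a ≤ n → cumulative L h a ≡ f a
        cumul {L = L} G h p a q = galois-unique-f
          (galois-cumulative (galois-range G′) (galois-sorted G′)) G′ a q
          where G′ = galois-cong G p (λ _ _ → refl)

      fromTriple∘toTriple : fromTriple (toTriple x) ≡ x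
      fromTriple∘toTriple = cong₂ _,_
        (trans (mkGT-cong n (λ a i _ q c → cumul (proj₁ (good-match i c)) (λ j → entry [] (mk nu [] (gridT x)) (i , j)) (entT i) a q))
               (mkGT∘getGT t))
        (trans (mkV-cong N (λ { (suc v) a b → trans (mkA-cong n (λ i c _ →
                  cumul (proj₂ (good-match i c)) (λ j → entry [] (mk (conj nu) [] (gridQ x)) (j , i)) (λ j → entQ i j c) v (<⇒≤ b)))
                  (trans (mkA∘getA (getV (Vec.replicate n 0) (top t ∷ proj₂ x) (suc v))) (getV-init (Vec.replicate n 0) (top t) (proj₂ x) b)) }))
               (mkV∘getV (Vec.replicate n 0) (proj₂ x)))

    module _ {nu Q T} (y : IsTriple (nu , Q , T)) where
      private
        P  = proj₁ y
        Q∈ = SSYT⁻ (conj-partition P) (proj₁ (proj₂ y))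
        T∈ = SSYT⁻ P (proj₂ (proj₂ y))
        gT gQ f q : ℕ → ℕ → ℕ
        gT i j = entry [] T (i , j)
        gQ j i = entry [] Q (j , i)
        f = chainT (nu , Q , T)
        q = chainQ (nu , Q , T)
        in-conj : ∀ {i j} → 1 ≤ i → 1 ≤ j → j ≤ part nu i → InShape (conj nu) [] (j , i)
        in-conj a b c = a , conj⁻ (proj₁ P) a b c

      triple-match : Match {α = αs} {γ} P {gT} {gQ} {f} {q}
      triple-match i a =
        galois-cumulative (λ j b c → Fills.bounded (proj₁ (proj₂ T∈)) (b , c))
          (λ j b c → SemiStd.row (proj₂ (proj₂ T∈)) (b , <⇒≤ c) (s≤s z≤n , c)) ,
        galois-cumulative (λ j b c → Fills.bounded (proj₁ (proj₂ Q∈)) (in-conj a b c))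
          (λ j b c → <⇒≤ (SemiStd.col (proj₂ (proj₂ Q∈)) (in-conj a b (<⇒≤ c)) (in-conj a (s≤s z≤n) c)))

      triple-chains : Chains n N (part αs) (part γ) f q
      triple-chains = pair⇒chains P triple-match record
        { fillsT = proj₁ (proj₂ T∈) ; stdT = proj₂ (proj₂ T∈) ; fillsQ = proj₁ (proj₂ Q∈) ; stdQ = proj₂ (proj₂ Q∈) }
      open Chains triple-chains

      fromTriple-⊢ : Good αs γ (fromTriple (nu , Q , T))
      fromTriple-⊢ = chains⇒good n N triple-chains

      private
        x = fromTriple (nu , Q , T)
        t = mkGT n f
        d = Vec.replicate n 0
        f-eq : ∀ a i → a ≤ n → 1 ≤ i → getGT t a i ≡ f a i
        f-eq zero    i p b = trans (getGT-zero t i) (sym (Galois.start (proj₁ (triple-match i b))))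
        f-eq (suc a) i p b with i ≤? suc a
        ... | yes r = getGT∘mkGT n f (suc a) i (s≤s z≤n) p b r
        ... | no  r = trans (getGT-beyond t (suc a) i (≰⇒> r)) (sym (f-beyond (suc a) i p (≰⇒> r)))
        nu-beyond : ∀ i → n < i → part nu i ≡ 0
        nu-beyond i p = trans (sym (Galois.end (proj₁ (triple-match i (≤-trans (s≤s z≤n) p))))) (f-beyond n i ≤-refl p)
        getA-q : ∀ v i → v ≤ N → 1 ≤ i → getA (mkA n (q v)) i ≡ q v i
        getA-q v i p b with i ≤? n
        ... | yes r = getA∘mkA n (q v) i b r
        ... | no  r = trans (getA-beyond (mkA n (q v)) (≰⇒> r)) (sym (n≤0⇒n≡0
          (≤-trans (Galois.bound (proj₂ (triple-match i b)) v p) (≤-reflexive (nu-beyond i (≰⇒> r))))))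
        q-eq : ∀ v i → v ≤ N → 1 ≤ i → getQ x v i ≡ q v i
        q-eq v i p b with m≤n⇒m<n∨m≡n p
        ... | inj₁ r = trans (cong (λ z → getA z i) (trans (getV-init d (top t) (mkQ n N q) r) (getV∘mkV N d _ (suc v) (s≤s z≤n) r))) (getA-q v i p b)
        ... | inj₂ refl = trans (cong (λ z → getA z i) (trans (getV-last d (top t) (mkQ n N q)) (top-mkGT n f)))
          (trans (getA-f i b) (same i b))
          where
          getA-f : ∀ i → 1 ≤ i → getA (mkA n (f n)) i ≡ f n i
          getA-f i b with i ≤? n
          ... | yes r = getA∘mkA n (f n) i b r
          ... | no  r = trans (getA-beyond (mkA n (f n)) (≰⇒> r)) (sym (f-beyond n i ≤-refl (≰⇒> r)))
        nu-eq : shape x ≡ nu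
        nu-eq = partition-ext (shape-partition fromTriple-⊢) P (λ i b →
          trans (shape-part fromTriple-⊢ i b) (trans (f-eq n i ≤-refl b) (Galois.end (proj₁ (triple-match i b)))))
        M = good-match fromTriple-⊢
        T-eq : ∀ i j → 1 ≤ i → 1 ≤ j → j ≤ part nu i → gridT x i j ≡ gT i j
        T-eq i j a b c = galois-unique-g
          (galois-cong (subst (λ z → Galois n (part z i) (gridT x i) (λ a → getGT t a i)) nu-eq (proj₁ (M i a))) (λ _ _ _ → refl) (λ b p → f-eq b i p a))
          (proj₁ (triple-match i a)) j b c
        Q-eq : ∀ i j → 1 ≤ i → 1 ≤ j → j ≤ part nu i → gridQ x j i ≡ gQ j i
        Q-eq i j a b c = galois-unique-g
          (galois-cong (subst (λ z → Galois N (part z i) (λ j → gridQ x j i) (λ v → getQ x v i)) nu-eq (proj₂ (M i a))) (λ _ _ _ → refl) (λ b p → q-eq b i p a))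
          (proj₂ (triple-match i a)) j b c

      toTriple∘fromTriple : toTriple x ≡ (nu , Q , T)
      toTriple∘fromTriple = cong₂ _,_ nu-eq (cong₂ _,_
        (trans (cong (λ z → mk (conj z) [] (gridQ x)) nu-eq) (trans (mk-cong (conj nu) [] (λ {j} {i} h →
           let a = proj₁ h ; b = proj₁ (inShape-row (conj nu) [] {j} {i} h) in Q-eq i j a b (conj⁺ (proj₁ P) a b (proj₂ h)))) (proj₁ Q∈)))
        (trans (cong (λ z → mk z [] (gridT x)) nu-eq) (trans (mk-cong nu [] (λ {i} {j} h →
           T-eq i j (proj₁ (inShape-row nu [] {i} {j} h)) (proj₁ h) (proj₂ h))) (proj₁ T∈))))

    good≃triple : Good αs γ ≃ IsTriple
    good≃triple = record
      { to = toTriple ; from = fromTriple ; to-⊢ = toTriple-⊢ ; from-⊢ = fromTriple-⊢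
      ; from∘to = fromTriple∘toTriple ; to∘from = toTriple∘fromTriple }

-- The reading word of a tableau from its pattern

module ReadingWords where

  open RSK
  open Plactic using (rowWord; readingWord; row₁; lower)
  open Shapes
  open Sums
  open Tableaux
  open Correspondence

  rowsUp : ℕ → (ℕ → Word) → Word
  rowsUp zero    r = []
  rowsUp (suc n) r = rowsUp n (r ∘ suc) ++ r 0

  rw-rowsUp : ∀ (r : ℕ → Word) (h : ℕ → ℕ) n → rw (map r (applyUpTo h n)) ≡ rowsUp n (r ∘ h)
  rw-rowsUp r h zero    = refl
  rw-rowsUp r h (suc n) = begin
    concat (reverse (r (h 0) ∷ F))       ≡⟨ cong concat (unfold-reverse (r (h 0)) F) ⟩
    concat (reverse F ++ r (h 0) ∷ [])   ≡⟨ sym (concat-++ (reverse F) _) ⟩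
    rw F ++ r (h 0) ++ []                ≡⟨ cong₂ _++_ (rw-rowsUp r (h ∘ suc) n) (++-identityʳ (r (h 0))) ⟩
    rowsUp n (r ∘ h ∘ suc) ++ r (h 0)    ∎
    where
    open ≡-Reasoning
    F : Filling
    F = map r (applyUpTo (h ∘ suc) n)

  rowsUp-extend : ∀ {m n} r → m ≤ n → (∀ i → m ≤ i → r i ≡ []) → rowsUp n r ≡ rowsUp m r
  rowsUp-extend {zero}  {zero}  r p z = refl
  rowsUp-extend {zero}  {suc n} r p z = trans (cong₂ _++_ (rowsUp-extend {n = n} (r ∘ suc) z≤n (λ i _ → z (suc i) z≤n)) (z 0 z≤n)) refl
  rowsUp-extend {suc m} {suc n} r (s≤s p) z = cong (_++ r 0) (rowsUp-extend (r ∘ suc) p (λ i q → z (suc i) (s≤s q)))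

  map-[1⋯]-const : ∀ (g : ℕ → ℕ) {x y c} → x ≤ y → (∀ j → x < j → j ≤ y → g j ≡ c) →
    map g [1⋯ y ] ≡ map g [1⋯ x ] ++ replicate (y ∸ x) c
  map-[1⋯]-const g {x} {zero}  {c} p q with refl ← n≤0⇒n≡0 p = refl
  map-[1⋯]-const g {x} {suc y} {c} p q with m≤n⇒m<n∨m≡n p
  ... | inj₂ refl rewrite n∸n≡0 y = sym (++-identityʳ _)
  ... | inj₁ (s≤s x≤y) = begin
    map g [1⋯ suc y ]                                 ≡⟨ cong (map g) (sym (applyUpTo-∷ʳ suc y)) ⟩
    map g ([1⋯ y ] ++ suc y ∷ [])                     ≡⟨ map-++ g [1⋯ y ] _ ⟩
    map g [1⋯ y ] ++ g (suc y) ∷ []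
      ≡⟨ cong₂ (λ u v → u ++ v ∷ []) (map-[1⋯]-const g x≤y (λ j a b → q j a (m≤n⇒m≤1+n b))) (q (suc y) (s≤s x≤y) ≤-refl) ⟩
    (map g [1⋯ x ] ++ replicate (y ∸ x) c) ++ c ∷ []  ≡⟨ ++-assoc (map g [1⋯ x ]) _ _ ⟩
    map g [1⋯ x ] ++ replicate (y ∸ x) c ++ c ∷ []    ≡⟨ cong (map g [1⋯ x ] ++_) (snoc (y ∸ x)) ⟩
    map g [1⋯ x ] ++ replicate (suc (y ∸ x)) c        ≡⟨ cong (λ d → map g [1⋯ x ] ++ replicate d c) (sym (+-∸-assoc 1 x≤y)) ⟩
    map g [1⋯ x ] ++ replicate (suc y ∸ x) c          ∎
    where
    open ≡-Reasoning
    snoc : ∀ d → replicate d c ++ c ∷ [] ≡ replicate (suc d) c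
    snoc zero    = refl
    snoc (suc d) = cong (c ∷_) (snoc d)

  -- A row whose letters all exceed `k`, with the letters lowered by `k`: `h a` counts the letters
  -- up to a + k.
  Row′ : (n k : ℕ) (g h : ℕ → ℕ) → Set
  Row′ n k g h = Galois n (h n) (λ j → g j ∸ k) h × (∀ j → 1 ≤ j → j ≤ h n → k < g j)

  rowWord-mkV : ∀ {n k g h} → Row′ n k g h → ∀ a → a ≤ n → rowWord k (mkV a h) ≡ map g [1⋯ h a ]
  rowWord-mkV {n} {k} {g} {h} (G , low) = go
    where
    open Galois G
    const : ∀ a → a < n → ∀ j → h a < j → j ≤ h (suc a) → g j ≡ suc (a + k)
    const a p j q r = begin
      g j           ≡⟨ sym (m∸n+n≡m (<⇒≤ (low j 1≤j j≤))) ⟩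
      g j ∸ k + k   ≡⟨ cong (_+ k) (≤-antisym (from (suc a) j p 1≤j j≤ r) (≰⇒> (λ le → contradiction (to a j (<⇒≤ p) 1≤j j≤ le) (<⇒≱ q)))) ⟩
      suc (a + k)   ∎
      where
      open ≡-Reasoning
      1≤j : 1 ≤ j
      1≤j = ≤-trans (s≤s z≤n) q
      j≤ : j ≤ h n
      j≤ = ≤-trans r (bound (suc a) p)
    go : ∀ a → a ≤ n → rowWord k (mkV a h) ≡ map g [1⋯ h a ]
    go zero p rewrite start = refl
    go (suc zero) p = sym (trans (map-[1⋯]-const g {h 0} {h 1} (galois-mono G 0 p) (const 0 p))
      (trans (cong (λ z → map g [1⋯ z ] ++ replicate (h 1 ∸ z) (suc k)) start) refl))
    go (suc (suc a)) p = trans (cong (_++ replicate (h (suc (suc a)) ∸ h (suc a)) (suc (suc (a + k)))) (go (suc a) (<⇒≤ p)))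
      (sym (map-[1⋯]-const g (galois-mono G (suc a) p) (const (suc a) p)))

  lower-mkGT : ∀ n f → lower (mkGT (suc n) f) ≡ mkGT n (λ a i → f (suc a) (suc i))
  lower-mkGT zero    f = refl
  lower-mkGT (suc n) f = cong (mkA (suc n) (f (suc (suc n)) ∘ suc) ∷_) (lower-mkGT n f)

  row₁-mkGT : ∀ n f → row₁ (mkGT n f) ≡ mkV n (λ a → f a 1)
  row₁-mkGT zero    f = refl
  row₁-mkGT (suc n) f = cong (f (suc n) 1 ∷_) (row₁-mkGT n f)

  -- Removing the first row raises `k` by one. The vanishing of `f` above the diagonal says that the
  -- next row contains no letter k + 1, as the raised bound demands.
  readingWord-mkGT : ∀ n k f (g : ℕ → ℕ → ℕ) → (∀ i → i < n → Row′ n k (g i) (λ a → f a (suc i))) → 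
    (∀ a i → a ≤ n → a < i → f a i ≡ 0) →
    readingWord k (mkGT n f) ≡ rowsUp n (λ i → map (g i) [1⋯ f n (suc i) ])
  readingWord-mkGT zero    k f g r z = refl
  readingWord-mkGT (suc n) k f g r z = cong₂ _++_
    (trans (cong (readingWord (suc k)) (lower-mkGT n f))
           (readingWord-mkGT n (suc k) (λ a i → f (suc a) (suc i)) (g ∘ suc) shift (λ a i p q → z (suc a) (suc i) (s≤s p) (s≤s q))))
    (trans (cong (rowWord k) (row₁-mkGT (suc n) f)) (rowWord-mkV (r 0 (s≤s z≤n)) (suc n) ≤-refl))
    where
    shift : ∀ i → i < n → Row′ n (suc k) (g (suc i)) (λ a → f (suc a) (suc (suc i)))
    shift i p = record
      { to    = λ a j q b c h → to (suc a) j (s≤s q) b c (ascend (low j b c) h)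
      ; from  = λ a j q b c h → descend (low j b c) (from (suc a) j (s≤s q) b c h)
      ; bound = λ a q → bound (suc a) (s≤s q)
      ; start = first
      ; end   = refl } , λ j b c → ≤∧≢⇒< (low j b c) λ eq →
          contradiction (to 1 j (s≤s z≤n) b c (≤-reflexive (trans (cong (_∸ k) (sym eq)) (m+n∸n≡m 1 k)))) (<⇒≱ (≤-<-trans (≤-reflexive first) b))
      where
      open Galois (proj₁ (r (suc i) (s≤s p)))
      low = proj₂ (r (suc i) (s≤s p))
      first : f 1 (suc (suc i)) ≡ 0
      first = z 1 (suc (suc i)) (s≤s z≤n) (s≤s (s≤s z≤n))
      ascend : ∀ {x a} → k < x → x ∸ suc k ≤ a → x ∸ k ≤ suc a
      ascend {x} q h = ≤-trans (≤-reflexive (+-cancelʳ-≡ k _ _ (trans (m∸n+n≡m (<⇒≤ q)) (trans (sym (m∸n+n≡m q)) (+-suc (x ∸ suc k) k))))) (s≤s h)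
      descend : ∀ {x a} → k < x → x ∸ k ≤ suc a → x ∸ suc k ≤ a
      descend {x} q h = ≤-pred (≤-trans (≤-reflexive (+-cancelʳ-≡ k _ _ (trans (sym (+-suc (x ∸ suc k) k)) (trans (m∸n+n≡m q) (sym (m∸n+n≡m (<⇒≤ q))))))) h)

  module _ (αs γ : List ℕ) where
    open Triples αs γ

    rw-toTriple : ∀ {x} → Good αs γ x → rw (proj₂ (proj₂ (toTriple x))) ≡ readingWord 0 (proj₁ x)
    rw-toTriple {x@(t , qs)} g = begin
      rw (mk nu [] (gridT x))                           ≡⟨ rw-rowsUp (mkRow nu [] (gridT x)) suc (length nu) ⟩
      rowsUp (length nu) (mkRow nu [] (gridT x) ∘ suc)  ≡⟨ sym (rowsUp-extend (mkRow nu [] (gridT x) ∘ suc) len (λ i p →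
        cong (λ l → map (gridT x (suc i)) [1⋯ l ]) (part-beyond {nu} (s≤s p)))) ⟩
      rowsUp n (mkRow nu [] (gridT x) ∘ suc)            ≡⟨ rowsUp-cong n (λ i → cong (λ l → map (gridT x (suc i)) [1⋯ l ]) (shape-part g (suc i) (s≤s z≤n))) ⟩
      rowsUp n (λ i → map (gridT x (suc i)) [1⋯ getGT t n (suc i) ]) ≡⟨ sym (readingWord-mkGT n 0 (getGT t) (gridT x ∘ suc) rows f-beyond) ⟩
      readingWord 0 (mkGT n (getGT t))                  ≡⟨ cong (readingWord 0) (mkGT∘getGT t) ⟩
      readingWord 0 t                                   ∎
      where
      open ≡-Reasoning
      open Chains (chains g)
      n : ℕ
      n = length αs
      nu : List ℕ
      nu = shape x
      rowsUp-cong : ∀ n {r r′ : ℕ → Word} → (∀ i → r i ≡ r′ i) → rowsUp n r ≡ rowsUp n r′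
      rowsUp-cong zero    p = refl
      rowsUp-cong (suc n) p = cong₂ _++_ (rowsUp-cong n (p ∘ suc)) (p 0)
      len : length nu ≤ n
      len with length nu ≤? n
      ... | yes p = p
      ... | no  p = contradiction (trans (shape-part g (length nu) (≤-trans (s≤s z≤n) (≰⇒> p))) (f-beyond n (length nu) ≤-refl (≰⇒> p)))
                      (>⇒≢ (partition-pos (shape-partition g) (≤-trans (s≤s z≤n) (≰⇒> p)) ≤-refl))
      rows : ∀ i → i < n → Row′ n 0 (gridT x (suc i)) (λ a → getGT t a (suc i))
      rows i p = subst (λ l → Galois n l (gridT x (suc i)) (λ a → getGT t a (suc i))) (shape-part g (suc i) (s≤s z≤n)) (proj₁ (good-match g (suc i) (s≤s z≤n)))
        , λ j _ _ → s≤s z≤n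

-- Coinversion-free fillings from the sets of their columns

module CoinversionFree where

  open RSK
  open TandemQueues using (sumTo; sumTo-cong; sumTo-⊕; sumTo-zero; when)
  open Markings using (when-yes; when-no)
  open ChargeWords
    using (when-cong; filter-cong-∈; sum-filter; ∈-[1⋯]⁻; ∈-[1⋯]⁺; sum-[1⋯]; at-map-[1⋯]; unique-↭;
           [1⋯]-unique; count-∷; count⇒∈; ∈⇒count)
  open Shapes
  open Sums
  open Correspondence using (_≃_; Good)

  -- For fixed a, `Inversion a x y` says that x precedes y in the cyclic order a, a - 1, ..., a + 1.
  -- This lemma and the following ones make it a strict total order.
  inversion-trans : ∀ {a x y z} → Inversion a x y → Inversion a y z → Inversion a x z
  inversion-trans (inj₁ (p , q))        (inj₁ (r , s))        = contradiction r (<⇒≱ q)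
  inversion-trans (inj₁ (p , q))        (inj₂ (inj₁ (r , s))) = inj₁ (p , r)
  inversion-trans (inj₁ (p , q))        (inj₂ (inj₂ (r , s))) = contradiction s (<⇒≱ q)
  inversion-trans (inj₂ (inj₁ (p , q))) (inj₁ (r , s))        = contradiction r (<⇒≱ p)
  inversion-trans (inj₂ (inj₁ (p , q))) (inj₂ (inj₁ (r , s))) = inj₂ (inj₁ (r , <-trans s q))
  inversion-trans (inj₂ (inj₁ (p , q))) (inj₂ (inj₂ (r , s))) = contradiction s (<⇒≱ p)
  inversion-trans (inj₂ (inj₂ (p , q))) (inj₁ (r , s))        = inj₁ (q , s)
  inversion-trans (inj₂ (inj₂ (p , q))) (inj₂ (inj₁ (r , s))) = contradiction (<-trans (<-trans s p) (≤-<-trans q r)) (<-irrefl refl)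
  inversion-trans (inj₂ (inj₂ (p , q))) (inj₂ (inj₂ (r , s))) = inj₂ (inj₂ (<-trans r p , q))

  inversion-total : ∀ {a x y} → x ≢ y → ¬ Inversion a x y → Inversion a y x
  inversion-total {a} {x} {y} ne n with x ≤? a | y ≤? a | <-cmp x y
  ... | _     | _     | tri≈ _ p _ = contradiction p ne
  ... | yes p | yes q | tri< r _ _ = inj₂ (inj₂ (r , q))
  ... | yes p | yes q | tri> _ _ r = contradiction (inj₂ (inj₂ (r , p))) n
  ... | yes p | no  q | _          = contradiction (inj₁ (p , ≰⇒> q)) n
  ... | no  p | yes q | _          = inj₁ (q , ≰⇒> p)
  ... | no  p | no  q | tri< r _ _ = inj₂ (inj₁ (≰⇒> p , r))
  ... | no  p | no  q | tri> _ _ r = contradiction (inj₂ (inj₁ (≰⇒> q , r))) n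

  inversion-≢ : ∀ {a x y} → Inversion a x y → x ≢ y
  inversion-≢ (inj₁ (p , q))        refl = contradiction p (<⇒≱ q)
  inversion-≢ (inj₂ (inj₁ (p , q))) refl = <-irrefl refl q
  inversion-≢ (inj₂ (inj₂ (p , q))) refl = <-irrefl refl p

  inversion-asym : ∀ {a x y} → Inversion a x y → ¬ Inversion a y x
  inversion-asym p q = inversion-≢ (inversion-trans p q) refl

  data Greedy : List ℕ → List ℕ → Set where
    []  : Greedy [] []
    _∷_ : ∀ {a b as bs} → All (Inversion a b) bs → Greedy as bs → Greedy (a ∷ as) (b ∷ bs)

  -- If the first entries differed, each would occur later in the other column, and each would
  -- precede the other.
  greedy-unique : ∀ {as bs cs} → Greedy as bs → Greedy as cs → bs ↭ cs → bs ≡ cs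
  greedy-unique []      []      p = refl
  greedy-unique {bs = b ∷ bs} {c ∷ cs} (x ∷ g) (y ∷ h) p with b ≟ c
  ... | yes refl = cong (b ∷_) (greedy-unique g h (↭ₚ.drop-∷ p))
  ... | no ne with ↭ₚ.∈-resp-↭ p (here refl) | ↭ₚ.∈-resp-↭ (↭-sym p) (here refl)
  ...   | here eq  | _        = contradiction eq ne
  ...   | there _  | here eq  = contradiction (sym eq) ne
  ...   | there b∈ | there c∈ = contradiction (All.lookup y b∈) (inversion-asym (All.lookup x c∈))

  pickFirst : ℕ → ℕ → List ℕ → ℕ × List ℕ
  pickFirst a x []      = x , []
  pickFirst a x (y ∷ C) with pickFirst a y C
  ... | b , C′ with inversion? a x b
  ...   | yes _ = x , b ∷ C′
  ...   | no  _ = b , x ∷ C′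

  pickFirst-↭ : ∀ a x C → x ∷ C ↭ proj₁ (pickFirst a x C) ∷ proj₂ (pickFirst a x C)
  pickFirst-↭ a x []      = ↭-refl
  pickFirst-↭ a x (y ∷ C) with pickFirst a y C | pickFirst-↭ a y C
  ... | b , C′ | p with inversion? a x b
  ...   | yes _ = ↭-prep x p
  ...   | no  _ = ↭-trans (↭-prep x p) (↭-swap x b ↭-refl)

  pickFirst-first : ∀ a x C → Unique (x ∷ C) → All (Inversion a (proj₁ (pickFirst a x C))) (proj₂ (pickFirst a x C))
  pickFirst-first a x []      u = []
  pickFirst-first a x (y ∷ C) (n ∷ u) with pickFirst a y C | pickFirst-first a y C u | pickFirst-↭ a y C
  ... | b , C′ | p | q with inversion? a x b
  ...   | yes i = i ∷ All.map (inversion-trans i) p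
  ...   | no ¬i = inversion-total (λ eq → All.lookup n (↭ₚ.∈-resp-↭ (↭-sym q) (here eq)) refl) ¬i ∷ p

  arrange : List ℕ → List ℕ → List ℕ
  arrange []       C       = []
  arrange (a ∷ as) []      = []
  arrange (a ∷ as) (x ∷ C) = proj₁ (pickFirst a x C) ∷ arrange as (proj₂ (pickFirst a x C))

  arrange-↭ : ∀ as C → length as ≡ length C → C ↭ arrange as C
  arrange-↭ []       []      p = ↭-refl
  arrange-↭ (a ∷ as) (x ∷ C) p = ↭-trans (pickFirst-↭ a x C) (↭-prep _ (arrange-↭ as _
    (suc-injective (trans p (↭ₚ.↭-length (pickFirst-↭ a x C))))))

  arrange-greedy : ∀ as C → Unique C → length as ≡ length C → Greedy as (arrange as C)
  arrange-greedy []       []      u p = []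
  arrange-greedy (a ∷ as) (x ∷ C) u p =
    ↭ₚ.All-resp-↭ (arrange-↭ as _ l) (pickFirst-first a x C u)
    ∷ arrange-greedy as _ (AllPairs.tail (↭ₛ.Unique-resp-↭ (setoid ℕ) (↭⇒↭ₛ (pickFirst-↭ a x C)) u)) l
    where l = suc-injective (trans p (↭ₚ.↭-length (pickFirst-↭ a x C)))

  module _ (x y : ℕ → ℕ) where

    greedy-map⁺ : ∀ n → (∀ k k′ → 1 ≤ k → k < k′ → k′ ≤ n → Inversion (x k) (y k) (y k′)) →
                  Greedy (map x [1⋯ n ]) (map y [1⋯ n ])
    greedy-map⁺ n p = go suc n (λ i i′ q r → p (suc i) (suc i′) (s≤s z≤n) (s≤s q) r) 
      where
      go : ∀ h n → (∀ i i′ → i < i′ → i′ < n → Inversion (x (h i)) (y (h i)) (y (h i′))) →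
           Greedy (map x (applyUpTo h n)) (map y (applyUpTo h n))
      go h zero    p = []
      go h (suc n) p = Allₚ.map⁺ (Allₚ.applyUpTo⁺₁ (h ∘ suc) n (λ {i} i<n → p 0 (suc i) (s≤s z≤n) (s≤s i<n)))
                       ∷ go (h ∘ suc) n (λ i i′ q r → p (suc i) (suc i′) (s≤s q) (s≤s r))

    greedy-map⁻ : ∀ n → Greedy (map x [1⋯ n ]) (map y [1⋯ n ]) →
                  ∀ k k′ → 1 ≤ k → k < k′ → k′ ≤ n → Inversion (x k) (y k) (y k′)
    greedy-map⁻ n g (suc k) (suc k′) _ (s≤s q) r = go suc n g k k′ q r
      where
      go : ∀ h n → Greedy (map x (applyUpTo h n)) (map y (applyUpTo h n)) →
           ∀ i i′ → i < i′ → i′ < n → Inversion (x (h i)) (y (h i)) (y (h i′))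
      go h (suc n) (a ∷ g) zero    (suc i′) q (s≤s r) = Allₚ.applyUpTo⁻ (h ∘ suc) n (Allₚ.map⁻ a) r
      go h (suc n) (a ∷ g) (suc i) (suc i′) (s≤s q) (s≤s r) = go (h ∘ suc) n g i i′ q r

  greedy-unique-col : ∀ {as bs} → Greedy as bs → Unique bs
  greedy-unique-col []      = []
  greedy-unique-col (a ∷ g) = All.map inversion-≢ a ∷ greedy-unique-col g

  count-unique : ∀ {v xs} → Unique xs → count v xs ≤ 1
  count-unique {v} {[]}     u = z≤n
  count-unique {v} {x ∷ xs} (n ∷ u) rewrite count-∷ v x xs with v ≟ x
  ... | no _ = count-unique {v} {xs} u
  ... | yes refl with count v xs in eq
  ...   | zero  = ≤-refl
  ...   | suc c = contradiction refl (All.lookup n (count⇒∈ {v} xs (subst (1 ≤_) (sym eq) (s≤s z≤n))))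

  count-↭ : ∀ v {xs ys} → xs ↭ ys → count v xs ≡ count v ys
  count-↭ v p = ↭ₚ.↭-length (↭ₚ.filter-↭ (v ≟_) p)

  sumTo-indicator : ∀ N x → 1 ≤ x → x ≤ N → sumTo N (λ v → when (v ≟ x) 1) ≡ 1
  sumTo-indicator zero    x p q = contradiction q (<⇒≱ p)
  sumTo-indicator (suc N) x p q with suc N ≟ x
  ... | yes refl = cong (_+ 1) (sumTo-zero′ N (λ i _ b → when-no (i ≟ suc N) (λ eq → <⇒≱ (s≤s b) (≤-reflexive (sym eq)))))
  ... | no ne      = trans (+-identityʳ _) (sumTo-indicator N x p (≤-pred (≤∧≢⇒< q (ne ∘ sym))))

  sumTo-counts : ∀ N xs → All (λ x → 1 ≤ x × x ≤ N) xs → sumTo N (λ v → count v xs) ≡ length xs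
  sumTo-counts N []       [] = sumTo-zero N (λ _ → refl)
  sumTo-counts N (x ∷ xs) ((p , q) ∷ b) = trans (sumTo-cong N (λ v _ _ → count-∷ v x xs))
    (trans (sumTo-⊕ N (λ v → when (v ≟ x) 1) (λ v → count v xs)) (cong₂ _+_ (sumTo-indicator N x p q) (sumTo-counts N xs b)))

  length-filter : ∀ {P : ℕ → Set} (P? : ∀ x → Dec (P x)) xs → length (filter P? xs) ≡ sum (map (λ x → when (P? x) 1) xs)
  length-filter P? []       = refl
  length-filter P? (x ∷ xs) with P? x
  ... | yes _ = cong suc (length-filter P? xs)
  ... | no  _ = length-filter P? xs

  orElse : {P : Set} → Dec P → ℕ → ℕ → ℕ
  orElse (yes _) x y = x
  orElse (no  _) x y = y

  orElse-yes : ∀ {P : Set} (d : Dec P) {x y} → P → orElse d x y ≡ x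
  orElse-yes (yes _) p = refl
  orElse-yes (no ¬p) p = contradiction p ¬p

  orElse-no : ∀ {P : Set} (d : Dec P) {x y} → ¬ P → orElse d x y ≡ y
  orElse-no (yes p) ¬p = contradiction p ¬p
  orElse-no (no _)  ¬p = refl

  sumTo-+ : ∀ m k f → sumTo (m + k) f ≡ sumTo m f + sumTo k (λ i → f (m + i))
  sumTo-+ m zero    f = trans (cong (λ z → sumTo z f) (+-identityʳ m)) (sym (+-identityʳ _))
  sumTo-+ m (suc k) f = trans (cong (λ z → sumTo z f) (+-suc m k))
    (trans (cong₂ _+_ (sumTo-+ m k f) (cong f (sym (+-suc m k)))) (+-assoc (sumTo m f) _ _))

  sum-cartesianProduct : ∀ {A B : Set} (f : A × B → ℕ) xs ys → sum (map f (cartesianProduct xs ys)) ≡ sum (map (λ x → sum (map (λ y → f (x , y)) ys)) xs)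
  sum-cartesianProduct f []       ys = refl
  sum-cartesianProduct f (x ∷ xs) ys = begin
    sum (map f (map (x ,_) ys ++ cartesianProduct xs ys))
      ≡⟨ cong sum (map-++ f (map (x ,_) ys) _) ⟩
    sum (map f (map (x ,_) ys) ++ map f (cartesianProduct xs ys))
      ≡⟨ sum-++ (map f (map (x ,_) ys)) _ ⟩
    sum (map f (map (x ,_) ys)) + sum (map f (cartesianProduct xs ys))
      ≡⟨ cong₂ _+_ (cong sum (sym (map-∘ ys))) (sum-cartesianProduct f xs ys) ⟩
    sum (map (λ y → f (x , y)) ys) + sum (map (λ x → sum (map (λ y → f (x , y)) ys)) xs) ∎
    where open ≡-Reasoning

  module _ (lam mu : List ℕ) where

    sumTo-row : ∀ i {n} (h : ℕ → ℕ) → part lam i ≤ n →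
      sumTo (rowLength lam mu i) (λ k → h (part mu i + k)) ≡ sumTo n (λ j → when (inShape? lam mu (i , j)) (h j))
    sumTo-row i {n} h l≤n = sym (trans (sumTo-extend f l≤n (λ j p _ → when-no (inShape? lam mu (i , j)) (λ s → <⇒≱ p (proj₂ s)))) inner)
      where
      m l : ℕ
      m = part mu i
      l = part lam i
      f : ℕ → ℕ
      f j = when (inShape? lam mu (i , j)) (h j)
      low : ∀ x → x ≤ m → sumTo x f ≡ 0
      low x x≤m = sumTo-zero′ x (λ j _ p → when-no (inShape? lam mu (i , j)) (λ s → <⇒≱ (proj₁ s) (≤-trans p x≤m)))
      inner : sumTo l f ≡ sumTo (l ∸ m) (λ k → h (m + k))
      inner with m ≤? l
      ... | no  q = trans (low l (<⇒≤ (≰⇒> q))) (cong (λ z → sumTo z (λ k → h (m + k))) (sym (m≤n⇒m∸n≡0 (<⇒≤ (≰⇒> q)))))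
      ... | yes q = begin
        sumTo l f                                    ≡⟨ cong (λ z → sumTo z f) (sym (m+[n∸m]≡n q)) ⟩
        sumTo (m + (l ∸ m)) f                        ≡⟨ sumTo-+ m (l ∸ m) f ⟩
        sumTo m f + sumTo (l ∸ m) (λ k → f (m + k))  ≡⟨ cong₂ _+_ (low m ≤-refl) (sumTo-cong (l ∸ m) (λ k a b →
          when-yes (inShape? lam mu (i , m + k)) (row-inShape lam mu i a b))) ⟩
        sumTo (l ∸ m) (λ k → h (m + k))              ∎
        where open ≡-Reasoning

    sum-boxes : ∀ f → sum (map f (boxes lam mu)) ≡
      sumTo (length lam) (λ i → sumTo (part lam 1) (λ j → when (inShape? lam mu (i , j)) (f (i , j))))
    sum-boxes f = begin
      sum (map f (boxes lam mu))
        ≡⟨ sum-filter (inShape? lam mu) f (cartesianProduct [1⋯ length lam ] [1⋯ part lam 1 ]) ⟩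
      sum (map (λ b → when (inShape? lam mu b) (f b)) (cartesianProduct [1⋯ length lam ] [1⋯ part lam 1 ]))
        ≡⟨ sum-cartesianProduct _ [1⋯ length lam ] _ ⟩
      sum (map (λ i → sum (map (λ j → when (inShape? lam mu (i , j)) (f (i , j))) [1⋯ part lam 1 ])) [1⋯ length lam ])
        ≡⟨ sum-[1⋯] _ (length lam) ⟩
      sumTo (length lam) (λ i → sum (map (λ j → when (inShape? lam mu (i , j)) (f (i , j))) [1⋯ part lam 1 ]))
        ≡⟨ sumTo-cong (length lam) (λ i _ _ → sum-[1⋯] _ (part lam 1)) ⟩
      sumTo (length lam) (λ i → sumTo (part lam 1) (λ j → when (inShape? lam mu (i , j)) (f (i , j)))) ∎
      where open ≡-Reasoning

  GoodMatrix : (αs γ : List ℕ) → Vec (Vec ℕ (length αs)) (length γ) → Set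
  GoodMatrix αs γ M = All≤1′ M × Vec.map Vec.sum M ≡ mkV (length γ) (part γ) × colSums M ≡ mkV (length αs) (part αs)

  matrix≃good : ∀ αs γ → GoodMatrix αs γ ≃ Good αs γ
  matrix≃good αs γ = record
    { to      = rsk
    ; from    = λ (t , qs) → unrsk t qs
    ; to-⊢    = λ {M} (b , r , c) → rsk-valid b , subst (Chain _ _) r (rsk-chain b) , subst (HasContent _) c (rsk-content b)
    ; from-⊢  = λ {x} (v , c , h) → let b = unrsk-≤1 v c ; eq = rsk∘unrsk v c in
        b ,
        chain-unique (rsk-chain b) (subst (λ z → Chain (top (proj₁ z)) (proj₂ z) (mkV (length γ) (part γ))) (sym eq) c) ,
        hasContent-unique (rsk-content b) (subst (λ z → HasContent (proj₁ z) (mkV (length αs) (part αs))) (sym eq) h)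
    ; from∘to = λ (b , _) → unrsk∘rsk b
    ; to∘from = λ (v , c , _) → rsk∘unrsk v c
    }
    where
    chain-unique : ∀ {a N m} {qs : Vec (Vec ℕ a) N} {g h} → Chain m qs g → Chain m qs h → g ≡ h
    chain-unique []                 []                 = refl
    chain-unique {qs = q ∷ _} ((_ , _ , e) ∷ c) ((_ , _ , f) ∷ d) =
      cong₂ _∷_ (+-cancelˡ-≡ (Vec.sum q) _ _ (trans (sym e) f)) (chain-unique c d)

  module Columns (lam mu : List ℕ) (pl : IsPartition lam) (pm : IsPartition mu) (γ : List ℕ) where

    n N : ℕ
    n = part lam 1
    N = length γ

    -- Column j occupies the rows head j + 1, …, head j + height j.
    height head : ℕ → ℕ
    head j   = part (conj mu) j
    height j = part (conj lam) j ∸ head j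

    in⁻ : ∀ {i j} → InShape lam mu (i , j) → 1 ≤ i × 1 ≤ j × j ≤ n × head j < i × i ≤ part (conj lam) j
    in⁻ {i} {j} s@(p , q) with a , b ← inShape-row lam mu {i} {j} s =
      a , 1≤j , ≤-trans q (part-anti (proj₁ pl) ≤-refl a) ,
      ≰⇒> (λ le → <⇒≱ p (conj⁺ (proj₁ pm) a 1≤j le)) , conj⁻ (proj₁ pl) a 1≤j q
      where
      1≤j : 1 ≤ j
      1≤j = ≤-trans (s≤s z≤n) p

    in⁺ : ∀ {j k} → 1 ≤ j → 1 ≤ k → k ≤ height j → InShape lam mu (head j + k , j)
    in⁺ {j} {k} a b c =
      ≰⇒> (λ le → <⇒≱ (m<m+n (head j) b) (conj⁻ (proj₁ pm) 1≤i a le)) ,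
      conj⁺ (proj₁ pl) 1≤i a (≤-trans (+-monoʳ-≤ (head j) c)
        (≤-reflexive (m+[n∸m]≡n {head j} {part (conj lam) j} (<⇒≤ (m∸n≢0⇒n<m (>⇒≢ (≤-trans b c)))))))
      where
      1≤i : 1 ≤ head j + k
      1≤i = ≤-trans b (m≤n+m k (head j))

    in-height : ∀ {i j} → InShape lam mu (i , j) → 1 ≤ i ∸ head j × i ∸ head j ≤ height j × head j + (i ∸ head j) ≡ i
    in-height {i} {j} s with _ , _ , _ , p , q ← in⁻ s = m<n⇒0<n∸m p , ∸-monoˡ-≤ (head j) q , m+[n∸m]≡n (<⇒≤ p)

    -- `suc N` serves as ∞: all entries are at most N, and for those `Inversion (suc N) b c` amounts
    -- to c < b. Column 0 meets no shape, so the first column is covered as well.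
    leftOf : (ℕ → ℕ → ℕ) → ℕ → ℕ → ℕ
    leftOf g i j = orElse (inShape? lam mu (i , pred j)) (g i (pred j)) (suc N)

    colOf leftsOf : (ℕ → ℕ → ℕ) → ℕ → List ℕ
    colOf   g j = map (λ k → g (head j + k) j) [1⋯ height j ]
    leftsOf g j = map (λ k → leftOf g (head j + k) j) [1⋯ height j ]

    Coinv : (ℕ → ℕ → ℕ) → Set
    Coinv g = ∀ {i i′ j} → i < i′ → InShape lam mu (i , j) → InShape lam mu (i′ , j) →
              Inversion (leftOf g i j) (g i j) (g i′ j)

    private
      pairs⁺ : ∀ {i i′ j} → i < i′ → InShape lam mu (i , j) → InShape lam mu (i′ , j) → ((i , j) , (i′ , j)) ∈ columnPairs lam mu
      pairs⁺ p s t = ∈-filter⁺ (λ (b , c) → below? b c) (∈-cartesianProduct⁺ (boxes⁺ {lam} {mu} pl s) (boxes⁺ {lam} {mu} pl t)) (refl , p)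

      pairs⁻ : ∀ {b c} → (b , c) ∈ columnPairs lam mu → Below b c × InShape lam mu b × InShape lam mu c
      pairs⁻ p with ∈-filter⁻ (λ (b , c) → below? b c) {xs = cartesianProduct (boxes lam mu) (boxes lam mu)} p
      ... | q , r with ∈-cartesianProduct⁻ (boxes lam mu) (boxes lam mu) q
      ...   | s , t = r , boxes⁻ {lam} {mu} s , boxes⁻ {lam} {mu} t

      infinite⁻ : ∀ {b c} → c ≤ N → Inversion (suc N) b c → c < b
      infinite⁻ q (inj₁ (_ , r))        = contradiction q (<⇒≱ (<-trans ≤-refl r))
      infinite⁻ q (inj₂ (inj₁ (r , _))) = contradiction q (<⇒≱ (<-trans ≤-refl r))
      infinite⁻ q (inj₂ (inj₂ (r , _))) = r

    -- Distinct columns and the decrease of the first column both follow from the triples, the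
    -- latter because the left neighbours of column 1 are infinite.
    COF⁺ : ∀ {g} → Fills lam mu γ g → Coinv g → mk lam mu g ∈ COF lam mu γ
    COF⁺ {g} f c = ∈-filter⁺ (isCOF? lam mu) (fillings⁺ f)
      ( All.tabulate (λ { {(i , j) , (i′ , j′)} p → distinct (pairs⁻ p) })
      , All.tabulate (λ { {(i , j) , (i′ , j′)} p → first (pairs⁻ p) })
      , All.tabulate (λ { {(i , j) , (i′ , j′)} p → triple (pairs⁻ p) }) )
      where
      F⟨_⟩ : Box → ℕ
      F⟨_⟩ = entry mu (mk lam mu g)
      F≡ : ∀ {i j} → InShape lam mu (i , j) → F⟨ i , j ⟩ ≡ g i j
      F≡ = entry-mk lam mu g
      distinct : ∀ {b c} → Below b c × InShape lam mu b × InShape lam mu c → F⟨ b ⟩ ≢ F⟨ c ⟩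
      distinct {i , j} {i′ , _} ((refl , p) , s , t) = subst₂ _≢_ (sym (F≡ s)) (sym (F≡ t)) (inversion-≢ (c p s t))
      outside : ∀ {i i′ j} → i < i′ → InShape lam mu (i , j) → InShape lam mu (i′ , j) → ¬ InShape lam mu (i , pred j) → F⟨ i′ , j ⟩ < F⟨ i , j ⟩
      outside {i} {i′} {j} p s t o = subst₂ _<_ (sym (F≡ t)) (sym (F≡ s))
        (infinite⁻ (proj₂ (Fills.bounded f t)) (subst (λ z → Inversion z (g i j) (g i′ j)) (orElse-no (inShape? lam mu (i , pred j)) o) (c p s t)))
      first : ∀ {b c} → Below b c × InShape lam mu b × InShape lam mu c → proj₂ b ≡ 1 → F⟨ c ⟩ < F⟨ b ⟩
      first {i , _} {i′ , _} ((refl , p) , s , t) refl = outside p s t λ (q , _) → contradiction q λ ()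
      triple : ∀ {b c} → Below b c × InShape lam mu b × InShape lam mu c → InversionTriple lam mu (mk lam mu g) b c
      triple {i , j} {i′ , _} ((refl , p) , s , t) =
        (λ l → subst₂ (Inversion F⟨ i , pred j ⟩) (sym (F≡ s)) (sym (F≡ t)) (subst (λ z → Inversion z (g i j) (g i′ j))
          (trans (orElse-yes (inShape? lam mu (i , pred j)) l) (sym (F≡ l))) (c p s t))) ,
        outside p s t

    COF⁻ : ∀ {F} → F ∈ COF lam mu γ → mk lam mu (λ i j → entry mu F (i , j)) ≡ F
      × Fills lam mu γ (λ i j → entry mu F (i , j)) × Coinv (λ i j → entry mu F (i , j))
    COF⁻ {F} F∈ with ∈-filter⁻ (isCOF? lam mu) {xs = fillings lam mu γ} F∈
    ... | F∈′ , _ , _ , all with fillings⁻ {lam} {mu} {γ} F∈′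
    ...   | eq , f = eq , f , coinv
      where
      coinv : Coinv (λ i j → entry mu F (i , j))
      coinv {i} {i′} {j} p s t with inShape? lam mu (i , pred j) | All.lookup all (pairs⁺ p s t)
      ... | yes l | a , _ = a l
      ... | no ¬l | _ , b = inj₂ (inj₂ (b ¬l , m≤n⇒m≤1+n (proj₂ (Fills.bounded f s))))

    coinv⇒greedy : ∀ {g} → Coinv g → ∀ j → 1 ≤ j → Greedy (leftsOf g j) (colOf g j)
    coinv⇒greedy {g} c j a = greedy-map⁺ (λ k → leftOf g (head j + k) j) (λ k → g (head j + k) j) (height j)
      (λ k k′ b p q → c (+-monoʳ-< (head j) p) (in⁺ a b (≤-trans (<⇒≤ p) q)) (in⁺ a (≤-trans b (<⇒≤ p)) q))

    greedy⇒coinv : ∀ {g} → (∀ j → 1 ≤ j → j ≤ n → Greedy (leftsOf g j) (colOf g j)) → Coinv g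
    greedy⇒coinv {g} c {i} {i′} {j} p s t with _ , a , b , h , _ ← in⁻ s | k , l , r ← in-height s | k′ , l′ , r′ ← in-height t =
      subst₂ (λ x y → Inversion (leftOf g x j) (g x j) (g y j)) r r′
        (greedy-map⁻ (λ k → leftOf g (head j + k) j) (λ k → g (head j + k) j) (height j) (c j a b)
          (i ∸ head j) (i′ ∸ head j) k (∸-monoˡ-< p (<⇒≤ h)) l′)

    weight-columns : ∀ g v → weight lam mu g v ≡ sumTo n (λ j → count v (colOf g j))
    weight-columns g v = begin
      weight lam mu g v
        ≡⟨ sumTo-cong (length lam) (λ i a _ → sumTo-row lam mu i (h i) (part-anti (proj₁ pl) ≤-refl a)) ⟩
      sumTo (length lam) (λ i → sumTo n (λ j → when (inShape? lam mu (i , j)) (h i j)))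
        ≡⟨ sumTo-swap (length lam) n _ ⟩
      sumTo n (λ j → sumTo (length lam) (λ i → when (inShape? lam mu (i , j)) (h i j)))
        ≡⟨ sumTo-cong n (λ j a b → column j a) ⟩
      sumTo n (λ j → count v (colOf g j)) ∎
      where
      open ≡-Reasoning
      h : ℕ → ℕ → ℕ
      h i j = when (v ≟ g i j) 1
      low : ∀ j → 1 ≤ j → part (conj lam) j ≤ length lam
      low j a with part (conj lam) j in eq
      ... | zero  = z≤n
      ... | suc l = proj₂ (part-pos {lam} (≤-trans a (conj⁺ (proj₁ pl) (s≤s z≤n) a (≤-reflexive (sym eq)))))
      column : ∀ j → 1 ≤ j → sumTo (length lam) (λ i → when (inShape? lam mu (i , j)) (h i j)) ≡ count v (colOf g j)
      column j a = begin
        sumTo (length lam) (λ i → when (inShape? lam mu (i , j)) (h i j))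
          ≡⟨ sumTo-cong (length lam) (λ i b _ → when-cong (inShape? lam mu (i , j)) (inShape? (conj lam) (conj mu) (j , i))
               (λ s → let _ , _ , _ , p , q = in⁻ s in p , q)
               (λ (p , q) → subst (λ z → InShape lam mu (z , j)) (m+[n∸m]≡n (<⇒≤ p)) (in⁺ a (m<n⇒0<n∸m p) (∸-monoˡ-≤ (head j) q)))) ⟩
        sumTo (length lam) (λ i → when (inShape? (conj lam) (conj mu) (j , i)) (h i j))
          ≡⟨ sym (sumTo-row (conj lam) (conj mu) j (λ i → h i j) (low j a)) ⟩
        sumTo (height j) (λ k → h (head j + k) j)
          ≡⟨ sym (trans (count-map v (λ k → g (head j + k) j) [1⋯ height j ]) (sum-[1⋯] _ (height j))) ⟩
        count v (colOf g j) ∎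

    Entries : Set
    Entries = ℕ → ℕ → ℕ

    colSet : Entries → ℕ → List ℕ
    colSet m j = filter (λ v → m v j ≟ 1) [1⋯ N ]

    -- Arranging column j + 1 requires column j, so the two functions are mutually recursive;
    -- `arranged m j` lists column j + 1 from its first box in the skew shape on.
    column : Entries → ℕ → ℕ → ℕ
    arranged : Entries → ℕ → List ℕ

    column m zero    i = 0
    column m (suc j) i = part (arranged m j) (i ∸ head (suc j))

    arranged m j = arrange
      (map (λ k → orElse (inShape? lam mu (head (suc j) + k , j)) (column m j (head (suc j) + k)) (suc N)) [1⋯ height (suc j) ])
      (colSet m (suc j))

    grid : Entries → ℕ → ℕ → ℕ
    grid m i j = column m j i

    record GoodEntries (m : Entries) : Set where
      field
        ≤1      : ∀ v j → 1 ≤ v → v ≤ N → 1 ≤ j → j ≤ n → m v j ≤ 1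
        rowSums : ∀ v → 1 ≤ v → v ≤ N → sumTo n (m v) ≡ part γ v
        colSums′ : ∀ j → 1 ≤ j → j ≤ n → sumTo N (λ v → m v j) ≡ height j

    entriesOf : (ℕ → ℕ → ℕ) → Entries
    entriesOf g v j = count v (colOf g j)

    private
      colOf-bounded : ∀ {g} → Fills lam mu γ g → ∀ j → 1 ≤ j → All (λ x → 1 ≤ x × x ≤ N) (colOf g j)
      colOf-bounded f j a = Allₚ.map⁺ (All.tabulate λ k∈ → let b , c = ∈-[1⋯]⁻ k∈ in Fills.bounded f (in⁺ a b c))

      colOf-length : ∀ g j → length (colOf g j) ≡ height j
      colOf-length g j = trans (length-map _ [1⋯ height j ]) (length-applyUpTo suc _)

    entriesOf-good : ∀ {g} → Fills lam mu γ g → Coinv g → GoodEntries (entriesOf g)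
    entriesOf-good {g} f c = record
      { ≤1       = λ v j _ _ a _ → count-unique {v} (greedy-unique-col (coinv⇒greedy c j a))
      ; rowSums  = λ v a b → trans (sym (weight-columns g v)) (Fills.weights f v a b)
      ; colSums′ = λ j a _ → trans (sumTo-counts N (colOf g j) (colOf-bounded f j a)) (colOf-length g j)
      }

    colSet-unique : ∀ m j → Unique (colSet m j)
    colSet-unique m j = Uniqueₚ.filter⁺ (λ v → m v j ≟ 1) ([1⋯]-unique N)

    colSet-entriesOf : ∀ {g} → Fills lam mu γ g → Coinv g → ∀ j → 1 ≤ j → colSet (entriesOf g) j ↭ colOf g j
    colSet-entriesOf {g} f c j a = unique-↭ (colSet-unique (entriesOf g) j) u
      (λ v∈ → count⇒∈ (colOf g j) (≤-reflexive (sym (proj₂ (∈-filter⁻ (λ v → entriesOf g v j ≟ 1) {xs = [1⋯ N ]} v∈)))))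
      (λ v∈ → let x , y = All.lookup (colOf-bounded f j a) v∈ in
        ∈-filter⁺ (λ v → entriesOf g v j ≟ 1) (∈-[1⋯]⁺ x y) (≤-antisym (count-unique u) (∈⇒count v∈)))
      where u = greedy-unique-col (coinv⇒greedy c j a)

    module _ {m : Entries} (G : GoodEntries m) where
      open GoodEntries G

      private
        lefts : ℕ → List ℕ
        lefts j = map (λ k → orElse (inShape? lam mu (head (suc j) + k , j)) (column m j (head (suc j) + k)) (suc N)) [1⋯ height (suc j) ]

        colSet-length : ∀ j → j < n → length (lefts j) ≡ length (colSet m (suc j))
        colSet-length j p = begin
          length (lefts j)                     ≡⟨ trans (length-map _ [1⋯ height (suc j) ]) (length-applyUpTo suc _) ⟩
          height (suc j)                       ≡⟨ sym (colSums′ (suc j) (s≤s z≤n) p) ⟩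
          sumTo N (λ v → m v (suc j))          ≡⟨ sumTo-cong N (λ v a b → bit (≤1 v (suc j) a b (s≤s z≤n) p)) ⟩
          sumTo N (λ v → when (m v (suc j) ≟ 1) 1) ≡⟨ sym (sum-[1⋯] _ N) ⟩
          sum (map (λ v → when (m v (suc j) ≟ 1) 1) [1⋯ N ]) ≡⟨ sym (length-filter (λ v → m v (suc j) ≟ 1) [1⋯ N ]) ⟩
          length (colSet m (suc j))            ∎
          where
          open ≡-Reasoning
          bit : ∀ {x} → x ≤ 1 → x ≡ when (x ≟ 1) 1
          bit {zero}  p = refl
          bit {suc zero} p = refl
          bit {suc (suc x)} (s≤s ())

      colOf-grid : ∀ j → j < n → colOf (grid m) (suc j) ≡ arranged m j
      colOf-grid j p = begin
        map (λ k → part (arranged m j) (head (suc j) + k ∸ head (suc j))) [1⋯ height (suc j) ]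
          ≡⟨ map-cong-[1⋯] (height (suc j)) (λ k _ _ → cong (part (arranged m j)) (m+n∸m≡n (head (suc j)) k)) ⟩
        map (part (arranged m j)) [1⋯ height (suc j) ]
          ≡⟨ cong (λ z → map (part (arranged m j)) [1⋯ z ]) len ⟩
        map (part (arranged m j)) [1⋯ length (arranged m j) ]
          ≡⟨ tabulate-at (arranged m j) ⟩
        arranged m j ∎
        where
        open ≡-Reasoning
        len : height (suc j) ≡ length (arranged m j)
        len = trans (sym (trans (length-map _ [1⋯ height (suc j) ]) (length-applyUpTo suc _)))
          (trans (colSet-length j p) (↭ₚ.↭-length (arrange-↭ (lefts j) _ (colSet-length j p))))

      colOf-grid-↭ : ∀ j → 1 ≤ j → j ≤ n → colSet m j ↭ colOf (grid m) j
      colOf-grid-↭ (suc j) _ p = ↭-trans (arrange-↭ (lefts j) _ (colSet-length j p)) (↭-reflexive (sym (colOf-grid j p)))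

      grid-greedy : ∀ j → 1 ≤ j → j ≤ n → Greedy (leftsOf (grid m) j) (colOf (grid m) j)
      grid-greedy (suc j) _ p = subst (Greedy (lefts j)) (sym (colOf-grid j p))
        (arrange-greedy (lefts j) _ (colSet-unique m (suc j)) (colSet-length j p))

      grid-coinv : Coinv (grid m)
      grid-coinv = greedy⇒coinv {grid m} grid-greedy

      entriesOf-grid : ∀ v j → 1 ≤ v → v ≤ N → 1 ≤ j → j ≤ n → entriesOf (grid m) v j ≡ m v j
      entriesOf-grid v j a b c d = trans (sym (count-↭ v (colOf-grid-↭ j c d))) (bit (≤1 v j a b c d) refl)
        where
        bit : ∀ {x} → x ≤ 1 → m v j ≡ x → count v (colSet m j) ≡ m v j
        bit {zero}  p eq with count v (colSet m j) in e
        ... | zero  = sym eq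
        ... | suc _ = contradiction (trans (sym eq) (proj₂ (∈-filter⁻ (λ v → m v j ≟ 1) {xs = [1⋯ N ]}
                        (count⇒∈ {v} (colSet m j) (subst (1 ≤_) (sym e) (s≤s z≤n)))))) λ ()
        bit {suc zero} p eq = trans (≤-antisym (count-unique {v} (colSet-unique m j))
          (∈⇒count {v} (∈-filter⁺ (λ v → m v j ≟ 1) (∈-[1⋯]⁺ a b) eq))) (sym eq)
        bit {suc (suc x)} (s≤s ())

      grid-fills : Fills lam mu γ (grid m)
      grid-fills = record
        { bounded = λ {i} {j} s → let _ , a , b , h , _ = in⁻ s ; k , l , r = in-height s in
            ∈-[1⋯]⁻ (proj₁ (∈-filter⁻ (λ v → m v j ≟ 1) {xs = [1⋯ N ]} (↭ₚ.∈-resp-↭ (↭-sym (colOf-grid-↭ j a b))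
              (subst (λ z → grid m z j ∈ colOf (grid m) j) r (∈-map⁺ (λ k → grid m (head j + k) j) (∈-[1⋯]⁺ k l))))))
        ; weights = λ v a b → trans (weight-columns (grid m) v)
            (trans (sumTo-cong n (λ j c d → entriesOf-grid v j a b c d)) (rowSums v a b))
        }

    -- Induction on the column: equal left neighbours and equal sets of entries leave one greedy
    -- arrangement. `m` has to agree with `g` within the matrix only, as it will be read back from a
    -- vector.
    grid-entriesOf : ∀ {g m} → Fills lam mu γ g → Coinv g → GoodEntries m →
      (∀ v j → 1 ≤ v → v ≤ N → 1 ≤ j → j ≤ n → m v j ≡ entriesOf g v j) →
      ∀ j {i} → InShape lam mu (i , j) → grid m i j ≡ g i j
    grid-entriesOf f c G eq zero    s with _ , () , _ ← in⁻ s
    grid-entriesOf {g} {m} f c G eq (suc j) {i} s with _ , a , b , h , _ ← in⁻ s | k , l , r ← in-height s = begin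
      grid m i (suc j)                                     ≡⟨ cong (λ z → grid m z (suc j)) (sym r) ⟩
      grid m (head (suc j) + (i ∸ head (suc j))) (suc j)   ≡⟨ sym (at-map-[1⋯] (λ k → grid m (head (suc j) + k) (suc j)) k l) ⟩
      part (colOf (grid m) (suc j)) (i ∸ head (suc j))     ≡⟨ cong (λ z → part z (i ∸ head (suc j))) cols ⟩
      part (colOf g (suc j)) (i ∸ head (suc j))            ≡⟨ at-map-[1⋯] (λ k → g (head (suc j) + k) (suc j)) k l ⟩
      g (head (suc j) + (i ∸ head (suc j))) (suc j)        ≡⟨ cong (λ z → g z (suc j)) r ⟩
      g i (suc j)                                          ∎
      where
      open ≡-Reasoning
      lefts≡ : leftsOf (grid m) (suc j) ≡ leftsOf g (suc j)
      lefts≡ = map-cong (λ k → same (head (suc j) + k)) [1⋯ height (suc j) ]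
        where
        same : ∀ i → leftOf (grid m) i (suc j) ≡ leftOf g i (suc j)
        same i with inShape? lam mu (i , j)
        ... | yes t = grid-entriesOf f c G eq j t
        ... | no _  = refl
      sets≡ : colSet m (suc j) ≡ colSet (entriesOf g) (suc j)
      sets≡ = filter-cong-∈ (λ v → m v (suc j) ≟ 1) (λ v → entriesOf g v (suc j) ≟ 1) [1⋯ N ]
        (λ v∈ p → let x , y = ∈-[1⋯]⁻ v∈ in trans (sym (eq _ (suc j) x y a b)) p)
        (λ v∈ p → let x , y = ∈-[1⋯]⁻ v∈ in trans (eq _ (suc j) x y a b) p)
      cols : colOf (grid m) (suc j) ≡ colOf g (suc j)
      cols = greedy-unique (subst (λ z → Greedy z (colOf (grid m) (suc j))) lefts≡ (grid-greedy G (suc j) a b)) (coinv⇒greedy c (suc j) a)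
        (↭-trans (↭-sym (colOf-grid-↭ G (suc j) a b)) (↭-trans (↭-reflexive sets≡) (colSet-entriesOf f c (suc j) a)))

-- Column sets as 0/1 matrices

module Matrices where

  open RSK
  open TandemQueues using (sumTo)
  open ChargeWords using (at-map-[1⋯])
  open Shapes
  open Sums
  open Correspondence using (_≃_)
  open CoinversionFree

  all≤1⁺ : ∀ n {f} → (∀ j → 1 ≤ j → j ≤ n → f j ≤ 1) → All≤1 (mkV n f)
  all≤1⁺ zero    p = []
  all≤1⁺ (suc n) p = p (suc n) (s≤s z≤n) ≤-refl ∷ all≤1⁺ n (λ j a b → p j a (m≤n⇒m≤1+n b))

  all≤1⁻ : ∀ n {f} → All≤1 (mkV n f) → ∀ j → 1 ≤ j → j ≤ n → f j ≤ 1
  all≤1⁻ zero    p        j (s≤s _) ()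
  all≤1⁻ (suc n) (p ∷ ps) j a b with m≤n⇒m<n∨m≡n b
  ... | inj₂ refl      = p
  ... | inj₁ (s≤s j≤n) = all≤1⁻ n ps j a j≤n

  all≤1′⁺ : ∀ n N {m : ℕ → ℕ → ℕ} → (∀ v j → 1 ≤ v → v ≤ N → 1 ≤ j → j ≤ n → m v j ≤ 1) → All≤1′ (mkV N (λ v → mkV n (m v)))
  all≤1′⁺ n zero    p = []
  all≤1′⁺ n (suc N) p = all≤1⁺ n (λ j → p (suc N) j (s≤s z≤n) ≤-refl) ∷ all≤1′⁺ n N (λ v j a b → p v j a (m≤n⇒m≤1+n b))

  all≤1′⁻ : ∀ n N {m : ℕ → ℕ → ℕ} → All≤1′ (mkV N (λ v → mkV n (m v))) → ∀ v j → 1 ≤ v → v ≤ N → 1 ≤ j → j ≤ n → m v j ≤ 1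
  all≤1′⁻ n zero    p        v j (s≤s _) ()
  all≤1′⁻ n (suc N) (p ∷ ps) v j a b with m≤n⇒m<n∨m≡n b
  ... | inj₂ refl      = all≤1⁻ n p j
  ... | inj₁ (s≤s v≤N) = all≤1′⁻ n N ps v j a v≤N

  mkV-injective : ∀ {A : Set} n {f g : ℕ → A} → mkV n f ≡ mkV n g → ∀ j → 1 ≤ j → j ≤ n → f j ≡ g j
  mkV-injective n {f} {g} eq j a b =
    trans (sym (getV∘mkV n (f j) f j a b)) (trans (cong (λ z → getV (f j) z j) eq) (getV∘mkV n (f j) g j a b))

  map-sum-mkV : ∀ n N (m : ℕ → ℕ → ℕ) → Vec.map Vec.sum (mkV N (λ v → mkV n (m v))) ≡ mkV N (λ v → sumTo n (m v))
  map-sum-mkV n zero    m = refl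
  map-sum-mkV n (suc N) m = cong₂ _∷_ (sum-mkV n (m (suc N))) (map-sum-mkV n N m)

  colSums-mkV : ∀ n N (m : ℕ → ℕ → ℕ) → colSums (mkV N (λ v → mkV n (m v))) ≡ mkV n (λ j → sumTo N (λ v → m v j))
  colSums-mkV n zero    m = zeros n
    where
    zeros : ∀ n → Vec.replicate n 0 ≡ mkV n (λ _ → 0)
    zeros zero    = refl
    zeros (suc n) = cong (0 ∷_) (zeros n)
  colSums-mkV n (suc N) m = trans (cong (Vec.zipWith _+_ (mkV n (m (suc N)))) (colSums-mkV n N m))
    (trans (zipWith-mkV n (m (suc N)) _) (mkV-cong n (λ j _ _ → +-comm (m (suc N) j) _)))
    where
    zipWith-mkV : ∀ n f g → Vec.zipWith _+_ (mkV n f) (mkV n g) ≡ mkV n (λ j → f j + g j)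
    zipWith-mkV zero    f g = refl
    zipWith-mkV (suc n) f g = cong (f (suc n) + g (suc n) ∷_) (zipWith-mkV n f g)

  getM : ∀ {n N} → Vec (Vec ℕ n) N → ℕ → ℕ → ℕ
  getM {n} M v j = getV 0 (getV (Vec.replicate n 0) M v) j

  mkM : ∀ n N → (ℕ → ℕ → ℕ) → Vec (Vec ℕ n) N
  mkM n N m = mkV N (λ v → mkV n (m v))

  mkM∘getM : ∀ {n N} (M : Vec (Vec ℕ n) N) → mkM n N (getM M) ≡ M
  mkM∘getM {n} {N} M = trans (mkV-cong N (λ v _ _ → mkV∘getV 0 (getV (Vec.replicate n 0) M v))) (mkV∘getV (Vec.replicate n 0) M)

  getM∘mkM : ∀ n N m v j → 1 ≤ v → v ≤ N → 1 ≤ j → j ≤ n → getM (mkM n N m) v j ≡ m v j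
  getM∘mkM n N m v j a b c d =
    trans (cong (λ z → getV 0 z j) (getV∘mkV N (Vec.replicate n 0) (λ v → mkV n (m v)) v a b)) (getV∘mkV n 0 (m v) j c d)

  module _ (lam mu : List ℕ) (pl : IsPartition lam) (pm : IsPartition mu) (γ : List ℕ) where
    open Columns lam mu pl pm γ

    private
      αs : List ℕ
      αs = columnLengths lam mu
      -- The correspondence uses vectors of length `length αs`, which equals `n` propositionally;
      -- `le` and `ge` translate the bounds.
      n′ : ℕ
      n′ = length αs
      n≡ : n′ ≡ n
      n≡ = trans (length-map _ [1⋯ n ]) (length-applyUpTo suc n)
      α≡ : ∀ j → 1 ≤ j → j ≤ n → part αs j ≡ height j
      α≡ j a b = at-map-[1⋯] height a b
      le : ∀ {j} → j ≤ n → j ≤ n′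
      le p = ≤-trans p (≤-reflexive (sym n≡))
      ge : ∀ {j} → j ≤ n′ → j ≤ n
      ge p = ≤-trans p (≤-reflexive n≡)

    goodEntries⇒matrix : ∀ {m} → GoodEntries m → GoodMatrix αs γ (mkM n′ N m)
    goodEntries⇒matrix {m} G =
      all≤1′⁺ n′ N (λ v j a b c d → ≤1 v j a b c (ge d)) ,
      trans (map-sum-mkV n′ N m) (mkV-cong N (λ v a b → trans (cong (λ z → sumTo z (m v)) n≡) (rowSums v a b))) ,
      trans (colSums-mkV n′ N m) (mkV-cong n′ (λ j a b → trans (colSums′ j a (ge b)) (sym (α≡ j a (ge b)))))
      where open GoodEntries G

    matrix⇒goodEntries : ∀ {M} → GoodMatrix αs γ M → GoodEntries (getM M)
    matrix⇒goodEntries {M} (p , r , c) = record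
      { ≤1       = λ v j a b d e → all≤1′⁻ n′ N (subst All≤1′ (sym (mkM∘getM M)) p) v j a b d (le e)
      ; rowSums  = λ v a b → trans (cong (λ z → sumTo z (getM M v)) (sym n≡))
          (mkV-injective N (trans (sym (map-sum-mkV n′ N (getM M))) (trans (cong (Vec.map Vec.sum) (mkM∘getM M)) r)) v a b)
      ; colSums′ = λ j a b → trans
          (mkV-injective n′ (trans (sym (colSums-mkV n′ N (getM M))) (trans (cong colSums (mkM∘getM M)) c)) j a (le b)) (α≡ j a b)
      }

    entryOf : Filling → ℕ → ℕ → ℕ
    entryOf F i j = entry mu F (i , j)

    matrixOf : Filling → Vec (Vec ℕ n′) N
    matrixOf F = mkM n′ N (entriesOf (entryOf F))

    fillingOf : Vec (Vec ℕ n′) N → Filling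
    fillingOf M = mk lam mu (grid (getM M))

    cof≃matrix : (_∈ COF lam mu γ) ≃ GoodMatrix αs γ
    cof≃matrix = record
      { to      = matrixOf
      ; from    = fillingOf
      ; to-⊢    = λ F∈ → let _ , f , c = COF⁻ F∈ in goodEntries⇒matrix (entriesOf-good f c)
      ; from-⊢  = λ g → let G = matrix⇒goodEntries g in COF⁺ (grid-fills G) (grid-coinv G)
      ; from∘to = λ {F} F∈ → let e , f , c = COF⁻ F∈ ; G = matrix⇒goodEntries (goodEntries⇒matrix (entriesOf-good f c)) in
          trans (mk-cong lam mu (λ {i} {j} → grid-entriesOf f c G (λ v j a b d e → getM∘mkM n′ N (entriesOf (entryOf F)) v j a b d (le e)) j)) e
      ; to∘from = λ {M} g → let G = matrix⇒goodEntries g in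
          trans (mkV-cong N (λ v a b → mkV-cong n′ (λ j d e → trans (cols M v j d) (entriesOf-grid G v j a b d (ge e))))) (mkM∘getM M)
      }
      where
      cols : ∀ M v j → 1 ≤ j → entriesOf (entryOf (fillingOf M)) v j ≡ entriesOf (grid (getM M)) v j
      cols M v j d = cong (count v) (map-cong-[1⋯] (height j) (λ k a b → entry-mk lam mu (grid (getM M)) (in⁺ d a b)))

-- The rows of the extended filling as standard subwords

module ExtendedFillings where

  open RSK
  open Plactic using (matrixWord; decrWord)
  open TandemQueues
  open Markings
  open ChargeWords using (sum-filter; turns-when; when-cong; ∈-[1⋯]⁻; ∈-[1⋯]⁺; count⇒∈; ∈⇒count)
  open Shapes
  open Sums
  open CoinversionFree
  open Matrices

  lex-< : ∀ {x x′ y y′ R} → x < x′ → y ≤ R → x * suc R + y < x′ * suc R + y′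
  lex-< {x} {x′} {y} {y′} {R} p q = begin-strict
    x * suc R + y     <⟨ +-monoʳ-< (x * suc R) (s≤s q) ⟩
    x * suc R + suc R ≡⟨ +-comm (x * suc R) (suc R) ⟩
    suc x * suc R     ≤⟨ *-monoˡ-≤ (suc R) p ⟩
    x′ * suc R        ≤⟨ m≤m+n _ y′ ⟩
    x′ * suc R + y′   ∎
    where open ≤-Reasoning

  suffix : List ℕ → Word
  suffix κ = concatMap (λ i → replicate (part κ i) i) (reverse [1⋯ length κ ])

  module Extended (lam mu : List ℕ) (pl : IsPartition lam) (pm : IsPartition mu) (sub : mu ⊆ lam) (γ : List ℕ) where
    open Columns lam mu pl pm γ

    R : ℕ
    R = length lam

    -- The boxes of μ receive values exceeding N that decrease along rows and
    -- columns, and column 0 is filled with a value exceeding all others.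
    large : ℕ → ℕ → ℕ
    large i j = suc N + ((n ∸ j) * suc R + (R ∸ i))
    huge : ℕ
    huge = suc N + (suc n * suc R + 0)

    -- The letter j for an entry v in column j precedes those for larger entries, and
    -- those for entries v in columns further left.
    K : ℕ → ℕ → ℕ
    K v j = v * suc n + (n ∸ j)

    K-< : ∀ {v v′ j j′} → v < v′ → K v j < K v′ j′
    K-< {j = j} p = lex-< p (m∸n≤m n j)

    K-≤ : ∀ {v v′ j} → j < n → v′ ≤ v → K v′ (suc j) < K v j
    K-≤ {v} {v′} {j} p q with m≤n⇒m<n∨m≡n q
    ... | inj₁ r    = K-< {v′} {v} {suc j} {j} r
    ... | inj₂ refl = +-monoʳ-< (v * suc n) (∸-monoʳ-< ≤-refl p)

    large-col : ∀ {i i′ j} → i < i′ → i′ ≤ R → large i′ j < large i j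
    large-col {j = j} p q = +-monoʳ-< (suc N) (+-monoʳ-< ((n ∸ j) * suc R) (∸-monoʳ-< p q))

    large-row : ∀ {i i′ j j′} → j′ < j → j ≤ n → large i j < large i′ j′
    large-row {i} p q = +-monoʳ-< (suc N) (lex-< (∸-monoʳ-< p q) (m∸n≤m R i))

    large-huge : ∀ i j → large i j < huge
    large-huge i j = +-monoʳ-< (suc N) (lex-< (s≤s (m∸n≤m n j)) (m∸n≤m R i))

    N<large : ∀ {v} i j → v ≤ N → v < large i j
    N<large i j p = ≤-trans (s≤s p) (m≤m+n (suc N) _)

    part≤n : ∀ {i} → 1 ≤ i → part lam i ≤ n
    part≤n = part-anti (proj₁ pl) ≤-refl

    module _ {g : ℕ → ℕ → ℕ} (f : Fills lam mu γ g) (c : Coinv g) where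

      ext : ℕ → ℕ → ℕ
      ext i zero    = huge
      ext i (suc j) = orElse (suc j ≤? part mu i) (large i (suc j)) (g i (suc j))

      ext-mu : ∀ {i j} → 1 ≤ j → j ≤ part mu i → ext i j ≡ large i j
      ext-mu {i} {suc j} _ p = orElse-yes (suc j ≤? part mu i) p

      ext-in : ∀ {i j} → InShape lam mu (i , j) → ext i j ≡ g i j
      ext-in {i} {suc j} (p , _) = orElse-no (suc j ≤? part mu i) (<⇒≱ p)

      ext-≤ : ∀ {i j} → InShape lam mu (i , j) → ext i j ≤ N
      ext-≤ s = ≤-trans (≤-reflexive (ext-in s)) (proj₂ (Fills.bounded f s))

      ext-huge : ∀ {i j} → 1 ≤ j → j ≤ part lam i → ext i j < huge
      ext-huge {i} {j} a b with j ≤? part mu i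
      ... | yes p = ≤-trans (s≤s (≤-reflexive (ext-mu a p))) (large-huge i j)
      ... | no  p = ≤-<-trans (ext-≤ (≰⇒> p , b)) (<-trans (N<large i j ≤-refl) (large-huge i j))

      ext-row : ∀ {i j} → 1 ≤ i → suc j ≤ part mu i → ext i (suc j) < ext i j
      ext-row {i} {zero}  a p = ext-huge (s≤s z≤n) (≤-trans p (sub i))
      ext-row {i} {suc j} a p = subst₂ _<_ (sym (ext-mu (s≤s z≤n) p)) (sym (ext-mu (s≤s z≤n) (<⇒≤ p)))
        (large-row {i} {i} ≤-refl (≤-trans p (≤-trans (sub i) (part≤n a))))

      -- If b or its left neighbour a lies in μ or column 0, the triple has the form c < b ≤ a; that
      -- c lies in μ and b does not is impossible for a partition. All other triples are those of
      -- the filling.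
      ext-inversion : ∀ {i i′ j} → 1 ≤ i → i < i′ → suc j ≤ part lam i′ →
                      Inversion (ext i j) (ext i (suc j)) (ext i′ (suc j))
      ext-inversion {i} {i′} {j} a p q with suc j ≤? part mu i | suc j ≤? part mu i′
      ... | yes r | yes t = inj₂ (inj₂
        ( large-col {i} {i′} {suc j} p (proj₂ (part-pos {lam} {i′} (≤-trans (s≤s z≤n) q)))
        , <⇒≤ (subst (_< ext i j) (ext-mu {i} (s≤s z≤n) r) (ext-row a r))))
      ... | yes r | no  t = inj₂ (inj₂
        ( N<large i (suc j) (proj₂ (Fills.bounded f (≰⇒> t , q)))
        , <⇒≤ (subst (_< ext i j) (ext-mu {i} (s≤s z≤n) r) (ext-row a r))))
      ... | no  r | yes t = contradiction (≤-trans t (part-anti (proj₁ pm) a (<⇒≤ p))) r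
      ... | no  r | no  t = leftCase j (≰⇒> r , ≤-trans q (part-anti (proj₁ pl) a (<⇒≤ p))) (≰⇒> t , q)
        where
        third : ∀ {x b d} → d < b → b ≤ N → N < x → Inversion x b d
        third u v w = inj₂ (inj₂ (u , ≤-trans v (<⇒≤ w)))
        outside : ∀ {j} → InShape lam mu (i , suc j) → InShape lam mu (i′ , suc j) → ¬ InShape lam mu (i , j) → g i′ (suc j) < g i (suc j)
        outside {j} s t o with subst (λ z → Inversion z (g i (suc j)) (g i′ (suc j))) (orElse-no (inShape? lam mu (i , j)) o) (c p s t)
        ... | inj₁ (_ , w)        = contradiction (proj₂ (Fills.bounded f t)) (<⇒≱ (<-trans ≤-refl w))
        ... | inj₂ (inj₁ (w , _)) = contradiction (proj₂ (Fills.bounded f t)) (<⇒≱ (<-trans ≤-refl w))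
        ... | inj₂ (inj₂ (w , _)) = w
        leftCase : ∀ j → InShape lam mu (i , suc j) → InShape lam mu (i′ , suc j) → Inversion (ext i j) (g i (suc j)) (g i′ (suc j))
        leftCase zero s t = third (outside s t (λ (x , _) → contradiction x λ ())) (proj₂ (Fills.bounded f s)) (s≤s (m≤m+n N _))
        leftCase (suc j) s t with suc j ≤? part mu i
        ... | yes u = third (outside s t (λ (x , _) → <⇒≱ x u)) (proj₂ (Fills.bounded f s)) (N<large i (suc j) ≤-refl)
        ... | no  u = subst (λ z → Inversion z (g i (suc (suc j))) (g i′ (suc (suc j))))
          (orElse-yes (inShape? lam mu (i , suc j)) (≰⇒> u , <⇒≤ (proj₂ s))) (c p s t)

      key : ℕ → ℕ → ℕ
      key i j = K (ext i j) j

      -- Keys compare entries first and columns second. A tie between an entry and its left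
      -- neighbour thus puts the right one further left in the word, so that b ≤ a never counts as a
      -- wraparound.
      passed : ∀ {a b d j} → j < n → Inversion a b d → Passed (K a j) (K b (suc j)) (K d (suc j))
      passed {a} {b} {d} {j} p (inj₁ (q , r)) =
        (λ _ → inj₂ (<⇒≤ (K-< {a} {d} {j} {suc j} r))) , λ w → contradiction w (<⇒≯ (K-≤ {a} {b} p q))
      passed {a} {b} {d} {j} p (inj₂ (inj₁ (q , r))) =
        (λ w → contradiction w (<⇒≯ (K-< {a} {b} {j} {suc j} (<-trans q r)))) ,
        λ _ → K-< {a} {d} {j} {suc j} q , <⇒≤ (K-< {d} {b} {suc j} {suc j} r)
      passed {a} {b} {d} {j} p (inj₂ (inj₂ (q , r))) =
        (λ _ → inj₁ (<⇒≤ (K-< {d} {b} {suc j} {suc j} q))) , λ w → contradiction w (<⇒≯ (K-≤ {a} {b} p r))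

      -- `W` holds exactly the letters of the rows beyond `r`, under the keys of their boxes.
      -- Peeling one row leads from `r` to `r + 1`.
      record Below-row (r : ℕ) (W : Keyed) : Set where
        field
          sorted : Sorted W
          mem⁺   : ∀ {i j} → r < i → 1 ≤ j → j ≤ part lam i → (key i j , j) ∈ W
          mem⁻   : ∀ {p j} → (p , j) ∈ W → ∃[ i ] r < i × 1 ≤ j × j ≤ part lam i × p ≡ key i j

      -- The competitors of a box of this row are the boxes below it, and the inversion condition
      -- says that its entry comes first in the cyclic order from its left neighbour. The value of
      -- column 0 makes the scan start to the right of all letters.
      row-marking : ∀ {r W} → Below-row r W → Marking (part lam (suc r)) W (key (suc r))
      row-marking {r} {W} B = record
        { sorted = sorted
        ; range  = λ m → let i , a , b , d , _ = mem⁻ m in b , ≤-trans d (part-anti (proj₁ pl) (s≤s z≤n) a)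
        ; marked = λ j a b → mem⁺ ≤-refl a b
        ; greedy = greedy
        ; first  = λ m → first (mem⁻ m)
        }
        where
        open Below-row B
        first : ∀ {p j} → ∃[ i ] r < i × 1 ≤ j × j ≤ part lam i × p ≡ key i j → p < key (suc r) 0
        first {j = j} (i , a , b , d , refl) = K-< {ext i j} {huge} {j} {0} (ext-huge b d)
        greedy : ∀ {p} j → j < part lam (suc r) → (p , suc j) ∈ W → Passed (key (suc r) j) (key (suc r) (suc j)) p
        greedy {p} j j< m with mem⁻ m
        ... | i , a , b , d , refl with m≤n⇒m<n∨m≡n a
        ...   | inj₂ refl = (λ _ → inj₁ ≤-refl) , (λ w → w , ≤-refl)
        ...   | inj₁ a<   = passed (≤-trans j< (part≤n (s≤s z≤n))) (ext-inversion (s≤s z≤n) a< d)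

      row-unmarked : ∀ {r W} → Below-row r W → Below-row (suc r) (unmarked (key (suc r)) W)
      row-unmarked {r} {W} B = record
        { sorted = AllPairsₚ.filter⁺ (λ (p , i) → ¬? (p ≟ key (suc r) i)) sorted
        ; mem⁺   = λ {i} {j} a b d → ∈-filter⁺ (λ (p , i) → ¬? (p ≟ key (suc r) i)) (mem⁺ (<⇒≤ a) b d) (differ i j a b d)
        ; mem⁻   = λ m → shrink (∈-filter⁻ (λ (p , i) → ¬? (p ≟ key (suc r) i)) {xs = W} m)
        }
        where
        open Below-row B
        differ : ∀ i j → suc r < i → 1 ≤ j → j ≤ part lam i → key i j ≢ key (suc r) j
        differ i (suc j) a b d eq = inversion-≢ (ext-inversion {suc r} {i} {j} (s≤s z≤n) a d)
          (*-cancelʳ-≡ _ _ (suc n) (sym (+-cancelʳ-≡ (n ∸ suc j) _ _ eq)))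
        shrink : ∀ {p j} → (p , j) ∈ W × p ≢ key (suc r) j → ∃[ i ] suc r < i × 1 ≤ j × j ≤ part lam i × p ≡ key i j
        shrink (m , ne) with mem⁻ m
        ... | i , a , b , d , refl = i , ≤∧≢⇒< a (λ { refl → ne refl }) , b , d , refl

      rowTurns : ℕ → ℕ
      rowTurns i = turns (part lam i) (wrap (key i))

      rows-peel : ∀ ks r W → (∀ i → 1 ≤ i → part ks i ≡ part lam (r + i)) → Below-row r W →
        Peels ks (letters W) (sumTo (length ks) (λ i → rowTurns (r + i)))
      rows-peel []       r W eq B = []
      rows-peel (k ∷ ks) r W eq B = subst (Peels (k ∷ ks) (letters W)) stat
        (marking⇒peel (subst (λ z → Marking z W (key (suc r))) (sym k≡) (row-marking B))
         ∷ rows-peel ks (suc r) (unmarked (key (suc r)) W) eq′ (row-unmarked B))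
        where
        k≡ : k ≡ part lam (suc r)
        k≡ = trans (eq 1 ≤-refl) (cong (part lam) (+-comm r 1))
        eq′ : ∀ i → 1 ≤ i → part ks i ≡ part lam (suc r + i)
        eq′ (suc i) a = trans (eq (suc (suc i)) (s≤s z≤n)) (cong (part lam) (+-suc r (suc i)))
        stat : turns k (wrap (key (suc r))) + sumTo (length ks) (λ i → rowTurns (suc r + i)) ≡ sumTo (suc (length ks)) (λ i → rowTurns (r + i))
        stat = trans (cong₂ _+_ (trans (cong (λ z → turns z (wrap (key (suc r)))) k≡) (cong rowTurns (+-comm 1 r)))
                                (sumTo-cong (length ks) (λ i _ _ → cong rowTurns (sym (+-suc r i)))))
                     (sym (sumTo-suc (length ks) (λ i → rowTurns (r + i))))

      key-<⁺ : ∀ {i j} → ext i j < ext i (suc j) → key i j < key i (suc j)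
      key-<⁺ {i} {j} p = K-< {ext i j} {ext i (suc j)} {j} {suc j} p

      key-<⁻ : ∀ {i j} → j < n → key i j < key i (suc j) → ext i j < ext i (suc j)
      key-<⁻ {i} {j} b p = ≰⇒> λ le → <⇒≯ p (K-≤ {ext i j} {ext i (suc j)} b le)

      module _ {F : Filling} (g≡ : ∀ i j → entry mu F (i , j) ≡ g i j) where

        descents : ℕ → ℕ → ℕ
        descents i j = when (inShape? lam mu (i , j)) (when (descent? lam mu F (i , j)) (leg lam (i , j) + 1))

        -- A descent at (i, j + 1) contributes leg + 1 = λᵢ - j, the weight in `turns` of a
        -- wraparound after the letter j. Column 1 has no descents, which explains the upper limit
        -- `pred`.
        row-maj : ∀ i → 1 ≤ i → sumTo n (descents i) ≡ rowTurns i
        row-maj i a = begin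
          sumTo n (descents i)
            ≡⟨ sumTo-extend (descents i) (part≤n a) (λ j p _ → when-no (inShape? lam mu (i , j)) (λ s → <⇒≱ p (proj₂ s))) ⟩
          sumTo (part lam i) (descents i)
            ≡⟨ row (part lam i) refl ⟩
          sumTo (pred (part lam i)) (λ j → when (key i j <? key i (suc j)) (part lam i ∸ j))
            ≡⟨ sym (turns-when (part lam i) (λ j → key i j <? key i (suc j)) {wrap (key i)} (λ { (suc j) _ _ → refl })) ⟩
          rowTurns i ∎
          where
          open ≡-Reasoning
          in-shape⇒ : ∀ {j} → InShape lam mu (i , j) → suc j ≤ part lam i → InShape lam mu (i , suc j)
          in-shape⇒ s p = m<n⇒m<1+n (proj₁ s) , p
          when-0 : ∀ {P : Set} (d : Dec P) → when d 0 ≡ 0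
          when-0 (yes _) = refl
          when-0 (no _)  = refl
          step : ∀ j → 1 ≤ j → suc j ≤ part lam i → descents i (suc j) ≡ when (key i j <? key i (suc j)) (part lam i ∸ j)
          step j b d = by-left (inShape? lam mu (i , j))
            where
            ∸-suc : ∀ {l j} → suc j ≤ l → l ∸ j ≡ suc (l ∸ suc j)
            ∸-suc {suc l} {zero}  p       = refl
            ∸-suc {suc l} {suc j} (s≤s p) = ∸-suc p
            -- Inside μ and on leaving it the extended row decreases, so no wraparound occurs where
            -- `maj` admits no descent.
            desc : ¬ InShape lam mu (i , j) → Dec (suc j ≤ part mu i) → key i (suc j) < key i j
            desc ¬s (yes p) = K-< {ext i (suc j)} {ext i j} {suc j} {j} (ext-row a p)
            desc ¬s (no p)  = K-≤ {ext i j} {ext i (suc j)} (≤-trans d (part≤n a)) (≤-trans (<⇒≤ (s≤s (ext-≤ (≰⇒> p , d))))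
              (subst (suc N ≤_) (sym (ext-mu b (≮⇒≥ (λ lt → ¬s (lt , <⇒≤ d))))) (m≤m+n (suc N) _)))
            by-left : Dec (InShape lam mu (i , j)) → descents i (suc j) ≡ when (key i j <? key i (suc j)) (part lam i ∸ j)
            by-left (yes s) = trans (when-yes (inShape? lam mu (i , suc j)) (in-shape⇒ s d))
              (trans (when-cong (descent? lam mu F (i , suc j)) (key i j <? key i (suc j))
                (λ (_ , _ , lt) → key-<⁺ {i} {j} (subst₂ _<_ (trans (g≡ i j) (sym (ext-in s))) (trans (g≡ i (suc j)) (sym (ext-in (in-shape⇒ s d)))) lt))
                (λ lt → s , in-shape⇒ s d , subst₂ _<_ (trans (ext-in s) (sym (g≡ i j))) (trans (ext-in (in-shape⇒ s d)) (sym (g≡ i (suc j))))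
                  (key-<⁻ {i} {j} (≤-trans d (part≤n a)) lt)))
                (cong (when (key i j <? key i (suc j))) (trans (+-comm (part lam i ∸ suc j) 1) (sym (∸-suc d)))))
            by-left (no ¬s) = trans (cong (when (inShape? lam mu (i , suc j))) (when-no (descent? lam mu F (i , suc j)) (λ (s , _) → ¬s s)))
              (trans (when-0 (inShape? lam mu (i , suc j))) (sym (when-no (key i j <? key i (suc j))
                (<⇒≯ (desc ¬s (suc j ≤? part mu i))))))
          row : ∀ l → l ≡ part lam i → sumTo l (descents i) ≡ sumTo (pred l) (λ j → when (key i j <? key i (suc j)) (part lam i ∸ j))
          row zero    eq = refl
          row (suc l) eq = trans (sumTo-suc l (descents i)) (cong₂ _+_
            (when-0 (inShape? lam mu (i , 1)))
            (sumTo-cong l (λ j b d → step j b (≤-trans (s≤s d) (≤-reflexive eq)))))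

        maj≡ : maj lam mu F ≡ sumTo (length lam) rowTurns
        maj≡ = trans (sum-filter (descent? lam mu F) (λ b → leg lam b + 1) (boxes lam mu))
          (trans (sum-boxes lam mu (λ b → when (descent? lam mu F b) (leg lam b + 1)))
                 (sumTo-cong (length lam) (λ i a _ → row-maj i a)))

      module _ (n′ : ℕ) (n′≡ : n′ ≡ n) where

        m : Entries
        m = entriesOf g

        keyedRow : ℕ → ℕ → Keyed
        keyedRow v zero    = []
        keyedRow v (suc a) = replicate (m v (suc a)) (K v (suc a) , suc a) ++ keyedRow v a

        keyedMatrix : ℕ → Keyed
        keyedMatrix zero    = []
        keyedMatrix (suc v) = keyedMatrix v ++ keyedRow (suc v) n′

        keyedGroup : ℕ → ℕ → Keyed
        keyedGroup j zero    = []
        keyedGroup j (suc r) = (K (large (suc r) j) j , j) ∷ keyedGroup j r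

        keyedSuffix : ℕ → Keyed
        keyedSuffix zero    = []
        keyedSuffix (suc j) = keyedGroup (suc j) (part (conj mu) (suc j)) ++ keyedSuffix j

        whole : Keyed
        whole = keyedMatrix N ++ keyedSuffix (length (conj mu))

        letters-row : ∀ v a → letters (keyedRow v a) ≡ decrWord 0 (mkV a (m v))
        letters-row v zero    = refl
        letters-row v (suc a) = trans (map-++ proj₂ (replicate (m v (suc a)) (K v (suc a) , suc a)) _)
          (cong₂ _++_ (trans (map-replicate proj₂ (m v (suc a)) _) (cong (λ z → replicate (m v (suc a)) (suc z)) (sym (+-identityʳ a)))) (letters-row v a))

        letters-matrix : ∀ v → letters (keyedMatrix v) ≡ matrixWord (mkM n′ v m)
        letters-matrix zero    = refl
        letters-matrix (suc v) = trans (map-++ proj₂ (keyedMatrix v) _) (cong₂ _++_ (letters-matrix v) (letters-row (suc v) n′))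

        letters-suffix : letters (keyedSuffix (length (conj mu))) ≡ suffix (conj mu)
        letters-suffix = go (length (conj mu))
          where
          group : ∀ j r → letters (keyedGroup j r) ≡ replicate r j
          group j zero    = refl
          group j (suc r) = cong (j ∷_) (group j r)
          go : ∀ l → letters (keyedSuffix l) ≡ concatMap (λ i → replicate (part (conj mu) i) i) (reverse [1⋯ l ])
          go zero    = refl
          go (suc l) = begin
            letters (keyedGroup (suc l) (part (conj mu) (suc l)) ++ keyedSuffix l)
              ≡⟨ map-++ proj₂ (keyedGroup (suc l) (part (conj mu) (suc l))) _ ⟩
            letters (keyedGroup (suc l) (part (conj mu) (suc l))) ++ letters (keyedSuffix l)
              ≡⟨ cong₂ _++_ (group (suc l) (part (conj mu) (suc l))) (go l) ⟩
            concatMap (λ i → replicate (part (conj mu) i) i) (suc l ∷ reverse [1⋯ l ])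
              ≡⟨ cong (concatMap (λ i → replicate (part (conj mu) i) i)) (sym (reverse-++ [1⋯ l ] (suc l ∷ []))) ⟩
            concatMap (λ i → replicate (part (conj mu) i) i) (reverse ([1⋯ l ] ++ suc l ∷ []))
              ≡⟨ cong (concatMap (λ i → replicate (part (conj mu) i) i) ∘ reverse) (applyUpTo-∷ʳ suc l) ⟩
            concatMap (λ i → replicate (part (conj mu) i) i) (reverse [1⋯ suc l ]) ∎
            where open ≡-Reasoning

        letters-whole : letters whole ≡ matrixWord (mkM n′ N m) ++ suffix (conj mu)
        letters-whole = trans (map-++ proj₂ (keyedMatrix N) _) (cong₂ _++_ (letters-matrix N) letters-suffix)

        private
          ∈-replicate⁻ : ∀ {x y : ℕ × ℕ} d → x ∈ replicate d y → x ≡ y × 1 ≤ d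
          ∈-replicate⁻ (suc d) (here eq) = eq , s≤s z≤n
          ∈-replicate⁻ (suc d) (there p) = proj₁ (∈-replicate⁻ d p) , s≤s z≤n

          ∈-replicate⁺ : ∀ {y : ℕ × ℕ} d → 1 ≤ d → y ∈ replicate d y
          ∈-replicate⁺ (suc d) p = here refl

        row⁻ : ∀ v a {p j} → (p , j) ∈ keyedRow v a → 1 ≤ j × j ≤ a × 1 ≤ m v j × p ≡ K v j
        row⁻ v (suc a) q with ∈-++⁻ (replicate (m v (suc a)) (K v (suc a) , suc a)) q
        ... | inj₁ r with refl , e ← ∈-replicate⁻ (m v (suc a)) r = s≤s z≤n , ≤-refl , e , refl
        ... | inj₂ r with b , d , e , h ← row⁻ v a r = b , m≤n⇒m≤1+n d , e , h

        row⁺ : ∀ v a {j} → 1 ≤ j → j ≤ a → 1 ≤ m v j → (K v j , j) ∈ keyedRow v a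
        row⁺ v zero    b d e = contradiction d (<⇒≱ b)
        row⁺ v (suc a) b d e with m≤n⇒m<n∨m≡n d
        ... | inj₂ refl      = ∈-++⁺ˡ (∈-replicate⁺ (m v (suc a)) e)
        ... | inj₁ (s≤s j≤a) = ∈-++⁺ʳ (replicate (m v (suc a)) (K v (suc a) , suc a)) (row⁺ v a b j≤a e)

        matrix⁻ : ∀ w {p j} → (p , j) ∈ keyedMatrix w → ∃[ v ] 1 ≤ v × v ≤ w × 1 ≤ j × j ≤ n′ × 1 ≤ m v j × p ≡ K v j
        matrix⁻ (suc w) q with ∈-++⁻ (keyedMatrix w) q
        ... | inj₁ r with v , a , b , h ← matrix⁻ w r = v , a , m≤n⇒m≤1+n b , h
        ... | inj₂ r = suc w , s≤s z≤n , ≤-refl , row⁻ (suc w) n′ r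

        matrix⁺ : ∀ w {v j} → 1 ≤ v → v ≤ w → 1 ≤ j → j ≤ n′ → 1 ≤ m v j → (K v j , j) ∈ keyedMatrix w
        matrix⁺ zero    a b = contradiction b (<⇒≱ a)
        matrix⁺ (suc w) {v} a b d e h with m≤n⇒m<n∨m≡n b
        ... | inj₂ refl      = ∈-++⁺ʳ (keyedMatrix w) (row⁺ v n′ d e h)
        ... | inj₁ (s≤s v≤w) = ∈-++⁺ˡ (matrix⁺ w a v≤w d e h)

        group⁻ : ∀ j r {p l} → (p , l) ∈ keyedGroup j r → l ≡ j × ∃[ i ] 1 ≤ i × i ≤ r × p ≡ K (large i j) j
        group⁻ j (suc r) (here refl) = refl , suc r , s≤s z≤n , ≤-refl , refl
        group⁻ j (suc r) (there q) with e , i , a , b , h ← group⁻ j r q = e , i , a , m≤n⇒m≤1+n b , h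

        group⁺ : ∀ j r {i} → 1 ≤ i → i ≤ r → (K (large i j) j , j) ∈ keyedGroup j r
        group⁺ j zero    a b = contradiction b (<⇒≱ a)
        group⁺ j (suc r) a b with m≤n⇒m<n∨m≡n b
        ... | inj₂ refl      = here refl
        ... | inj₁ (s≤s i≤r) = there (group⁺ j r a i≤r)

        suffix⁻ : ∀ l {p j} → (p , j) ∈ keyedSuffix l → 1 ≤ j × j ≤ l × ∃[ i ] 1 ≤ i × i ≤ part (conj mu) j × p ≡ K (large i j) j
        suffix⁻ (suc l) q with ∈-++⁻ (keyedGroup (suc l) (part (conj mu) (suc l))) q
        ... | inj₁ r with refl , h ← group⁻ (suc l) (part (conj mu) (suc l)) r = s≤s z≤n , ≤-refl , h
        ... | inj₂ r with a , b , h ← suffix⁻ l r = a , m≤n⇒m≤1+n b , h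

        suffix⁺ : ∀ l {i j} → 1 ≤ j → j ≤ l → 1 ≤ i → i ≤ part (conj mu) j → (K (large i j) j , j) ∈ keyedSuffix l
        suffix⁺ zero    a b = contradiction b (<⇒≱ a)
        suffix⁺ (suc l) {i} {j} a b d e with m≤n⇒m<n∨m≡n b
        ... | inj₂ refl      = ∈-++⁺ˡ (group⁺ (suc l) (part (conj mu) (suc l)) d e)
        ... | inj₁ (s≤s j≤l) = ∈-++⁺ʳ (keyedGroup (suc l) (part (conj mu) (suc l))) (suffix⁺ l a j≤l d e)

        mu-box : ∀ {i j} → 1 ≤ i → 1 ≤ j → i ≤ part (conj mu) j → j ≤ part mu i
        mu-box a b = conj⁺ (proj₁ pm) a b

        entry-≤1 : ∀ v {j} → 1 ≤ j → m v j ≤ 1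
        entry-≤1 v a = count-unique {v} (greedy-unique-col (coinv⇒greedy c _ a))

        row-sorted : ∀ v a → a ≤ n → Sorted (keyedRow v a)
        row-sorted v zero    p = []
        row-sorted v (suc a) p with m v (suc a) | entry-≤1 v {suc a} (s≤s z≤n)
        ... | zero        | _ = row-sorted v a (<⇒≤ p)
        ... | suc zero    | _ = All.tabulate (λ {x} x∈ → smaller x (row⁻ v a x∈)) ∷ row-sorted v a (<⇒≤ p)
          where
          smaller : ∀ x → 1 ≤ proj₂ x × proj₂ x ≤ a × 1 ≤ m v (proj₂ x) × proj₁ x ≡ K v (proj₂ x) → K v (suc a) < proj₁ x
          smaller (_ , j) (_ , b , _ , refl) = +-monoʳ-< (v * suc n) (∸-monoʳ-< (s≤s b) p)
        ... | suc (suc _) | s≤s ()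

        matrix-sorted : ∀ w → Sorted (keyedMatrix w)
        matrix-sorted zero    = []
        matrix-sorted (suc w) = AllPairsₚ.++⁺ (matrix-sorted w) (row-sorted (suc w) n′ (≤-reflexive n′≡))
          (All.tabulate λ {x} x∈ → All.tabulate λ {y} y∈ → before x y (matrix⁻ w x∈) (row⁻ (suc w) n′ y∈))
          where
          before : ∀ x y → ∃[ v ] 1 ≤ v × v ≤ w × 1 ≤ proj₂ x × proj₂ x ≤ n′ × 1 ≤ m v (proj₂ x) × proj₁ x ≡ K v (proj₂ x) →
            1 ≤ proj₂ y × proj₂ y ≤ n′ × 1 ≤ m (suc w) (proj₂ y) × proj₁ y ≡ K (suc w) (proj₂ y) → proj₁ x < proj₁ y
          before (_ , j) (_ , l) (v , _ , b , _ , _ , _ , refl) (_ , _ , _ , refl) = K-< {v} {suc w} {j} {l} (s≤s b)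

        group-sorted : ∀ j r → r ≤ R → Sorted (keyedGroup j r)
        group-sorted j zero    p = []
        group-sorted j (suc r) p = All.tabulate (λ {x} x∈ → before x (group⁻ j r x∈)) ∷ group-sorted j r (<⇒≤ p)
          where
          before : ∀ x → proj₂ x ≡ j × ∃[ i ] 1 ≤ i × i ≤ r × proj₁ x ≡ K (large i j) j → K (large (suc r) j) j < proj₁ x
          before (_ , _) (refl , i , _ , b , refl) = K-< {large (suc r) j} {large i j} {j} {j} (large-col {i} {suc r} {j} (s≤s b) p)

        suffix-≤ : ∀ {i j} → 1 ≤ i → 1 ≤ j → i ≤ part (conj mu) j → j ≤ part lam i
        suffix-≤ {i} a b d = ≤-trans (mu-box a b d) (sub i)

        conj-length : ∀ {j} → 1 ≤ j → part (conj mu) j ≤ R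
        conj-length {j} a with part (conj mu) j in eq
        ... | zero  = z≤n
        ... | suc r = proj₂ (part-pos {lam} {suc r} (≤-trans a (suffix-≤ (s≤s z≤n) a (≤-reflexive (sym eq)))))

        suffix-sorted : ∀ l → l ≤ length (conj mu) → Sorted (keyedSuffix l)
        suffix-sorted zero    p = []
        suffix-sorted (suc l) p = AllPairsₚ.++⁺ (group-sorted (suc l) _ (conj-length {suc l} (s≤s z≤n))) (suffix-sorted l (<⇒≤ p))
          (All.tabulate λ {x} x∈ → All.tabulate λ {y} y∈ → before x y (group⁻ (suc l) (part (conj mu) (suc l)) x∈) (suffix⁻ l y∈))
          where
          before : ∀ x y → proj₂ x ≡ suc l × ∃[ i ] 1 ≤ i × i ≤ part (conj mu) (suc l) × proj₁ x ≡ K (large i (suc l)) (suc l) →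
            1 ≤ proj₂ y × proj₂ y ≤ l × ∃[ i ] 1 ≤ i × i ≤ part (conj mu) (proj₂ y) × proj₁ y ≡ K (large i (proj₂ y)) (proj₂ y) → proj₁ x < proj₁ y
          before (_ , _) (_ , j) (refl , i , a , b , refl) (_ , d , i′ , _ , _ , refl) =
            K-< {large i (suc l)} {large i′ j} {suc l} {j} (large-row {i} {i′} (s≤s d) (≤-trans (suffix-≤ a (s≤s z≤n) b) (part≤n a)))

        -- The keys increase along the word: matrix rows come by increasing entry, each by
        -- decreasing column. The values in μ exceed N and grow from column to column as the suffix
        -- descends to the letter 1.
        whole-below : Below-row 0 whole
        whole-below = record
          { sorted = AllPairsₚ.++⁺ (matrix-sorted N) (suffix-sorted _ ≤-refl)
              (All.tabulate λ {x} x∈ → All.tabulate λ {y} y∈ → before x y (matrix⁻ N x∈) (suffix⁻ (length (conj mu)) y∈))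
          ; mem⁺ = mem⁺
          ; mem⁻ = λ q → mem⁻ (∈-++⁻ (keyedMatrix N) q)
          }
          where
          before : ∀ x y → ∃[ v ] 1 ≤ v × v ≤ N × 1 ≤ proj₂ x × proj₂ x ≤ n′ × 1 ≤ m v (proj₂ x) × proj₁ x ≡ K v (proj₂ x) →
            1 ≤ proj₂ y × proj₂ y ≤ length (conj mu) × ∃[ i ] 1 ≤ i × i ≤ part (conj mu) (proj₂ y) × proj₁ y ≡ K (large i (proj₂ y)) (proj₂ y) → proj₁ x < proj₁ y
          before (_ , j) (_ , l) (v , _ , b , _ , _ , _ , refl) (_ , _ , i , _ , _ , refl) = K-< {v} {large i l} {j} {l} (N<large i l b)
          mem⁺ : ∀ {i j} → 0 < i → 1 ≤ j → j ≤ part lam i → (key i j , j) ∈ whole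
          mem⁺ {i} {j} a b d with j ≤? part mu i
          ... | yes p = ∈-++⁺ʳ (keyedMatrix N) (subst (λ z → (K z j , j) ∈ keyedSuffix (length (conj mu))) (sym (ext-mu b p))
            (suffix⁺ (length (conj mu)) b (proj₂ (part-pos {conj mu} (≤-trans a i≤))) a i≤))
            where i≤ = conj⁻ (proj₁ pm) a b p
          ... | no p = ∈-++⁺ˡ (subst (λ z → (K z j , j) ∈ keyedMatrix N) (sym (ext-in box))
            (matrix⁺ N (proj₁ (Fills.bounded f box)) (proj₂ (Fills.bounded f box)) b (≤-trans d (≤-trans (part≤n a) (≤-reflexive (sym n′≡))))
              (∈⇒count {g i j} (subst (λ z → g z j ∈ colOf g j) r (∈-map⁺ (λ k → g (head j + k) j) (∈-[1⋯]⁺ k l))))))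
            where
            box : InShape lam mu (i , j)
            box = ≰⇒> p , d
            k = proj₁ (in-height box)
            l = proj₁ (proj₂ (in-height box))
            r = proj₂ (proj₂ (in-height box))
          mem⁻ : ∀ {p j} → (p , j) ∈ keyedMatrix N ⊎ (p , j) ∈ keyedSuffix (length (conj mu)) → ∃[ i ] 0 < i × 1 ≤ j × j ≤ part lam i × p ≡ key i j
          mem⁻ {j = j} (inj₁ q) with v , _ , _ , a , _ , e , refl ← matrix⁻ N q
            with k , k∈ , refl ← ∈-map⁻ (λ k → g (head j + k) j) (count⇒∈ {v} (colOf g j) e)
            with x , y ← ∈-[1⋯]⁻ k∈ =
            head j + k , ≤-trans x (m≤n+m k (head j)) , a , proj₂ (in⁺ a x y) , cong (λ z → K z j) (sym (ext-in (in⁺ a x y)))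
          mem⁻ {j = j} (inj₂ q) with a , _ , i , x , y , refl ← suffix⁻ (length (conj mu)) q =
            i , x , a , suffix-≤ x a y , cong (λ z → K z j) (sym (ext-mu a (mu-box x a y)))

        maj-peels : ∀ {F} → (∀ i j → entry mu F (i , j) ≡ g i j) →
          Peels lam (matrixWord (mkM n′ N m) ++ suffix (conj mu)) (maj lam mu F)
        maj-peels {F} g≡ = subst₂ (Peels lam) letters-whole (sym (maj≡ {F} g≡)) (rows-peel lam 0 whole (λ _ _ → refl) whole-below)

-- Letter counts and the equality of `maj` and charge

open RSK
open Plactic
open TandemQueues
open Markings
open ChargeWords
open Shapes
open Sums
open Tableaux
open Correspondence
open ReadingWords
open CoinversionFree
open Matrices
open ExtendedFillings

count-rw : ∀ v F → count v (rw F) ≡ count v (concat F)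
count-rw v F = trans (count-concat v (reverse F)) (trans (sum-↭ (↭ₚ.map⁺ (count v) (↭ₚ.↭-reverse F))) (sym (count-concat v F)))

count-replicate : ∀ v r j → count v (replicate r j) ≡ when (v ≟ j) r
count-replicate v zero    j with v ≟ j
... | yes _ = refl
... | no _  = refl
count-replicate v (suc r) j = trans (count-∷ v j (replicate r j)) (trans (cong (when (v ≟ j) 1 +_) (count-replicate v r j)) (join (v ≟ j)))
  where
  join : ∀ {P : Set} (d : Dec P) → when d 1 + when d r ≡ when d (suc r)
  join (yes _) = refl
  join (no _)  = refl

count-suffix-sum : ∀ κ v → count v (suffix κ) ≡ sumTo (length κ) (λ i → when (v ≟ i) (part κ i))
count-suffix-sum κ v = go (length κ)
  where
  f : ℕ → Word
  f i = replicate (part κ i) i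
  go : ∀ l → count v (concatMap f (reverse [1⋯ l ])) ≡ sumTo l (λ i → when (v ≟ i) (part κ i))
  go zero    = refl
  go (suc l) = begin
    count v (concatMap f (reverse [1⋯ suc l ]))
      ≡⟨ cong (count v ∘ concatMap f) (trans (cong reverse (sym (applyUpTo-∷ʳ suc l))) (reverse-++ [1⋯ l ] (suc l ∷ []))) ⟩
    count v (f (suc l) ++ concatMap f (reverse [1⋯ l ]))
      ≡⟨ count-++ v (f (suc l)) _ ⟩
    count v (f (suc l)) + count v (concatMap f (reverse [1⋯ l ]))
      ≡⟨ cong₂ _+_ (count-replicate v (part κ (suc l)) (suc l)) (go l) ⟩
    when (v ≟ suc l) (part κ (suc l)) + sumTo l (λ i → when (v ≟ i) (part κ i))
      ≡⟨ +-comm (when (v ≟ suc l) (part κ (suc l))) _ ⟩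
    sumTo (suc l) (λ i → when (v ≟ i) (part κ i)) ∎
    where open ≡-Reasoning

count-suffix-zero : ∀ κ → count 0 (suffix κ) ≡ 0
count-suffix-zero κ = trans (count-suffix-sum κ 0) (sumTo-zero′ (length κ) λ { (suc i) _ _ → refl })

count-suffix : ∀ κ v → 1 ≤ v → count v (suffix κ) ≡ part κ v
count-suffix κ (suc l) _ = trans (count-suffix-sum κ (suc l)) (pick (suc l ≤? length κ))
  where
  f : ℕ → ℕ
  f i = when (suc l ≟ i) (part κ i)
  below : ∀ m → m < suc l → sumTo m f ≡ 0
  below m p = sumTo-zero′ m (λ i _ q → when-no (suc l ≟ i) (λ eq → <⇒≱ p (≤-trans (≤-reflexive eq) q)))
  pick : Dec (suc l ≤ length κ) → sumTo (length κ) f ≡ part κ (suc l)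
  pick (no p)  = trans (below (length κ) (≰⇒> p)) (sym (part-beyond {κ} (≰⇒> p)))
  pick (yes p) = trans (sumTo-extend f p (λ i q _ → when-no (suc l ≟ i) (λ eq → <-irrefl eq q)))
    (cong₂ _+_ (below l ≤-refl) (when-yes (suc l ≟ suc l) refl))

count-weight-zero : ∀ lam mu γ g v → Fills lam mu γ g → (v ≡ 0 ⊎ length γ < v) → weight lam mu g v ≡ 0
count-weight-zero lam mu γ g v f out = sumTo-zero′ (length lam) (λ i _ _ → sumTo-zero′ (rowLength lam mu i) (λ k a b →
  when-no (v ≟ g i (part mu i + k)) (λ eq → avoid out (Fills.bounded f (row-inShape lam mu i a b)) eq)))
  where
  avoid : ∀ {x} → v ≡ 0 ⊎ length γ < v → 1 ≤ x × x ≤ length γ → v ≢ x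
  avoid (inj₁ refl) (a , b) refl = contradiction a λ ()
  avoid (inj₂ q)    (a , b) refl = <⇒≱ q b

count-ssyt : ∀ {nu α T} → IsPartition nu → T ∈ SSYT nu α → ∀ v → 1 ≤ v → count v (rw T) ≡ part α v
count-ssyt {nu} {α} {T} P T∈ v a with SSYT⁻ P T∈
... | eq , f , _ = trans (count-rw v T) (trans (cong (count v ∘ concat) (sym eq)) (trans (count-mk nu [] _ v) (weights (v ≤? length α))))
  where
  weights : Dec (v ≤ length α) → weight nu [] (λ i j → entry [] T (i , j)) v ≡ part α v
  weights (yes p) = Fills.weights f v a p
  weights (no p)  = trans (count-weight-zero nu [] α _ v f (inj₂ (≰⇒> p))) (sym (part-beyond {α} (≰⇒> p)))

count-ssyt-zero : ∀ {nu α T} → IsPartition nu → T ∈ SSYT nu α → count 0 (rw T) ≡ 0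
count-ssyt-zero {nu} {α} {T} P T∈ with SSYT⁻ P T∈
... | eq , f , _ = trans (count-rw 0 T) (trans (cong (count 0 ∘ concat) (sym eq)) (trans (count-mk nu [] _ 0) (count-weight-zero nu [] α _ 0 f (inj₁ refl))))

-- The content is the conjugate of `lam`, cut off at the largest letter, which is the first part of
-- `lam`; conjugating it again returns `lam`.
charge-lengths : ∀ {lam} w → IsPartition lam → (∀ j → 1 ≤ j → count j w ≡ atLeast j lam) → conj (content (max 0 w) w) ≡ lam
charge-lengths {lam} w p cnt = trans (cong conj content≡) (conj-involutive p)
  where
  d = proj₁ p
  bounded : ∀ {j} → j ∈ w → j ≤ part lam 1
  bounded {zero}  j∈ = z≤n
  bounded {suc j} j∈ = atLeast⁺ d ≤-refl (s≤s z≤n) (≤-trans (∈⇒count j∈) (≤-reflexive (cnt (suc j) (s≤s z≤n))))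
  attained : ∀ l → l ≡ part lam 1 → l ≤ max 0 w
  attained zero    eq = z≤n
  attained (suc l) eq = All.lookup (xs≤max 0 w) (count⇒∈ w (≤-trans (atLeast⁻ d ≤-refl (s≤s z≤n) (≤-reflexive eq)) (≤-reflexive (sym (cnt (suc l) (s≤s z≤n))))))
  max≡ : max 0 w ≡ part lam 1
  max≡ = ≤-antisym (max≤v⁺ z≤n (All.tabulate bounded)) (attained (part lam 1) refl)
  content≡ : content (max 0 w) w ≡ conj lam
  content≡ = trans (cong (λ z → content z w) max≡)
    (map-cong-[1⋯] (part lam 1) (λ j a _ → trans (cnt j a) (sym (length-filter-≤ d j))))

module _ {lam mu : List ℕ} (pl : IsPartition lam) (pm : IsPartition mu) (sub : mu ⊆ lam) where
  private
    αs : List ℕ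
    αs = columnLengths lam mu
    conj-sub : ∀ j → 1 ≤ j → part (conj mu) j ≤ part (conj lam) j
    conj-sub j a with part (conj mu) j in eq
    ... | zero  = z≤n
    ... | suc i = conj⁻ (proj₁ pl) (s≤s z≤n) a (≤-trans (conj⁺ (proj₁ pm) (s≤s z≤n) a (≤-reflexive (sym eq))) (sub (suc i)))
    α≡ : ∀ j → 1 ≤ j → part αs j ≡ part (conj lam) j ∸ part (conj mu) j
    α≡ j a with j ≤? part lam 1
    ... | yes p = at-map-[1⋯] (λ i → part (conj lam) i ∸ part (conj mu) i) a p
    ... | no p  = trans (part-beyond {αs} (≤-trans (s≤s (≤-reflexive (trans (length-map _ [1⋯ part lam 1 ]) (length-applyUpTo suc _)))) (≰⇒> p)))
      (sym (trans (cong (_∸ part (conj mu) j) (part-beyond {conj lam} (≤-trans (s≤s (≤-reflexive (trans (length-map _ [1⋯ part lam 1 ]) (length-applyUpTo suc _)))) (≰⇒> p)))) (0∸n≡0 (part (conj mu) j))))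

  -- Letter j occurs λ′ⱼ - μ′ⱼ times in T and μ′ⱼ times in the suffix. The subwords therefore have
  -- the lengths of the rows of λ, like those peeled from the filling.
  charge-tableau : ∀ {nu T} → IsPartition nu → T ∈ SSYT nu αs → Peels lam (rw T ++ suffix (conj mu)) (tableauCharge (conj mu) T)
  charge-tableau {nu} {T} P T∈ =
    subst (λ z → Peels lam w (sum (map permCharge (standardSubwords z w)))) (sym (charge-lengths w pl cnt))
      (charge-peels lam w (proj₁ pl) pos cnt)
    where
    w : Word
    w = rw T ++ suffix (conj mu)
    cnt : ∀ j → 1 ≤ j → count j w ≡ atLeast j lam
    cnt j a = begin
      count j w                                       ≡⟨ count-++ j (rw T) _ ⟩
      count j (rw T) + count j (suffix (conj mu))     ≡⟨ cong₂ _+_ (trans (count-ssyt P T∈ j a) (α≡ j a)) (count-suffix (conj mu) j a) ⟩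
      part (conj lam) j ∸ part (conj mu) j + part (conj mu) j ≡⟨ m∸n+n≡m (conj-sub j a) ⟩
      part (conj lam) j                               ≡⟨ part-conj (proj₁ pl) a ⟩
      atLeast j lam                                   ∎
      where open ≡-Reasoning
    pos : ∀ {j} → j ∈ w → 1 ≤ j
    pos {suc j} _  = s≤s z≤n
    pos {zero}  j∈ with ∈-++⁻ (rw T) j∈
    ... | inj₁ q = contradiction (∈⇒count q) (<⇒≱ (s≤s (≤-reflexive (count-ssyt-zero P T∈))))
    ... | inj₂ q = contradiction (∈⇒count q) (<⇒≱ (s≤s (≤-reflexive (count-suffix-zero (conj mu)))))

  module _ (γ : List ℕ) where
    open Triples αs γ
    open Extended lam mu pl pm sub γ using (maj-peels)
    open Columns lam mu pl pm γ using (COF⁻; n)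

    cof≃triple : (_∈ COF lam mu γ) ≃ IsTriple
    cof≃triple = ≃-trans (cof≃matrix lam mu pl pm γ) (≃-trans (matrix≃good αs γ) good≃triple)

    -- Both sides are values of `Peels` for the parts of λ, on words that are Knuth equivalent by
    -- dual RSK; appending the common suffix preserves the equivalence.
    maj≡charge : ∀ {F} → F ∈ COF lam mu γ → maj lam mu F ≡ tableauCharge (conj mu) (proj₂ (proj₂ (_≃_.to cof≃triple F)))
    maj≡charge {F} F∈ with COF⁻ F∈
    ... | _ , f , c = peels-unique (proj₁ pl) same (maj-peels f c (length αs) n≡ {F} (λ _ _ → refl)) (charge-tableau (proj₁ y) (proj₂ (proj₂ y)))
      where
      M = matrixOf lam mu pl pm γ F
      M-good = _≃_.to-⊢ (cof≃matrix lam mu pl pm γ) F∈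
      x = rsk M
      x-good = _≃_.to-⊢ (matrix≃good αs γ) M-good
      y = toTriple-⊢ x-good
      n≡ : length αs ≡ n
      n≡ = trans (length-map _ [1⋯ n ]) (length-applyUpTo suc n)
      same : ∀ k → act (matrixWord M ++ suffix (conj mu)) k ≐ act (rw (proj₂ (proj₂ (toTriple x))) ++ suffix (conj mu)) k
      same k j = trans (sym (act-plactic (~-++ʳ (suffix (conj mu)) (rsk-~ (proj₁ M-good))) k j))
        (cong (λ w → act (w ++ suffix (conj mu)) k j) (sym (rw-toTriple αs γ x-good)))

    -- Places `nu` among the partitions of |λ/μ|: the chain of T adds the parts of `αs` one by one,
    -- and these are the column lengths of the skew shape.
    size : ∀ {y} → IsTriple y → sum (proj₁ y) ≡ length (boxes lam mu)
    size {nu , Q , T} y = begin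
      sum nu                              ≡⟨ cong sum (sym (tabulate-at nu)) ⟩
      sum (map (part nu) [1⋯ length nu ]) ≡⟨ sum-[1⋯] (part nu) (length nu) ⟩
      sumTo (length nu) (part nu)         ≡⟨ sym (sumTo-extend (part nu) (m≤m⊔n (length nu) (length αs)) (λ i p _ → part-beyond {nu} p)) ⟩
      sumTo (length nu ⊔ length αs) (part nu)
        ≡⟨ sumTo-extend (part nu) (m≤n⊔m (length nu) (length αs)) (λ i p _ → trans (sym (f-end i (≤-trans (s≤s z≤n) p))) (f-beyond (length αs) i ≤-refl p)) ⟩
      sumTo (length αs) (part nu)         ≡⟨ sumTo-cong (length αs) (λ i a _ → sym (f-end i a)) ⟩
      sumTo (length αs) (f (length αs))   ≡⟨ sizes (length αs) ≤-refl ⟩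
      sumTo (length αs) (part αs)         ≡⟨ cong (λ z → sumTo z (part αs)) (trans (length-map _ [1⋯ part lam 1 ]) (length-applyUpTo suc (part lam 1))) ⟩
      sumTo n (part αs)                   ≡⟨ sumTo-cong n (λ j a b → trans (αs-part j a b) (sym (col-count j))) ⟩
      -- The constant filling 1 makes the number of boxes a weight, for which the counts by columns
      -- and by rows are known to agree.
      sumTo n (λ j → count 1 (colOf (λ _ _ → 1) j)) ≡⟨ sym (weight-columns (λ _ _ → 1) 1) ⟩
      weight lam mu (λ _ _ → 1) 1
        ≡⟨ sumTo-cong (length lam) (λ i a _ → sumTo-row lam mu i (λ _ → 1) (part-anti (proj₁ pl) ≤-refl a)) ⟩
      sumTo (length lam) (λ i → sumTo n (λ j → when (inShape? lam mu (i , j)) 1))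
        ≡⟨ sym (sum-boxes lam mu (λ _ → 1)) ⟩
      sum (map (λ _ → 1) (boxes lam mu)) ≡⟨ sum-ones (boxes lam mu) ⟩
      length (boxes lam mu)               ∎
      where
      open ≡-Reasoning
      open Columns lam mu pl pm γ using (height; colOf; weight-columns)
      open Chains (triple-chains y)
      αs-part : ∀ j → 1 ≤ j → j ≤ n → part αs j ≡ height j
      αs-part j a b = at-map-[1⋯] height a b
      f : ℕ → ℕ → ℕ
      f = chainT (nu , Q , T)
      f-end : ∀ i → 1 ≤ i → f (length αs) i ≡ part nu i
      f-end i a = Galois.end (proj₁ (triple-match y i a))
      sizes : ∀ a → a ≤ length αs → sumTo a (f a) ≡ sumTo a (part αs)
      sizes zero    p = refl
      sizes (suc a) p = trans (f-size a p) (cong (_+ part αs (suc a)) (sizes a (<⇒≤ p)))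
      sum-ones : ∀ {A : Set} (xs : List A) → sum (map (λ _ → 1) xs) ≡ length xs
      sum-ones []       = refl
      sum-ones (x ∷ xs) = cong suc (sum-ones xs)
      col-count : ∀ j → count 1 (colOf (λ _ _ → 1) j) ≡ height j
      col-count j = trans (count-map 1 (λ _ → 1) [1⋯ height j ]) (trans (sum-ones [1⋯ height j ]) (length-applyUpTo suc _))

-- Enumeration of partitions and the final summation

∈-extend : ∀ {xs} → All (0 <_) xs → ∀ {n} → sum xs ≡ suc n → ∃[ ys ] All (0 <_) ys × sum ys ≡ n × xs ∈ extend ys
∈-extend {suc zero ∷ []}      (p ∷ ps) refl = [] , [] , refl , here refl
∈-extend {suc zero ∷ y ∷ ys}  (p ∷ ps) refl = y ∷ ys , ps , refl , here refl
∈-extend {suc (suc x) ∷ ys}   (p ∷ ps) refl = suc x ∷ ys , s≤s z≤n ∷ ps , refl , there (here refl)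

compositions⁺ : ∀ n {xs} → All (0 <_) xs → sum xs ≡ n → xs ∈ compositions n
compositions⁺ zero    {[]} [] refl = here refl
compositions⁺ zero    {suc x ∷ xs} (p ∷ ps) ()
compositions⁺ (suc n) ps eq with ∈-extend ps eq
... | ys , qs , e , xs∈ = ∈-concatMap⁺ extend (Any.map (λ { refl → xs∈ }) (compositions⁺ n qs e))

concatMap⁻ : ∀ {A B : Set} (f : A → List B) xs {y} → y ∈ concatMap f xs → ∃[ x ] x ∈ xs × y ∈ f x
concatMap⁻ f (x ∷ xs) p with ∈-++⁻ (f x) p
... | inj₁ q = x , here refl , q
... | inj₂ q with z , r , t ← concatMap⁻ f xs q = z , there r , t

-- `g` recovers the block from which an element comes, so different blocks are disjoint.
concatMap-unique : ∀ {A B : Set} (f : A → List B) (g : B → A) {xs} → Unique xs →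
  (∀ {x} → x ∈ xs → Unique (f x)) → (∀ {x y} → x ∈ xs → y ∈ f x → g y ≡ x) → Unique (concatMap f xs)
concatMap-unique f g {[]}     u p q = []
concatMap-unique f g {x ∷ xs} (n ∷ u) p q = Uniqueₚ.++⁺ (p (here refl)) (concatMap-unique f g u (p ∘ there) (q ∘ there)) disjoint
  where
  disjoint : ∀ {y} → ¬ (y ∈ f x × y ∈ concatMap f xs)
  disjoint (r , t) with z , z∈ , w ← concatMap⁻ f xs t =
    All.lookup n z∈ (trans (sym (q (here refl) r)) (q (there z∈) w))

compositions-pos : ∀ n {xs} → xs ∈ compositions n → All (0 <_) xs
compositions-pos zero    (here refl) = []
compositions-pos (suc n) p with concatMap⁻ extend (compositions n) p
... | []     , q , here refl         = s≤s z≤n ∷ []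
... | y ∷ ys , q , here refl         = s≤s z≤n ∷ compositions-pos n q
... | y ∷ ys , q , there (here refl) = s≤s z≤n ∷ All.tail (compositions-pos n q)

-- Undoes both branches of `extend` on positive parts: a first part 1 is dropped, a larger one is
-- lowered.
unextend : List ℕ → List ℕ
unextend []                 = []
unextend (suc (suc x) ∷ xs) = suc x ∷ xs
unextend (x ∷ xs)           = xs

compositions-unique : ∀ n → Unique (compositions n)
compositions-unique zero    = [] ∷ []
compositions-unique (suc n) = concatMap-unique extend unextend (compositions-unique n)
  (λ p → single (compositions-pos n p)) (λ p → back (compositions-pos n p))
  where
  single : ∀ {xs} → All (0 <_) xs → Unique (extend xs)
  single {[]}         ps = [] ∷ []
  single {zero ∷ xs}  (() ∷ _)
  single {suc x ∷ xs} ps = ((λ ()) ∷ []) ∷ [] ∷ []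
  back : ∀ {xs ys} → All (0 <_) xs → ys ∈ extend xs → unextend ys ≡ xs
  back {[]}         ps (here refl)         = refl
  back {zero ∷ xs}  (() ∷ _)
  back {suc x ∷ xs} ps (here refl)         = refl
  back {suc x ∷ xs} ps (there (here refl)) = refl

map-unique : ∀ {A B : Set} (f : A → B) {xs} → Unique xs → (∀ {x y} → x ∈ xs → y ∈ xs → f x ≡ f y → x ≡ y) → Unique (map f xs)
map-unique f {[]}     u p = []
map-unique f {x ∷ xs} (n ∷ u) p = All.tabulate fresh ∷ map-unique f u (λ a b → p (there a) (there b))
  where
  fresh : ∀ {y} → y ∈ map f xs → f x ≢ y
  fresh y∈ eq with z , z∈ , refl ← ∈-map⁻ f y∈ = All.lookup n z∈ (p (here refl) (there z∈) eq)

sum-concatMap : ∀ {A B : Set} (h : B → ℕ) (f : A → List B) xs → sum (map h (concatMap f xs)) ≡ sum (map (λ x → sum (map h (f x))) xs)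
sum-concatMap h f []       = refl
sum-concatMap h f (x ∷ xs) = trans (cong sum (map-++ h (f x) _)) (trans (sum-++ (map h (f x)) _) (cong (sum (map h (f x)) +_) (sum-concatMap h f xs)))

sum-const : ∀ {A : Set} c (xs : List A) → sum (map (λ _ → c) xs) ≡ length xs * c
sum-const c []       = refl
sum-const c (x ∷ xs) = cong (c +_) (sum-const c xs)

theorem34 : (lam mu : List ℕ) → IsPartition lam → IsPartition mu → mu ⊆ lam →
    E lam mu ≈
    (Σx[ nu ∈ partitions (length (boxes lam mu)) ]
    (s (conj nu) ·
    (Σq[ T ∈ SSYT nu (columnLengths lam mu) ] q^ tableauCharge (conj mu) T)))
theorem34 lam mu pl pm sub γ k = begin
  sum (map (λ F → (q^ maj lam mu F) k) (COF lam mu γ))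
    ≡⟨ cong sum (map-cong-local (All.tabulate λ F∈ → cong (λ z → (q^ z) k) (maj≡charge pl pm sub γ F∈))) ⟩
  sum (map (weigh ∘ to) (COF lam mu γ))
    ≡⟨ cong sum (map-∘ (COF lam mu γ)) ⟩
  sum (map weigh (map to (COF lam mu γ)))
    ≡⟨ sum-↭ (↭ₚ.map⁺ weigh bijection) ⟩
  sum (map weigh triples)
    ≡⟨ sum-concatMap weigh (λ nu → map (nu ,_) (pairs nu)) (partitions m) ⟩
  sum (map (λ nu → sum (map weigh (map (nu ,_) (pairs nu)))) (partitions m))
    ≡⟨ cong sum (map-cong product (partitions m)) ⟩
  sum (map (λ nu → s (conj nu) γ * sum (map (λ T → (q^ tableauCharge (conj mu) T) k) (SSYT nu αs))) (partitions m)) ∎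
  where
  open ≡-Reasoning
  αs : List ℕ
  αs = columnLengths lam mu
  m : ℕ
  m = length (boxes lam mu)
  open Triples αs γ
  open _≃_ (cof≃triple pl pm sub γ)
  weigh : Triple → ℕ
  weigh (_ , _ , T) = (q^ tableauCharge (conj mu) T) k
  pairs : List ℕ → List (Filling × Filling)
  pairs nu = cartesianProduct (SSYT (conj nu) γ) (SSYT nu αs)
  triples : List Triple
  triples = concatMap (λ nu → map (nu ,_) (pairs nu)) (partitions m)
  ssyt-unique : ∀ nu α → Unique (SSYT nu α)
  ssyt-unique nu α = Uniqueₚ.filter⁺ (isSemistandard? nu) (fillings-unique nu [] α)
  triples-unique : Unique triples
  triples-unique = concatMap-unique (λ nu → map (nu ,_) (pairs nu)) proj₁
    (Uniqueₚ.filter⁺ isPartition? (compositions-unique m))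
    (λ {nu} _ → Uniqueₚ.map⁺ (λ { refl → refl }) (Uniqueₚ.cartesianProduct⁺ (ssyt-unique (conj nu) γ) (ssyt-unique nu αs)))
    (λ {nu} _ y∈ → cong proj₁ (proj₂ (proj₂ (∈-map⁻ (nu ,_) y∈))))
  triples⁺ : ∀ {y} → IsTriple y → y ∈ triples
  triples⁺ {nu , Q , T} y@(P , Q∈ , T∈) = ∈-concatMap⁺ (λ nu → map (nu ,_) (pairs nu))
    (Any.map (λ { refl → ∈-map⁺ (nu ,_) (∈-cartesianProduct⁺ Q∈ T∈) })
      (∈-filter⁺ isPartition? (compositions⁺ m (proj₂ P) (size pl pm sub γ y)) P))
  triples⁻ : ∀ {y} → y ∈ triples → IsTriple y
  triples⁻ y∈ with nu , nu∈ , z ← concatMap⁻ (λ nu → map (nu ,_) (pairs nu)) (partitions m) y∈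
              with (Q , T) , w , refl ← ∈-map⁻ (nu ,_) z
              with Q∈ , T∈ ← ∈-cartesianProduct⁻ (SSYT (conj nu) γ) (SSYT nu αs) w =
    proj₂ (∈-filter⁻ isPartition? {xs = compositions m} nu∈) , Q∈ , T∈
  -- Both lists are free of repetitions and have the same members.
  bijection : map to (COF lam mu γ) ↭ triples
  bijection = unique-↭
    (map-unique to (Uniqueₚ.filter⁺ (isCOF? lam mu) (fillings-unique lam mu γ))
      (λ x∈ y∈ eq → trans (sym (from∘to x∈)) (trans (cong from eq) (from∘to y∈))))
    triples-unique
    (λ y∈ → let F , F∈ , eq = ∈-map⁻ to y∈ in triples⁺ (subst IsTriple (sym eq) (to-⊢ F∈)))
    (λ y∈ → let y = triples⁻ y∈ in subst (_∈ map to (COF lam mu γ)) (to∘from y) (∈-map⁺ to (from-⊢ y)))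
  -- The weight does not involve Q, so the tableaux Q of the conjugate shape contribute the
  -- coefficient of the Schur function as a factor.
  product : ∀ nu → sum (map weigh (map (nu ,_) (pairs nu))) ≡
    s (conj nu) γ * sum (map (λ T → (q^ tableauCharge (conj mu) T) k) (SSYT nu αs))
  product nu = trans (cong sum (sym (map-∘ (pairs nu))))
    (trans (sum-cartesianProduct _ (SSYT (conj nu) γ) (SSYT nu αs)) (sum-const _ (SSYT (conj nu) γ)))
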